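{- For every positive integer $n$: if $n\equiv 0$ or $2\pmod 3$ and $n\notin\{3,9,21\}$, then $N(0,3;n)<N(1,3;n)$; if $n\equiv1\pmod3$, then $N(0,3;n)>N(1,3;n)$. Moreover, for $n\in\{3,9,21\}$ one has $N(0,3;n)=N(1,3;n)$.
   Context: $N(a,c;n)$ denotes the number of partitions of $n$ whose rank (the largest part minus the number of parts) is congruent to $a$ modulo $c$. -}

module Defs where

open import Data.Nat using (ℕ; zero; suc; _+_; _∸_; _≤?_; NonZero)
open import Data.Nat.Properties using (_≟_)
open import Data.Integer using (ℤ; +_; _-_)
open import Data.Integer.DivMod using (_%ℕ_)
open import Data.List using (List; []; _∷_; length; filter; map; concatMap; downFrom; sum; head)
open import Data.Maybe using (Maybe; just; nothing)
open import Relation.Nullary using (Dec; yes; no)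

-- A partition is represented as a non-increasing list of positive parts.
-- partsBounded m n : all partitions of n whose parts are all ≤ m,
-- listed as non-increasing lists of positive integers (each exactly once).
-- Defined by structural recursion on a fuel argument f (f ≥ n suffices).
partsBounded : (fuel m n : ℕ) → List (List ℕ)
partsBounded _        _ zero    = [] ∷ []
partsBounded zero     _ (suc _) = []
partsBounded (suc f)  m (suc n) =
  concatMap (λ k → choose k) (map suc (downFrom m))
  where
    choose : ℕ → List (List ℕ)
    choose k with k ≤? suc n
    ... | yes _ = map (k ∷_) (partsBounded f k (suc n ∸ k))
    ... | no  _ = []

partitions : ℕ → List (List ℕ)
partitions n = partsBounded n n n

-- Largest part (0 for the empty partition; parts are listed non-increasingly).
largestPart : List ℕ → ℕ
largestPart []      = 0
largestPart (x ∷ _) = x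

rank : List ℕ → ℤ
rank p = + largestPart p - + length p

N : (a : ℤ) (c : ℕ) .{{_ : NonZero c}} (n : ℕ) → ℕ
N a c n = length (filter (λ p → ((rank p - a) %ℕ c) ≟ 0) (partitions n))

{-# OPTIONS --safe #-}
-- Dyson's recurrence for the number H m of partitions of rank at most m expresses the generating function of H m as
-- the partition generating function times a partial theta series. Multiplied by Σ (-1)^k q^(3k(k-1)/2), the sum over all k
-- collapses, by the pentagonal number theorem, to a sparse sum of monomials: E t = F t + F (1 - t). Summing over t with
-- weights modulo 3 and inverting the remaining theta factor (its product with 1/(q⁹;q⁹)_∞ is 2) gives
--   Σ (N(0,3;n) - N(1,3;n)) qⁿ = 1/(q⁹;q⁹)_∞ Σ_{r,v≥0} (-1)^r ω(r+v) q^(3r(r+1)/2) (q^((3r+1)v) + q^((3r+2)(v+1)))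
-- with ω of period 3 and values 1, 1, -2. In a fixed residue class of n the coefficient is a combination of sums of the
-- partition function p along arithmetic progressions, alternating and decreasing along r ↦ r + 3. Truncating the alternating
-- sums and comparing the few remaining progressions term by term, with p increasing and p(m) ≤ p(m-1) + p(m-2), gives the signs.
module Submission where

open import Defs
open import Data.Nat using (ℕ; suc; _<_; _>_; _%_)
open import Data.Integer using (+_)
open import Data.Product using (_×_)
open import Data.Sum using (_⊎_)
open import Relation.Binary.PropositionalEquality using (_≡_; _≢_)

import Data.Nat as ℕ
open import Data.Nat using (NonZero; z≤n; s≤s)
import Data.Nat.Properties as ℕₚ
open import Data.Nat.DivMod using (m≡m%n+[m/n]*n; m%n<n; [m+kn]%n≡m%n)
open import Data.Nat.Tactic.RingSolver using () renaming (solve-∀ to ℕ-solve-∀)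
import Data.Integer as ℤ
open import Data.Integer using (ℤ; -[1+_]; 0ℤ; 1ℤ; -1ℤ; ∣_∣; _+_; _*_; _-_; -_; _≤_; +≤+; -≤+; _%ℕ_; _/ℕ_)
import Data.Integer.Properties as ℤₚ
open import Data.Integer.Properties using (*-assoc; *-distribʳ-+; *-distribˡ-+; *-identityʳ; *-identityˡ; *-zeroʳ; +-assoc; +-comm; +-identityʳ; +-identityˡ; +-injective; +-inverseʳ; +-mono-≤; +-monoʳ-≤; +-monoˡ-≤; +∣i∣≡i⊎+∣i∣≡-i; -1*i≡-i; 0≤i-j⇒j≤i; [+m]-[+n]≡m⊖n; drop‿+≤+; i-j≡0⇒i≡j; i<j⇒suc[i]≤j; i≡j⇒i-j≡0; i≤j⇒0≤j-i; i≤j⇒i-j≤0; neg-distribʳ-*; neg-distribˡ-*; neg-involutive; neg-mono-≤; pos-*; pos-+; ∣-i∣≡∣i∣; ∣i*j∣≡∣i∣*∣j∣; ∣i+j∣≤∣i∣+∣j∣; ∣i-j∣≤∣i∣+∣j∣; ∣i∣≡0⇒i≡0; ∣m⊝n∣≤m⊔n; ≤-refl; ≤-reflexive; ≤-trans; ≤⇒≯; ≰⇒>; ⊖-≥)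
open import Data.Integer.DivMod using (n%ℕd<d; a≡a%ℕn+[a/ℕn]*n)
open import Data.Integer.Tactic.RingSolver using (solve-∀)
open import Data.List using (List; []; _∷_; _++_; length; map; concatMap; downFrom; filter)
open import Data.Product using (Σ; _,_; proj₁; proj₂)
open import Data.Sum as Sum using (inj₁; inj₂)
open import Data.Empty using (⊥-elim)
open import Function using (_∘_)
open import Relation.Nullary using (Dec; yes; no; ¬_)
open import Relation.Binary.PropositionalEquality using (refl; sym; trans; cong; cong₂; subst; subst₂; module ≡-Reasoning)

-- Finitely supported sums over ℤ

-- Why the theta factor `Σ (-1)^k q^(3k(k-1)/2)`: written out, the product is a sum over pairs
-- `(k, n)` whose exponent has a quadratic part symmetric in `k` and `n`. With `k` fixed or with `n`
-- fixed the sum over the other variable is the same series `D y`, and at every integer `y` that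
-- series is a signed monomial or 0, by a shift or a reflection of the pentagonal number series. A
-- power series is represented by its coefficient function on ℤ and a product by a sum over ℤ, so
-- each exchange or reindexing costs a bound on a support. The bounds come from completing quadratic
-- forms to sums of squares. The numbers 3, 9 and 21 arise in the last step. After the progressions
-- are compared, the class `9m` rests on `p(m-5) < p(m-2)` and the class `9m+3` on
-- `p(m-2) < p(m-1)`. For positive numbers the first fails exactly at `m = 1`, the second exactly at
-- `m = 0` and at `m = 2`, where it would say `p(0) < p(1)`.

record FinSupp (f : ℤ → ℤ) : Set where
  no-eta-equality
  constructor finSupp
  field
    bound  : ℕ
    within : ∀ i → f i ≡ 0ℤ ⊎ ∣ i ∣ ℕ.≤ bound
open FinSupp

interchange : ∀ a b c d → (a + b) + (c + d) ≡ (a + c) + (b + d)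
interchange = solve-∀

-- The interval from `-b` to `b` grows by one index at each end, so a bound on `∣ i ∣` is all that a
-- support has to provide.
S : ℕ → (ℤ → ℤ) → ℤ
S 0       f = f 0ℤ
S (suc b) f = S b f + (f (+ suc b) + f -[1+ b ])

S-cong : ∀ b {f g : ℤ → ℤ} → (∀ i → f i ≡ g i) → S b f ≡ S b g
S-cong 0       e = e _
S-cong (suc b) e = cong₂ _+_ (S-cong b e) (cong₂ _+_ (e _) (e _))

S-+ : ∀ b (f g : ℤ → ℤ) → S b (λ i → f i + g i) ≡ S b f + S b g
S-+ 0       f g = refl
S-+ (suc b) f g = trans (cong₂ _+_ (S-+ b f g) (interchange (f (+ suc b)) _ _ _)) (interchange (S b f) _ _ _)

S-* : ∀ b c (f : ℤ → ℤ) → S b (λ i → c * f i) ≡ c * S b f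
S-* 0       c f = refl
S-* (suc b) c f = trans (cong₂ _+_ (S-* b c f) (sym (*-distribˡ-+ c (f (+ suc b)) _)))
                        (sym (*-distribˡ-+ c (S b f) _))

S-swap : ∀ a b (F : ℤ → ℤ → ℤ) → S a (λ i → S b (F i)) ≡ S b (λ j → S a (λ i → F i j))
S-swap 0       b F = refl
S-swap (suc a) b F = trans
  (cong₂ _+_ (S-swap a b F) (sym (S-+ b (F (+ suc a)) (F -[1+ a ]))))
  (sym (S-+ b (λ j → S a (λ i → F i j)) _))

S-mono : ∀ b {f g : ℤ → ℤ} → (∀ i → f i ≤ g i) → S b f ≤ S b g
S-mono 0       e = e _
S-mono (suc b) e = +-mono-≤ (S-mono b e) (+-mono-≤ (e _) (e _))

S-vanish : ∀ b {f : ℤ → ℤ} → (∀ i → ∣ i ∣ ℕ.≤ b → f i ≡ 0ℤ) → S b f ≡ 0ℤ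
S-vanish 0       e = e _ z≤n
S-vanish (suc b) e = cong₂ _+_ (S-vanish b (λ i l → e i (ℕₚ.m≤n⇒m≤1+n l)))
                               (cong₂ _+_ (e _ ℕₚ.≤-refl) (e _ ℕₚ.≤-refl))

S-single : ∀ b {f : ℤ → ℤ} a → ∣ a ∣ ℕ.≤ b → (∀ i → i ≢ a → f i ≡ 0ℤ) → S b f ≡ f a
S-single 0 (+ 0) _ _ = refl
S-single (suc b) {f} a l e with ℕₚ.m≤n⇒m<n∨m≡n l
... | inj₁ (s≤s l′) = trans
  (cong₂ _+_ (S-single b a l′ e)
     (cong₂ _+_ (e _ λ { refl → ℕₚ.1+n≰n l′ }) (e _ λ { refl → ℕₚ.1+n≰n l′ })))
  (+-identityʳ _)
S-single (suc b) {f} (+ _) l e | inj₂ refl = trans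
  (cong₂ _+_ (S-vanish b λ i l′ → e i λ { refl → ℕₚ.1+n≰n l′ }) (cong (λ z → f (+ suc b) + z) (e -[1+ b ] λ ())))
  (trans (+-identityˡ _) (+-identityʳ _))
S-single (suc b) {f} -[1+ _ ] l e | inj₂ refl = trans
  (cong₂ _+_ (S-vanish b λ i l′ → e i λ { refl → ℕₚ.1+n≰n l′ }) (cong (_+ f -[1+ b ]) (e (+ suc b) λ ())))
  (trans (+-identityˡ _) (+-identityˡ _))

S-stable : ∀ d b {f : ℤ → ℤ} → (∀ i → f i ≡ 0ℤ ⊎ ∣ i ∣ ℕ.≤ b) → S (d ℕ.+ b) f ≡ S b f
S-stable 0 b w = refl
S-stable (suc d) b {f} w = trans (cong₂ _+_ (S-stable d b w) (cong₂ _+_ (z (+ suc (d ℕ.+ b)) refl) (z -[1+ d ℕ.+ b ] refl)))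
                                 (+-identityʳ _)
  where
  z : ∀ i → ∣ i ∣ ≡ suc (d ℕ.+ b) → f i ≡ 0ℤ
  z i e with w i
  ... | inj₁ p = p
  ... | inj₂ l = ⊥-elim (ℕₚ.1+n≰n (ℕₚ.≤-trans (s≤s (ℕₚ.m≤n+m b d)) (subst (ℕ._≤ b) e l)))

abstract
  ∑ : (f : ℤ → ℤ) → FinSupp f → ℤ
  ∑ f p = S (bound p) f

  -- The value is independent of the chosen bound: enlarging a valid bound adds only zeros, and any
  -- two bounds can be compared at their sum. Hence later lemmas accept arbitrary support witnesses
  -- on both sides.
  ∑-bound : ∀ f p b → (∀ i → f i ≡ 0ℤ ⊎ ∣ i ∣ ℕ.≤ b) → ∑ f p ≡ S b f
  ∑-bound f p b w = begin
    S (bound p) f           ≡⟨ S-stable b (bound p) (within p) ⟨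
    S (b ℕ.+ bound p) f     ≡⟨ cong (λ n → S n f) (ℕₚ.+-comm b (bound p)) ⟩
    S (bound p ℕ.+ b) f     ≡⟨ S-stable (bound p) b w ⟩
    S b f                   ∎
    where open ≡-Reasoning

∑-cong : ∀ {f g} p q → (∀ i → f i ≡ g i) → ∑ f p ≡ ∑ g q
∑-cong {f} {g} p q e = trans (∑-bound f p (bound q) (λ i → subst (λ z → z ≡ 0ℤ ⊎ _) (sym (e i)) (within q i)))
  (trans (S-cong (bound q) e) (sym (∑-bound g q (bound q) (within q))))

⊎-weaken : ∀ {z : ℤ} {n a b} → a ℕ.≤ b → z ≡ 0ℤ ⊎ n ℕ.≤ a → z ≡ 0ℤ ⊎ n ℕ.≤ b
⊎-weaken l (inj₁ p) = inj₁ p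
⊎-weaken l (inj₂ q) = inj₂ (ℕₚ.≤-trans q l)

private
  both : ∀ {x y : ℤ} {A : Set} (h : ℤ → ℤ → ℤ) → h 0ℤ 0ℤ ≡ 0ℤ → x ≡ 0ℤ ⊎ A → y ≡ 0ℤ ⊎ A → h x y ≡ 0ℤ ⊎ A
  both h z (inj₁ refl) (inj₁ refl) = inj₁ z
  both h z (inj₁ _) (inj₂ a) = inj₂ a
  both h z (inj₂ a) _ = inj₂ a

fs-+ : ∀ {f g} → FinSupp f → FinSupp g → FinSupp (λ i → f i + g i)
fs-+ p q = finSupp (bound p ℕ.+ bound q) λ i → both _+_ refl
  (⊎-weaken (ℕₚ.m≤m+n _ _) (within p i)) (⊎-weaken (ℕₚ.m≤n+m _ (bound p)) (within q i))

fs-* : ∀ (g : ℤ → ℤ) {f} → FinSupp f → FinSupp (λ i → g i * f i)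
fs-* g p = finSupp (bound p) λ i → both (λ _ y → g i * y) (*-zeroʳ (g i)) (inj₁ refl) (within p i)

fs-cong : ∀ {f g} → (∀ i → f i ≡ g i) → FinSupp f → FinSupp g
fs-cong e p = finSupp (bound p) λ i → subst (λ z → z ≡ 0ℤ ⊎ _) (e i) (within p i)

∑-+ : ∀ {f g} p q r → ∑ (λ i → f i + g i) r ≡ ∑ f p + ∑ g q
∑-+ {f} {g} p q r = begin
  ∑ (λ i → f i + g i) r ≡⟨ ∑-bound _ r b (within (fs-+ p q)) ⟩
  S b (λ i → f i + g i) ≡⟨ S-+ b f g ⟩
  S b f + S b g         ≡⟨ cong₂ _+_ (∑-bound f p b λ i → ⊎-weaken (ℕₚ.m≤m+n _ _) (within p i))
                                     (∑-bound g q b λ i → ⊎-weaken (ℕₚ.m≤n+m _ (bound p)) (within q i)) ⟨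
  ∑ f p + ∑ g q ∎
  where open ≡-Reasoning
        b = bound p ℕ.+ bound q

∑-* : ∀ c {f} p q → ∑ (λ i → c * f i) q ≡ c * ∑ f p
∑-* c {f} p q = begin
  ∑ (λ i → c * f i) q   ≡⟨ ∑-bound _ q (bound p) (within (fs-* (λ _ → c) p)) ⟩
  S (bound p) (λ i → c * f i) ≡⟨ S-* (bound p) c f ⟩
  c * S (bound p) f     ≡⟨ cong (c *_) (∑-bound f p (bound p) (within p)) ⟨
  c * ∑ f p ∎
  where open ≡-Reasoning

∑-mono : ∀ {f g} p q → (∀ i → f i ≤ g i) → ∑ f p ≤ ∑ g q
∑-mono {f} {g} p q e = subst (_≤ ∑ g q) (sym (∑-bound f p b λ i → ⊎-weaken (ℕₚ.m≤m+n _ _) (within p i)))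
  (subst (S b f ≤_) (sym (∑-bound g q b λ i → ⊎-weaken (ℕₚ.m≤n+m _ (bound p)) (within q i))) (S-mono b e))
  where b = bound p ℕ.+ bound q

∑-single : ∀ {f} p a → (∀ i → i ≢ a → f i ≡ 0ℤ) → ∑ f p ≡ f a
∑-single {f} p a e = trans (∑-bound f p (bound p ℕ.+ ∣ a ∣) λ i → ⊎-weaken (ℕₚ.m≤m+n _ _) (within p i))
  (S-single _ a (ℕₚ.m≤n+m _ (bound p)) e)

∑-zero : ∀ {f} p → (∀ i → f i ≡ 0ℤ) → ∑ f p ≡ 0ℤ
∑-zero p e = trans (∑-single p 0ℤ (λ i _ → e i)) (e 0ℤ)

fs-single : ∀ {f} a → (∀ i → i ≢ a → f i ≡ 0ℤ) → FinSupp f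
fs-single {f} a e = finSupp ∣ a ∣ w
  where
  w : ∀ i → f i ≡ 0ℤ ⊎ ∣ i ∣ ℕ.≤ ∣ a ∣
  w i with i ℤₚ.≟ a
  ... | yes refl = inj₂ ℕₚ.≤-refl
  ... | no ne = inj₁ (e i ne)

∑-nonneg : ∀ {f} p → (∀ i → 0ℤ ≤ f i) → 0ℤ ≤ ∑ f p
∑-nonneg p e = subst (_≤ ∑ _ p) (∑-zero z (λ _ → refl)) (∑-mono z p e)
  where z = fs-single {λ _ → 0ℤ} 0ℤ (λ _ _ → refl)

∑-term : ∀ {f} p → (∀ i → 0ℤ ≤ f i) → ∀ a → f a ≤ ∑ f p
∑-term {f} p e a = subst (_≤ ∑ f p) (trans (∑-single q a off) at) (∑-mono q p le)
  where
  g : ℤ → ℤ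
  g i with i ℤₚ.≟ a
  ... | yes _ = f i
  ... | no _ = 0ℤ
  off : ∀ i → i ≢ a → g i ≡ 0ℤ
  off i ne with i ℤₚ.≟ a
  ... | yes eq = ⊥-elim (ne eq)
  ... | no _ = refl
  at : g a ≡ f a
  at with a ℤₚ.≟ a
  ... | yes _ = refl
  ... | no ne = ⊥-elim (ne refl)
  q = fs-single a off
  le : ∀ i → g i ≤ f i
  le i with i ℤₚ.≟ a
  ... | yes _ = ≤-refl
  ... | no _ = e i

-- Double sums and reindexing

-- Finiteness of every row would not allow an exchange of sums; one square that contains the whole
-- support does, and it bounds rows, columns and both outer sums at once.
record Box (F : ℤ → ℤ → ℤ) : Set where
  no-eta-equality
  constructor box
  field
    side   : ℕ
    inside : ∀ i j → F i j ≡ 0ℤ ⊎ (∣ i ∣ ℕ.≤ side × ∣ j ∣ ℕ.≤ side)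
open Box

row : ∀ {F} → Box F → ∀ i → FinSupp (F i)
row B i = finSupp (side B) λ j → Sum.map₂ proj₂ (inside B i j)

column : ∀ {F} → Box F → ∀ j → FinSupp (λ i → F i j)
column B j = finSupp (side B) λ i → Sum.map₂ proj₁ (inside B i j)

box-transpose : ∀ {F} → Box F → Box (λ j i → F i j)
box-transpose B = box (side B) λ j i → Sum.map₂ (λ (a , b) → b , a) (inside B i j)

rows : ∀ {F} (B : Box F) (p : ∀ i → FinSupp (F i)) → FinSupp (λ i → ∑ (F i) (p i))
rows {F} B p = finSupp (side B) w
  where
  w : ∀ i → ∑ (F i) (p i) ≡ 0ℤ ⊎ ∣ i ∣ ℕ.≤ side B
  w i with ∣ i ∣ ℕ.≤? side B
  ... | yes l = inj₂ l
  ... | no nl = inj₁ (∑-zero (p i) λ j → Sum.[ (λ z → z) , (λ (l , _) → ⊥-elim (nl l)) ]′ (inside B i j))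

columns : ∀ {F} (B : Box F) (q : ∀ j → FinSupp (λ i → F i j)) → FinSupp (λ j → ∑ (λ i → F i j) (q j))
columns B q = rows (box-transpose B) q

∑-swap : ∀ {F} → Box F → ∀ p q r s →
         ∑ (λ i → ∑ (F i) (p i)) r ≡ ∑ (λ j → ∑ (λ i → F i j) (q j)) s
∑-swap {F} B p q r s = begin
  ∑ (λ i → ∑ (F i) (p i)) r           ≡⟨ ∑-bound _ r b (within (rows B p)) ⟩
  S b (λ i → ∑ (F i) (p i))           ≡⟨ S-cong b (λ i → ∑-bound (F i) (p i) b (within (row B i))) ⟩
  S b (λ i → S b (F i))               ≡⟨ S-swap b b F ⟩
  S b (λ j → S b (λ i → F i j))       ≡⟨ S-cong b (λ j → ∑-bound _ (q j) b (within (column B j))) ⟨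
  S b (λ j → ∑ (λ i → F i j) (q j))   ≡⟨ ∑-bound _ s b (within (columns B q)) ⟨
  ∑ (λ j → ∑ (λ i → F i j) (q j)) s   ∎
  where open ≡-Reasoning
        b = side B

-- The function that is `f j` on the graph `j ≡ σ i` and 0 elsewhere is summed by columns and by
-- rows. `σ` need only reach the points where `f` does not vanish, so `σ` may be `i ↦ d i + s`,
-- which extracts a residue class.
∑-reindex : ∀ {f} (σ τ : ℤ → ℤ) → (∀ i → τ (σ i) ≡ i) → (∀ j → f j ≡ 0ℤ ⊎ σ (τ j) ≡ j) →
            ∀ p q → ∑ f p ≡ ∑ (λ i → f (σ i)) q
∑-reindex {f} σ τ τσ στ p q = begin
  ∑ f p                             ≡⟨ ∑-cong cs p (λ j → trans (∑-single (column B j) (τ j) (offᶜ j)) (atᶜ j)) ⟨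
  ∑ (λ j → ∑ (λ i → F i j) _) cs    ≡⟨ ∑-swap B (row B) (column B) rs cs ⟨
  ∑ (λ i → ∑ (F i) _) rs            ≡⟨ ∑-cong rs q (λ i → trans (∑-single (row B i) (σ i) (offʳ i)) (atʳ i)) ⟩
  ∑ (λ i → f (σ i)) q               ∎
  where
  open ≡-Reasoning
  F : ℤ → ℤ → ℤ
  F i j with j ℤₚ.≟ σ i
  ... | yes _ = f j
  ... | no  _ = 0ℤ
  B : Box F
  B = box (bound p ℕ.+ bound q) w
    where
    w : ∀ i j → F i j ≡ 0ℤ ⊎ (∣ i ∣ ℕ.≤ bound p ℕ.+ bound q × ∣ j ∣ ℕ.≤ bound p ℕ.+ bound q)
    w i j with j ℤₚ.≟ σ i
    ... | no _ = inj₁ refl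
    ... | yes refl with within p (σ i) | within q i
    ...   | inj₁ z | _ = inj₁ z
    ...   | _ | inj₁ z = inj₁ z
    ...   | inj₂ a | inj₂ b = inj₂ (ℕₚ.≤-trans b (ℕₚ.m≤n+m _ (bound p)) , ℕₚ.≤-trans a (ℕₚ.m≤m+n _ _))
  rs = rows B (row B)
  cs = columns B (column B)
  offʳ : ∀ i j → j ≢ σ i → F i j ≡ 0ℤ
  offʳ i j ne with j ℤₚ.≟ σ i
  ... | yes e = ⊥-elim (ne e)
  ... | no _ = refl
  atʳ : ∀ i → F i (σ i) ≡ f (σ i)
  atʳ i with σ i ℤₚ.≟ σ i
  ... | yes _ = refl
  ... | no ne = ⊥-elim (ne refl)
  offᶜ : ∀ j i → i ≢ τ j → F i j ≡ 0ℤ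
  offᶜ j i ne with j ℤₚ.≟ σ i
  ... | yes refl = ⊥-elim (ne (sym (τσ i)))
  ... | no _ = refl
  atᶜ : ∀ j → F (τ j) j ≡ f j
  atᶜ j with j ℤₚ.≟ σ (τ j)
  ... | yes _ = refl
  ... | no ne with στ j
  ...   | inj₁ z = sym z
  ...   | inj₂ e = ⊥-elim (ne (sym e))

-- Integer inequalities

+-nonneg : ∀ {a b} → 0ℤ ≤ a → 0ℤ ≤ b → 0ℤ ≤ a + b
+-nonneg = +-mono-≤

*-nonneg : ∀ {a b} → 0ℤ ≤ a → 0ℤ ≤ b → 0ℤ ≤ a * b
*-nonneg {+ a} {+ b} _ _ = subst (0ℤ ≤_) (pos-* a b) (+≤+ z≤n)

sq-nonneg : ∀ i → 0ℤ ≤ i * i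
sq-nonneg (+ n)    = *-nonneg {+ n} {+ n} (+≤+ z≤n) (+≤+ z≤n)
sq-nonneg -[1+ n ] = +≤+ z≤n

-- The pattern for all polynomial inequalities below: the ring solver rewrites `b - a` as an
-- expression that is visibly nonnegative, usually a known slack plus squares.
≤-from : ∀ {a b c} → b - a ≡ c → 0ℤ ≤ c → a ≤ b
≤-from e h = 0≤i-j⇒j≤i (subst (0ℤ ≤_) (sym e) h)

∣∣-≤ : ∀ i {z} → i ≤ z → - i ≤ z → + ∣ i ∣ ≤ z
∣∣-≤ i p q with +∣i∣≡i⊎+∣i∣≡-i i
... | inj₁ e = subst (_≤ _) (sym e) p
... | inj₂ e = subst (_≤ _) (sym e) q

∣∣-≤-∣∣ : ∀ i z → + ∣ i ∣ ≤ z → ∣ i ∣ ℕ.≤ ∣ z ∣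
∣∣-≤-∣∣ i (+ z) (+≤+ l) = l

fs-bounded : ∀ {f} z → (∀ i → f i ≡ 0ℤ ⊎ + ∣ i ∣ ≤ z) → FinSupp f
fs-bounded z w = finSupp ∣ z ∣ λ i → Sum.map₂ (∣∣-≤-∣∣ i z) (w i)

box-bounded : ∀ {F} z → (∀ i j → F i j ≡ 0ℤ ⊎ (+ ∣ i ∣ ≤ z × + ∣ j ∣ ≤ z)) → Box F
box-bounded z w = box ∣ z ∣ λ i j → Sum.map₂ (λ (a , b) → ∣∣-≤-∣∣ i z a , ∣∣-≤-∣∣ j z b) (w i j)

⊎-*ˡ : ∀ c (z : ℤ) {A : Set} → z ≡ 0ℤ ⊎ A → c * z ≡ 0ℤ ⊎ A
⊎-*ˡ c z (inj₁ p) = inj₁ (trans (cong (c *_) p) (*-zeroʳ c))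
⊎-*ˡ c z (inj₂ a) = inj₂ a

-- Affine substitutions

fs-affine : ∀ c s {f} .{{_ : NonZero ∣ c ∣}} → FinSupp f → FinSupp (λ i → f (c * i + s))
fs-affine c s {f} p = finSupp (FinSupp.bound p ℕ.+ ∣ s ∣) λ i → Sum.map₂ (bd i) (FinSupp.within p (c * i + s))
  where
  bd : ∀ i → ∣ c * i + s ∣ ℕ.≤ FinSupp.bound p → ∣ i ∣ ℕ.≤ FinSupp.bound p ℕ.+ ∣ s ∣
  bd i l = begin
    ∣ i ∣                       ≤⟨ ℕₚ.m≤n*m ∣ i ∣ ∣ c ∣ ⟩
    ∣ c ∣ ℕ.* ∣ i ∣             ≡⟨ ∣i*j∣≡∣i∣*∣j∣ c i ⟨
    ∣ c * i ∣                   ≡⟨ cong ∣_∣ (add-sub (c * i) s) ⟨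
    ∣ (c * i + s) - s ∣         ≤⟨ ∣i-j∣≤∣i∣+∣j∣ (c * i + s) s ⟩
    ∣ c * i + s ∣ ℕ.+ ∣ s ∣     ≤⟨ ℕₚ.+-monoˡ-≤ ∣ s ∣ l ⟩
    FinSupp.bound p ℕ.+ ∣ s ∣   ∎
    where
    open ℕₚ.≤-Reasoning
    add-sub : ∀ a b → (a + b) - b ≡ a
    add-sub = solve-∀

∑-shift : ∀ a (f : ℤ → ℤ) p q → ∑ f p ≡ ∑ (λ i → f (i + a)) q
∑-shift a f p q = ∑-reindex {f} (λ i → i + a) (λ i → i - a) (λ i → e₁ i a) (λ i → inj₂ (e₂ i a)) p q
  where
  e₁ : ∀ i a → i + a - a ≡ i
  e₁ = solve-∀
  e₂ : ∀ i a → i - a + a ≡ i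
  e₂ = solve-∀

∑-reflect : ∀ a (f : ℤ → ℤ) p q → ∑ f p ≡ ∑ (λ i → f (a - i)) q
∑-reflect a f p q = ∑-reindex {f} (λ i → a - i) (λ i → a - i) (e a) (λ i → inj₂ (e a i)) p q
  where
  e : ∀ a i → a - (a - i) ≡ i
  e = solve-∀

fs-shift : ∀ a {f} → FinSupp f → FinSupp (λ i → f (i + a))
fs-shift a {f} p = fs-cong (λ i → cong (λ z → f (z + a)) (*-identityˡ i)) (fs-affine 1ℤ a p)

fs-reflect : ∀ a {f} → FinSupp f → FinSupp (λ i → f (a - i))
fs-reflect a {f} p = fs-cong (λ i → cong f (e i a)) (fs-affine -1ℤ a p)
  where
  e : ∀ i a → -1ℤ * i + a ≡ a - i
  e = solve-∀

-- Residue classes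

[_≟_] : ℕ → ℕ → ℤ
[ m ≟ n ] with m ℕ.≟ n
... | yes _ = 1ℤ
... | no _  = 0ℤ

module _ (d : ℕ) .{{_ : NonZero d}} where

  -- The difference of the remainders is a multiple of `d` and smaller than `d` in absolute value.
  quotient-unique : ∀ r r′ q q′ → r ℕ.< d → r′ ℕ.< d → + r + q * + d ≡ + r′ + q′ * + d → q ≡ q′
  quotient-unique r r′ q q′ l l′ e = i-j≡0⇒i≡j q q′ (∣i∣≡0⇒i≡0 (zero-of (ℕₚ.*-cancelʳ-< d ∣ q - q′ ∣ 1 small)))
    where
    move : ∀ r r′ q q′ d → (q - q′) * d ≡ (r + q * d) - (r′ + q′ * d) + (r′ - r)
    move = solve-∀
    diff : (q - q′) * + d ≡ + r′ - + r
    diff = trans (move (+ r) (+ r′) q q′ (+ d))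
      (trans (cong (_+ (+ r′ - + r)) (i≡j⇒i-j≡0 e)) (+-identityˡ _))
    small : ∣ q - q′ ∣ ℕ.* d ℕ.< 1 ℕ.* d
    small = begin-strict
      ∣ q - q′ ∣ ℕ.* d        ≡⟨ ∣i*j∣≡∣i∣*∣j∣ (q - q′) (+ d) ⟨
      ∣ (q - q′) * + d ∣      ≡⟨ cong ∣_∣ (trans diff ([+m]-[+n]≡m⊖n r′ r)) ⟩
      ∣ r′ ℤ.⊖ r ∣ ≤⟨ ∣m⊝n∣≤m⊔n r′ r ⟩
      r′ ℕ.⊔ r                <⟨ ℕₚ.⊔-lub l′ l ⟩
      d                       ≡⟨ ℕₚ.*-identityˡ d ⟨
      1 ℕ.* d                 ∎
      where open ℕₚ.≤-Reasoning
    zero-of : ∀ {n} → n ℕ.< 1 → n ≡ 0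
    zero-of (s≤s z≤n) = refl

  /ℕ-unique : ∀ r q → r ℕ.< d → (+ r + q * + d) /ℕ d ≡ q
  /ℕ-unique r q l = sym (quotient-unique r (z %ℕ d) q (z /ℕ d) l (n%ℕd<d z d) (a≡a%ℕn+[a/ℕn]*n z d))
    where z = + r + q * + d

  %ℕ-unique : ∀ r q → r ℕ.< d → (+ r + q * + d) %ℕ d ≡ r
  %ℕ-unique r q l = +-injective (sym (cancel (+ r) (+ (z %ℕ d)) q (+ d)
      (trans (a≡a%ℕn+[a/ℕn]*n z d) (cong (λ w → + (z %ℕ d) + w * + d) (/ℕ-unique r q l)))))
    where
    z = + r + q * + d
    drop : ∀ a q d → a ≡ (a + q * d) - q * d
    drop = solve-∀
    cancel : ∀ a b q d → a + q * d ≡ b + q * d → a ≡ b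
    cancel a b q d e = trans (drop a q d) (trans (cong (_- q * d) e) (sym (drop b q d)))

  residue : ℕ → ℤ → ℤ
  residue s j = [ j %ℕ d ≟ s ]

  residue-≡ : ∀ {s} j → j %ℕ d ≡ s → residue s j ≡ 1ℤ
  residue-≡ {s} j refl with j %ℕ d ℕ.≟ j %ℕ d
  ... | yes _ = refl
  ... | no ne = ⊥-elim (ne refl)

  ∑-residue : ∀ s → s ℕ.< d → ∀ (f : ℤ → ℤ) p q → ∑ (λ j → residue s j * f j) p ≡ ∑ (λ i → f (+ d * i + + s)) q
  ∑-residue s l f p q = trans
    (∑-reindex {λ j → residue s j * f j} σ (_/ℕ d) (λ i → trans (cong (_/ℕ d) (form (+ d) i (+ s))) (/ℕ-unique s i l)) back p
       (fs-cong (λ i → sym (at i)) q))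
    (∑-cong _ q at)
    where
    σ : ℤ → ℤ
    σ i = + d * i + + s
    form : ∀ d i s → d * i + s ≡ s + i * d
    form = solve-∀
    at : ∀ i → residue s (σ i) * f (σ i) ≡ f (σ i)
    at i = trans (cong (_* f (σ i)) (residue-≡ (σ i) (trans (cong (_%ℕ d) (form (+ d) i (+ s))) (%ℕ-unique s i l))))
                 (*-identityˡ _)
    back : ∀ j → residue s j * f j ≡ 0ℤ ⊎ σ (j /ℕ d) ≡ j
    back j with j %ℕ d ℕ.≟ s
    ... | no _ = inj₁ refl
    ... | yes e = inj₂ (trans (form (+ d) (j /ℕ d) (+ s))
                    (trans (cong (λ r → + r + (j /ℕ d) * + d) (sym e)) (sym (a≡a%ℕn+[a/ℕn]*n j d))))

∑-split2 : ∀ {f} p q₀ q₁ → ∑ f p ≡ ∑ (λ i → f (+ 2 * i + 0ℤ)) q₀ + ∑ (λ i → f (+ 2 * i + 1ℤ)) q₁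
∑-split2 {f} p q₀ q₁ = begin
  ∑ f p                                   ≡⟨ ∑-cong p (fs-+ (cls 0) (cls 1)) pt ⟩
  ∑ _ (fs-+ (cls 0) (cls 1))              ≡⟨ ∑-+ (cls 0) (cls 1) _ ⟩
  ∑ _ (cls 0) + ∑ _ (cls 1)               ≡⟨ cong₂ _+_ (∑-residue 2 0 (s≤s z≤n) f (cls 0) q₀)
                                                       (∑-residue 2 1 (s≤s (s≤s z≤n)) f (cls 1) q₁) ⟩
  _ ∎
  where
  open ≡-Reasoning
  cls : ∀ s → FinSupp (λ j → residue 2 s j * f j)
  cls s = fs-* (residue 2 s) p
  id₀ : ∀ x → x ≡ 1ℤ * x + 0ℤ * x
  id₀ = solve-∀
  id₁ : ∀ x → x ≡ 0ℤ * x + 1ℤ * x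
  id₁ = solve-∀
  pt : ∀ j → f j ≡ residue 2 0 j * f j + residue 2 1 j * f j
  pt j with j %ℕ 2 | n%ℕd<d j 2
  ... | 0 | _ = id₀ (f j)
  ... | 1 | _ = id₁ (f j)
  ... | suc (suc _) | s≤s (s≤s ())

∑-split3 : ∀ {f} p q₀ q₁ q₂ →
           ∑ f p ≡ ∑ (λ i → f (+ 3 * i + 0ℤ)) q₀ + (∑ (λ i → f (+ 3 * i + 1ℤ)) q₁ + ∑ (λ i → f (+ 3 * i + + 2)) q₂)
∑-split3 {f} p q₀ q₁ q₂ = begin
  ∑ f p                                   ≡⟨ ∑-cong p (fs-+ (cls 0) (fs-+ (cls 1) (cls 2))) pt ⟩
  ∑ _ (fs-+ (cls 0) (fs-+ (cls 1) (cls 2)))              ≡⟨ ∑-+ (cls 0) (fs-+ (cls 1) (cls 2)) _ ⟩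
  ∑ _ (cls 0) + ∑ _ (fs-+ (cls 1) (cls 2))               ≡⟨ cong (λ z → ∑ _ (cls 0) + z) (∑-+ (cls 1) (cls 2) _) ⟩
  ∑ _ (cls 0) + (∑ _ (cls 1) + ∑ _ (cls 2))
     ≡⟨ cong₂ _+_ (∑-residue 3 0 (s≤s z≤n) f (cls 0) q₀)
         (cong₂ _+_ (∑-residue 3 1 (s≤s (s≤s z≤n)) f (cls 1) q₁)
                    (∑-residue 3 2 (s≤s (s≤s (s≤s z≤n))) f (cls 2) q₂)) ⟩
  _ ∎
  where
  open ≡-Reasoning
  cls : ∀ s → FinSupp (λ j → residue 3 s j * f j)
  cls s = fs-* (residue 3 s) p
  id₀ : ∀ x → x ≡ 1ℤ * x + (0ℤ * x + 0ℤ * x)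
  id₀ = solve-∀
  id₁ : ∀ x → x ≡ 0ℤ * x + (1ℤ * x + 0ℤ * x)
  id₁ = solve-∀
  id₂ : ∀ x → x ≡ 0ℤ * x + (0ℤ * x + 1ℤ * x)
  id₂ = solve-∀
  pt : ∀ j → f j ≡ residue 3 0 j * f j + (residue 3 1 j * f j + residue 3 2 j * f j)
  pt j with j %ℕ 3 | n%ℕd<d j 3
  ... | 0 | _ = id₀ (f j)
  ... | 1 | _ = id₁ (f j)
  ... | 2 | _ = id₂ (f j)
  ... | suc (suc (suc _)) | s≤s (s≤s (s≤s ()))

-- Signs and indicators

parity : ℕ → ℤ
parity 0       = 1ℤ
parity (suc n) = - parity n

sgn : ℤ → ℤ
sgn i = parity ∣ i ∣

sgn-suc : ∀ i → sgn (i + 1ℤ) ≡ - sgn i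
sgn-suc (+ n)           = cong parity (ℕₚ.+-comm n 1)
sgn-suc -[1+ 0 ]        = refl
sgn-suc -[1+ suc n ]    = sym (neg-involutive _)

sgn-+ : ∀ i j → sgn (i + j) ≡ sgn i * sgn j
sgn-+ i (+ 0) = trans (cong sgn (+-identityʳ i)) (sym (*-identityʳ _))
sgn-+ i (+ suc n) = begin
  sgn (i + + suc n)       ≡⟨ cong (λ z → sgn (i + + z)) (ℕₚ.+-comm n 1) ⟨
  sgn (i + (+ n + 1ℤ))    ≡⟨ cong sgn (+-assoc i (+ n) 1ℤ) ⟨
  sgn (i + + n + 1ℤ)      ≡⟨ sgn-suc (i + + n) ⟩
  - sgn (i + + n)         ≡⟨ cong -_ (sgn-+ i (+ n)) ⟩
  - (sgn i * parity n)    ≡⟨ neg-distribʳ-* (sgn i) (parity n) ⟩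
  sgn i * - parity n      ∎
  where open ≡-Reasoning
sgn-+ i -[1+ n ] = begin
  sgn (i + -[1+ n ])           ≡⟨ neg-involutive _ ⟨
  - - sgn (i + -[1+ n ])       ≡⟨ cong -_ (sgn-suc (i + -[1+ n ])) ⟨
  - sgn (i + -[1+ n ] + 1ℤ)    ≡⟨ cong (λ z → - sgn z) (+-assoc i -[1+ n ] 1ℤ) ⟩
  - sgn (i + (-[1+ n ] + 1ℤ))  ≡⟨ cong -_ (pred-case n) ⟩
  - (sgn i * parity n)         ≡⟨ neg-distribʳ-* (sgn i) (parity n) ⟩
  sgn i * - parity n           ∎
  where
  open ≡-Reasoning
  pred-case : ∀ n → sgn (i + (-[1+ n ] + 1ℤ)) ≡ sgn i * parity n
  pred-case 0       = sgn-+ i 0ℤ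
  pred-case (suc m) = sgn-+ i -[1+ m ]

parity-sq : ∀ n → parity n * parity n ≡ 1ℤ
parity-sq 0       = refl
parity-sq (suc n) = trans (e (parity n)) (parity-sq n)
  where
  e : ∀ x → (- x) * (- x) ≡ x * x
  e = solve-∀

sgn-mod2 : ∀ i j k → i ≡ j + (k + k) → sgn i ≡ sgn j
sgn-mod2 i j k refl = begin
  sgn (j + (k + k))        ≡⟨ sgn-+ j (k + k) ⟩
  sgn j * sgn (k + k)      ≡⟨ cong (sgn j *_) (trans (sgn-+ k k) (parity-sq ∣ k ∣)) ⟩
  sgn j * 1ℤ               ≡⟨ *-identityʳ _ ⟩
  sgn j                    ∎
  where open ≡-Reasoning

sgn-odd : ∀ i j k → i ≡ j + 1ℤ + (k + k) → sgn i ≡ - sgn j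
sgn-odd i j k e = trans (sgn-mod2 i (j + 1ℤ) k e) (sgn-suc j)

-- The indicator of `0 ≤ i`. It turns one-sided sums into sums over all of ℤ, to which shifts and
-- reflections apply.
pos : ℤ → ℤ
pos (+ _)    = 1ℤ
pos -[1+ _ ] = 0ℤ

pos-≥ : ∀ {i} → 0ℤ ≤ i → pos i ≡ 1ℤ
pos-≥ (+≤+ _) = refl

pos-compl : ∀ i → pos i + pos (- i - 1ℤ) ≡ 1ℤ
pos-compl (+ 0)       = refl
pos-compl (+ suc n)   = refl
pos-compl -[1+ n ]    = refl

-- Gaussian binomials and the rank generating functions

δ : ℤ → ℤ
δ (+ 0)      = 1ℤ
δ (+ suc _)  = 0ℤ
δ -[1+ _ ]   = 0ℤ

δ-≢ : ∀ {x} → x ≢ 0ℤ → δ x ≡ 0ℤ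
δ-≢ {+ 0} ne = ⊥-elim (ne refl)
δ-≢ {+ suc _} _ = refl
δ-≢ { -[1+ _ ]} _ = refl

δ-supp : ∀ x → δ x ≡ 0ℤ ⊎ x ≡ 0ℤ
δ-supp (+ 0)     = inj₂ refl
δ-supp (+ suc _) = inj₁ refl
δ-supp -[1+ _ ]  = inj₁ refl

pos-step : ∀ i → pos (i + 1ℤ) ≡ pos i + δ (i + 1ℤ)
pos-step (+ n) rewrite ℕₚ.+-comm n 1 = refl
pos-step -[1+ 0 ] = refl
pos-step -[1+ suc n ] = refl

-- Exponents are doubled: the coefficient of qⁿ sits at 2n. This makes every quadratic
-- exponent below an integer polynomial.
bin : ℕ → ℕ → ℤ → ℤ
bin 0       _       x = δ x
bin (suc l) 0       x = δ x
bin (suc l) (suc k) x = bin l (suc k) x + bin (suc l) k (x - + 2 * + suc l)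

bin-0ʳ : ∀ l x → bin l 0 x ≡ δ x
bin-0ʳ 0       x = refl
bin-0ʳ (suc l) x = refl

-- The second Pascal rule for Gaussian binomials. Transposing a box exchanges it with the defining
-- rule, which is how `bin-sym` follows.
bin-recʳ : ∀ l k x → bin (suc l) (suc k) x ≡ bin (suc l) k x + bin l (suc k) (x - + 2 * + suc k)
bin-recʳ 0 0 x = refl
bin-recʳ 0 (suc k) x = begin
  δ x + bin 1 (suc k) (x - + 2 * 1ℤ)
    ≡⟨ cong (λ z → δ x + z) (bin-recʳ 0 k (x - + 2 * 1ℤ)) ⟩
  δ x + (bin 1 k (x - + 2 * 1ℤ) + δ (x - + 2 * 1ℤ - + 2 * + suc k))
    ≡⟨ +-assoc (δ x) _ _ ⟨
  δ x + bin 1 k (x - + 2 * 1ℤ) + δ (x - + 2 * 1ℤ - + 2 * + suc k)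
    ≡⟨ cong (λ z → δ x + bin 1 k (x - + 2 * 1ℤ) + δ z) (e x (+ suc k)) ⟩
  δ x + bin 1 k (x - + 2 * 1ℤ) + δ (x - + 2 * + suc (suc k)) ∎
  where
  open ≡-Reasoning
  e : ∀ x k → x - + 2 * 1ℤ - + 2 * k ≡ x - + 2 * (1ℤ + k)
  e = solve-∀
bin-recʳ (suc l) 0 x = begin
  bin (suc l) 1 x + δ (x - + 2 * + suc (suc l))
    ≡⟨ cong (_+ δ (x - + 2 * + suc (suc l))) (bin-recʳ l 0 x) ⟩
  δ x + bin l 1 (x - + 2 * 1ℤ) + δ (x - + 2 * + suc (suc l))
    ≡⟨ cong (λ z → δ x + bin l 1 (x - + 2 * 1ℤ) + δ z) (e x (+ suc l)) ⟩
  δ x + bin l 1 (x - + 2 * 1ℤ) + δ (x - + 2 * 1ℤ - + 2 * + suc l)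
    ≡⟨ +-assoc (δ x) _ _ ⟩
  δ x + (bin l 1 (x - + 2 * 1ℤ) + δ (x - + 2 * 1ℤ - + 2 * + suc l)) ∎
  where
  open ≡-Reasoning
  e : ∀ x k → x - + 2 * (1ℤ + k) ≡ x - + 2 * 1ℤ - + 2 * k
  e = solve-∀
bin-recʳ (suc l) (suc k) x = begin
  bin (suc l) (suc (suc k)) x + bin (suc (suc l)) (suc k) (x - a)
    ≡⟨ cong₂ _+_ (bin-recʳ l (suc k) x) (bin-recʳ (suc l) k (x - a)) ⟩
  (bin (suc l) (suc k) x + bin l (suc (suc k)) (x - b)) + (bin (suc (suc l)) k (x - a) + bin (suc l) (suc k) (x - a - + 2 * + suc k))
    ≡⟨ interchange (bin (suc l) (suc k) x) _ _ _ ⟩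
  (bin (suc l) (suc k) x + bin (suc (suc l)) k (x - a)) + (bin l (suc (suc k)) (x - b) + bin (suc l) (suc k) (x - a - + 2 * + suc k))
    ≡⟨ cong (λ z → (bin (suc l) (suc k) x + bin (suc (suc l)) k (x - a)) + (bin l (suc (suc k)) (x - b) + bin (suc l) (suc k) z)) (e x (+ suc l) (+ suc k)) ⟩
  (bin (suc l) (suc k) x + bin (suc (suc l)) k (x - a)) + (bin l (suc (suc k)) (x - b) + bin (suc l) (suc k) (x - b - + 2 * + suc l)) ∎
  where
  open ≡-Reasoning
  a = + 2 * + suc (suc l)
  b = + 2 * + suc (suc k)
  e : ∀ x l k → x - + 2 * (1ℤ + l) - + 2 * k ≡ x - + 2 * (1ℤ + k) - + 2 * l
  e = solve-∀

bin-sym : ∀ l k x → bin l k x ≡ bin k l x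
bin-sym 0       k       x = sym (bin-0ʳ k x)
bin-sym (suc l) 0       x = refl
bin-sym (suc l) (suc k) x = trans (cong₂ _+_ (bin-sym l (suc k) x) (bin-sym (suc l) k _)) (sym (bin-recʳ k l x))

δ-nonneg : ∀ x → 0ℤ ≤ δ x
δ-nonneg (+ 0)     = +≤+ z≤n
δ-nonneg (+ suc _) = +≤+ z≤n
δ-nonneg -[1+ _ ]  = +≤+ z≤n

bin-nonneg : ∀ l k x → 0ℤ ≤ bin l k x
bin-nonneg 0       k       x = δ-nonneg x
bin-nonneg (suc l) 0       x = δ-nonneg x
bin-nonneg (suc l) (suc k) x = +-nonneg (bin-nonneg l (suc k) x) (bin-nonneg (suc l) k _)

bin-supp : ∀ l k x → bin l k x ≡ 0ℤ ⊎ 0ℤ ≤ x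
bin-supp l k (+ _) = inj₂ (+≤+ z≤n)
bin-supp l k -[1+ n ] = inj₁ (neg l k n)
  where
  neg : ∀ l k n → bin l k -[1+ n ] ≡ 0ℤ
  neg 0       k       n = refl
  neg (suc l) 0       n = refl
  neg (suc l) (suc k) n = cong₂ _+_ (neg l (suc k) n) (neg (suc l) k _)

-- pe l k counts the partitions with largest part exactly l and exactly k parts.
pe : ℤ → ℤ → ℤ → ℤ
pe (+ 0)     (+ 0)     x = δ x
-- Removing the first row and the first column of the Ferrers diagram, a hook of `l + k + 1` cells,
-- leaves a partition inside an `l` by `k` box.
pe (+ suc l) (+ suc k) x = bin l k (x - + 2 * (+ l + + k + 1ℤ))
pe (+ 0)     (+ suc k) x = 0ℤ
pe (+ 0)     -[1+ _ ]  x = 0ℤ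
pe (+ suc l) (+ 0)     x = 0ℤ
pe (+ suc l) -[1+ _ ]  x = 0ℤ
pe -[1+ _ ]  _         x = 0ℤ

pe-negʳ : ∀ l k x → pe l -[1+ k ] x ≡ 0ℤ
pe-negʳ (+ 0)     k x = refl
pe-negʳ (+ suc l) k x = refl
pe-negʳ -[1+ l ]  k x = refl

pe-sym : ∀ l k x → pe l k x ≡ pe k l x
pe-sym (+ 0)     (+ 0)     x = refl
pe-sym (+ suc l) (+ suc k) x = trans (bin-sym l k _) (cong (λ z → bin k l (x - + 2 * (z + 1ℤ))) (+-comm (+ l) (+ k)))
pe-sym (+ 0)     (+ suc k) x = refl
pe-sym (+ suc l) (+ 0)     x = refl
pe-sym l         -[1+ k ]  x = pe-negʳ l k x
pe-sym -[1+ l ]  (+ k)     x = sym (pe-negʳ (+ k) l x)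

pe-nonneg : ∀ l k x → 0ℤ ≤ pe l k x
pe-nonneg (+ 0)     (+ 0)     x = δ-nonneg x
pe-nonneg (+ suc l) (+ suc k) x = bin-nonneg l k _
pe-nonneg (+ 0)     (+ suc k) x = +≤+ z≤n
pe-nonneg (+ suc l) (+ 0)     x = +≤+ z≤n
pe-nonneg l         -[1+ k ]  x = subst (0ℤ ≤_) (sym (pe-negʳ l k x)) (+≤+ z≤n)
pe-nonneg -[1+ l ]  (+ k)     x = +≤+ z≤n

+-≥0 : ∀ n → 0ℤ ≤ + n
+-≥0 n = +≤+ z≤n

pe-supp : ∀ l k x → pe l k x ≡ 0ℤ ⊎ (+ ∣ l ∣ ≤ x × + ∣ k ∣ ≤ x)
pe-supp (+ 0)     (+ 0)     x with δ-supp x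
... | inj₁ z = inj₁ z
... | inj₂ refl = inj₂ (+≤+ z≤n , +≤+ z≤n)
pe-supp (+ suc l) (+ suc k) x with bin-supp l k (x - + 2 * (+ l + + k + 1ℤ))
... | inj₁ z = inj₁ z
... | inj₂ h = inj₂ (≤-from (e x (+ l) (+ k)) (bd l k) , ≤-from (e′ x (+ l) (+ k)) (bd k l))
  where
  e : ∀ x l k → x - (1ℤ + l) ≡ (x - + 2 * (l + k + 1ℤ)) + (l + (k + k) + 1ℤ)
  e = solve-∀
  e′ : ∀ x l k → x - (1ℤ + k) ≡ (x - + 2 * (l + k + 1ℤ)) + (k + (l + l) + 1ℤ)
  e′ = solve-∀
  bd : ∀ a b → 0ℤ ≤ (x - + 2 * (+ l + + k + 1ℤ)) + (+ a + (+ b + + b) + 1ℤ)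
  bd a b = +-nonneg h (+≤+ z≤n)
pe-supp (+ 0)     (+ suc k) x = inj₁ refl
pe-supp (+ suc l) (+ 0)     x = inj₁ refl
pe-supp l         -[1+ k ]  x = inj₁ (pe-negʳ l k x)
pe-supp -[1+ l ]  (+ k)     x = inj₁ refl

diff-≤ : ∀ a b {z} → + ∣ a ∣ ≤ z → + ∣ b ∣ ≤ z → + ∣ a - b ∣ ≤ z + z
diff-≤ a b {+ z} (+≤+ p) (+≤+ q) = +≤+ (ℕₚ.≤-trans (∣i-j∣≤∣i∣+∣j∣ a b) (ℕₚ.+-mono-≤ p q))

≤-double : ∀ a {z} → + ∣ a ∣ ≤ z → + ∣ a ∣ ≤ z + z
≤-double a {+ z} (+≤+ p) = +≤+ (ℕₚ.≤-trans p (ℕₚ.m≤m+n z z))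

rank-box : ∀ x → Box (λ j k → pe (k + j) k x)
rank-box x = box-bounded (x + x) w
  where
  e : ∀ k j → (k + j) - k ≡ j
  e = solve-∀
  w : ∀ j k → pe (k + j) k x ≡ 0ℤ ⊎ (+ ∣ j ∣ ≤ x + x × + ∣ k ∣ ≤ x + x)
  w j k with pe-supp (k + j) k x
  ... | inj₁ z = inj₁ z
  ... | inj₂ (a , b) = inj₂ (subst (λ i → + ∣ i ∣ ≤ x + x) (e k j) (diff-≤ (k + j) k a b) , ≤-double k b)

-- N₌ j, H m and P count the partitions of rank j, of rank at most m, and all partitions.
N₌ : ℤ → ℤ → ℤ
N₌ j x = ∑ (λ k → pe (k + j) k x) (row (rank-box x) j)

N₌-fs : ∀ x → FinSupp (λ j → N₌ j x)
N₌-fs x = rows (rank-box x) (row (rank-box x))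

P : ℤ → ℤ
P x = ∑ (λ j → N₌ j x) (N₌-fs x)

H : ℤ → ℤ → ℤ
H m x = ∑ (λ j → pos (m - j) * N₌ j x) (fs-* (λ j → pos (m - j)) (N₌-fs x))

N₌-nonneg : ∀ j x → 0ℤ ≤ N₌ j x
N₌-nonneg j x = ∑-nonneg _ (λ k → pe-nonneg (k + j) k x)

N₌-neg : ∀ j n → N₌ j -[1+ n ] ≡ 0ℤ
N₌-neg j n = ∑-zero _ z
  where
  z : ∀ k → pe (k + j) k -[1+ n ] ≡ 0ℤ
  z k with pe-supp (k + j) k -[1+ n ]
  ... | inj₁ p = p
  ... | inj₂ (() , _)

P-neg : ∀ n → P -[1+ n ] ≡ 0ℤ
P-neg n = ∑-zero _ (λ j → N₌-neg j n)

P-supp : ∀ x → P x ≡ 0ℤ ⊎ 0ℤ ≤ x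
P-supp (+ _)    = inj₂ (+≤+ z≤n)
P-supp -[1+ n ] = inj₁ (P-neg n)

H-neg : ∀ m n → H m -[1+ n ] ≡ 0ℤ
H-neg m n = ∑-zero _ (λ j → trans (cong (pos (m - j) *_) (N₌-neg j n)) (*-zeroʳ (pos (m - j))))

H-supp : ∀ m x → H m x ≡ 0ℤ ⊎ 0ℤ ≤ x
H-supp m (+ _)    = inj₂ (+≤+ z≤n)
H-supp m -[1+ n ] = inj₁ (H-neg m n)

-- Conjugation of partitions: it exchanges largest part and number of parts, so the number of parts
-- becomes `k + j`.
N₌-sym : ∀ j x → N₌ (- j) x ≡ N₌ j x
N₌-sym j x = trans (∑-shift j (λ k → pe (k + - j) k x) _ (fs-shift j (row (rank-box x) (- j)))) (∑-cong _ _ pt)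
  where
  e : ∀ k j → k + j + - j ≡ k
  e = solve-∀
  pt : ∀ k → pe (k + j + - j) (k + j) x ≡ pe (k + j) k x
  pt k = trans (cong (λ z → pe z (k + j) x) (e k j)) (pe-sym k (k + j) x)

H-step : ∀ m x → H m x ≡ H (m - 1ℤ) x + N₌ m x
H-step m x = begin
  H m x ≡⟨ ∑-cong _ r pt ⟩
  ∑ (λ j → pos (m - 1ℤ - j) * N₌ j x + δ (m - j) * N₌ j x) r ≡⟨ ∑-+ _ q _ ⟩
  H (m - 1ℤ) x + ∑ (λ j → δ (m - j) * N₌ j x) q ≡⟨ cong (λ z → H (m - 1ℤ) x + z) single ⟩
  H (m - 1ℤ) x + N₌ m x ∎
  where
  open ≡-Reasoning
  q : FinSupp (λ j → δ (m - j) * N₌ j x)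
  q = fs-* (λ j → δ (m - j)) (N₌-fs x)
  r : FinSupp (λ j → pos (m - 1ℤ - j) * N₌ j x + δ (m - j) * N₌ j x)
  r = fs-+ (fs-* (λ j → pos (m - 1ℤ - j)) (N₌-fs x)) q
  e : ∀ m j → m - j ≡ m - 1ℤ - j + 1ℤ
  e = solve-∀
  pt : ∀ j → pos (m - j) * N₌ j x ≡ pos (m - 1ℤ - j) * N₌ j x + δ (m - j) * N₌ j x
  pt j = begin
    pos (m - j) * N₌ j x                ≡⟨ cong (λ z → pos z * N₌ j x) (e m j) ⟩
    pos (m - 1ℤ - j + 1ℤ) * N₌ j x      ≡⟨ cong (_* N₌ j x) (pos-step (m - 1ℤ - j)) ⟩
    (pos (m - 1ℤ - j) + δ (m - 1ℤ - j + 1ℤ)) * N₌ j x ≡⟨ *-distribʳ-+ (N₌ j x) (pos (m - 1ℤ - j)) _ ⟩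
    pos (m - 1ℤ - j) * N₌ j x + δ (m - 1ℤ - j + 1ℤ) * N₌ j x
      ≡⟨ cong (λ z → pos (m - 1ℤ - j) * N₌ j x + δ z * N₌ j x) (e m j) ⟨
    pos (m - 1ℤ - j) * N₌ j x + δ (m - j) * N₌ j x ∎
  off : ∀ j → j ≢ m → δ (m - j) * N₌ j x ≡ 0ℤ
  off j ne = cong (_* N₌ j x) (δ-≢ (λ z → ne (sym (i-j≡0⇒i≡j m j z))))
  single : ∑ (λ j → δ (m - j) * N₌ j x) q ≡ N₌ m x
  single = trans (∑-single q m off)
    (trans (cong (λ z → δ z * N₌ m x) (+-inverseʳ m)) (*-identityˡ _))

-- By conjugation, rank at most `-1 - m` is as frequent as rank at least `m + 1`.
H-compl : ∀ m x → H m x + H (-1ℤ - m) x ≡ P x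
H-compl m x = begin
  H m x + H (-1ℤ - m) x
    ≡⟨ cong (λ z → H m x + z) (trans (∑-reflect 0ℤ (λ j → pos (-1ℤ - m - j) * N₌ j x) _ (fs-reflect 0ℤ (h-fs (-1ℤ - m)))) (∑-cong _ q pt)) ⟩
  H m x + ∑ (λ j → pos (- (m - j) - 1ℤ) * N₌ j x) q
    ≡⟨ ∑-+ (h-fs m) q (fs-+ (h-fs m) q) ⟨
  ∑ (λ j → pos (m - j) * N₌ j x + pos (- (m - j) - 1ℤ) * N₌ j x) _
    ≡⟨ ∑-cong _ _ (λ j → trans (sym (*-distribʳ-+ (N₌ j x) (pos (m - j)) _))
                       (trans (cong (_* N₌ j x) (pos-compl (m - j))) (*-identityˡ _))) ⟩
  P x ∎
  where
  open ≡-Reasoning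
  q : FinSupp (λ j → pos (- (m - j) - 1ℤ) * N₌ j x)
  q = fs-* (λ j → pos (- (m - j) - 1ℤ)) (N₌-fs x)
  h-fs : ∀ m → FinSupp (λ j → pos (m - j) * N₌ j x)
  h-fs m = fs-* (λ j → pos (m - j)) (N₌-fs x)
  e : ∀ m j → -1ℤ - m - (0ℤ - j) ≡ - (m - j) - 1ℤ
  e = solve-∀
  pt : ∀ j → pos (-1ℤ - m - (0ℤ - j)) * N₌ (0ℤ - j) x ≡ pos (- (m - j) - 1ℤ) * N₌ j x
  pt j = cong₂ (λ a b → pos a * b) (e m j) (trans (cong (λ z → N₌ z x) (+-identityˡ (- j))) (N₌-sym j x))

-- atMost l k counts the partitions with exactly k parts, all at most l.
atMost-fs : ∀ l k x → FinSupp (λ i → pos (l - i) * pe i k x)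
atMost-fs l k x = fs-* (λ i → pos (l - i)) (fs-bounded x (λ i → Sum.map₂ proj₁ (pe-supp i k x)))

atMost : ℤ → ℤ → ℤ → ℤ
atMost l k x = ∑ (λ i → pos (l - i) * pe i k x) (atMost-fs l k x)

atMost-step : ∀ l k x → atMost (l + 1ℤ) k x ≡ atMost l k x + pe (l + 1ℤ) k x
atMost-step l k x = begin
  atMost (l + 1ℤ) k x ≡⟨ ∑-cong _ r pt ⟩
  ∑ (λ i → pos (l - i) * pe i k x + δ (l + 1ℤ - i) * pe i k x) r ≡⟨ ∑-+ _ q _ ⟩
  atMost l k x + ∑ (λ i → δ (l + 1ℤ - i) * pe i k x) q ≡⟨ cong (λ z → atMost l k x + z) single ⟩
  atMost l k x + pe (l + 1ℤ) k x ∎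
  where
  open ≡-Reasoning
  q : FinSupp (λ i → δ (l + 1ℤ - i) * pe i k x)
  q = fs-* (λ i → δ (l + 1ℤ - i)) (fs-bounded x (λ i → Sum.map₂ proj₁ (pe-supp i k x)))
  r : FinSupp (λ i → pos (l - i) * pe i k x + δ (l + 1ℤ - i) * pe i k x)
  r = fs-+ (atMost-fs l k x) q
  eq : ∀ l i → l + 1ℤ - i ≡ l - i + 1ℤ
  eq = solve-∀
  pt : ∀ i → pos (l + 1ℤ - i) * pe i k x ≡ pos (l - i) * pe i k x + δ (l + 1ℤ - i) * pe i k x
  pt i rewrite eq l i = trans (cong (_* pe i k x) (pos-step (l - i))) (*-distribʳ-+ (pe i k x) (pos (l - i)) _)
  off : ∀ i → i ≢ l + 1ℤ → δ (l + 1ℤ - i) * pe i k x ≡ 0ℤ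
  off i ne = cong (_* pe i k x) (δ-≢ (λ z → ne (sym (i-j≡0⇒i≡j (l + 1ℤ) i z))))
  single : ∑ (λ i → δ (l + 1ℤ - i) * pe i k x) q ≡ pe (l + 1ℤ) k x
  single = trans (∑-single q (l + 1ℤ) off)
    (trans (cong (λ z → δ z * pe (l + 1ℤ) k x) (+-inverseʳ (l + 1ℤ))) (*-identityˡ _))

atMost-negˡ : ∀ l k x → atMost -[1+ l ] k x ≡ 0ℤ
atMost-negˡ l k x = ∑-zero _ z
  where
  z : ∀ i → pos (-[1+ l ] - i) * pe i k x ≡ 0ℤ
  z (+ 0)     = refl
  z (+ suc n) = refl
  z -[1+ n ]  = *-zeroʳ (pos (-[1+ l ] - -[1+ n ]))

atMost-negʳ : ∀ l k x → atMost l -[1+ k ] x ≡ 0ℤ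
atMost-negʳ l k x = ∑-zero _ (λ i → trans (cong (pos (l - i) *_) (pe-negʳ i k x)) (*-zeroʳ (pos (l - i))))

atMost-0 : ∀ k x → atMost 0ℤ k x ≡ pe 0ℤ k x
atMost-0 k x = trans (atMost-step -1ℤ k x) (trans (cong (_+ pe 0ℤ k x) (atMost-negˡ 0 k x)) (+-identityˡ _))

atMost-bin : ∀ l k x → atMost (+ suc l) (+ k) x ≡ bin l k (x - + 2 * + k)
atMost-bin 0 0 x = trans (atMost-step 0ℤ 0ℤ x) (trans (cong (_+ 0ℤ) (atMost-0 0ℤ x)) (trans (+-identityʳ _) (cong δ (sym (+-identityʳ x)))))
atMost-bin 0 (suc k) x = trans (atMost-step 0ℤ (+ suc k) x) (trans (cong (_+ pe 1ℤ (+ suc k) x) (atMost-0 (+ suc k) x))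
  (trans (+-identityˡ _) (cong δ (eq x (+ k)))))
  where
  eq : ∀ x k → x - + 2 * (0ℤ + k + 1ℤ) ≡ x - + 2 * (1ℤ + k)
  eq = solve-∀
atMost-bin (suc l) 0 x = trans (cong (λ z → atMost (+ z) 0ℤ x) (ℕₚ.+-comm 1 (suc l)))
  (trans (atMost-step (+ suc l) 0ℤ x) (trans (cong₂ _+_ (atMost-bin l 0 x) (pe-0 l)) (trans (+-identityʳ _) (bin-0ʳ l _))))
  where
  pe-0 : ∀ l → pe (+ suc l + 1ℤ) 0ℤ x ≡ 0ℤ
  pe-0 l = refl
atMost-bin (suc l) (suc k) x = trans (cong (λ z → atMost (+ z) (+ suc k) x) (ℕₚ.+-comm 1 (suc l)))
  (trans (atMost-step (+ suc l) (+ suc k) x) (cong₂ _+_ (atMost-bin l (suc k) x) last))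
  where
  eq : ∀ x l k → x - + 2 * (l + k + 1ℤ) ≡ x - + 2 * (1ℤ + k) - + 2 * l
  eq = solve-∀
  last : pe (+ suc l + 1ℤ) (+ suc k) x ≡ bin (suc l) k (x - + 2 * + suc k - + 2 * + suc l)
  last = trans (cong (λ z → pe (+ z) (+ suc k) x) (ℕₚ.+-comm (suc l) 1)) (cong (bin (suc l) k) (eq x (+ suc l) (+ k)))

H-rows-fs : ∀ m x → FinSupp (λ k → atMost (k + m) k x)
H-rows-fs m x = fs-bounded x w
  where
  w : ∀ k → atMost (k + m) k x ≡ 0ℤ ⊎ + ∣ k ∣ ≤ x
  w k with + ∣ k ∣ ℤₚ.≤? x
  ... | yes l = inj₂ l
  ... | no nl = inj₁ (∑-zero _ λ i → z i)
    where
    z : ∀ i → pos (k + m - i) * pe i k x ≡ 0ℤ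
    z i with pe-supp i k x
    ... | inj₁ p = trans (cong (pos (k + m - i) *_) p) (*-zeroʳ (pos (k + m - i)))
    ... | inj₂ (_ , l) = ⊥-elim (nl l)

-- With `k` parts, rank at most `m` says that the largest part is at most `k + m`.
H-rows : ∀ m x → H m x ≡ ∑ (λ k → atMost (k + m) k x) (H-rows-fs m x)
H-rows m x = begin
  H m x
    ≡⟨ ∑-cong _ (rows B (row B)) (λ j → sym (∑-* (pos (m - j)) _ (row B j))) ⟩
  ∑ (λ j → ∑ (λ k → pos (m - j) * pe (k + j) k x) (row B j)) (rows B (row B))
    ≡⟨ ∑-swap B (row B) (column B) _ (columns B (column B)) ⟩
  ∑ (λ k → ∑ (λ j → pos (m - j) * pe (k + j) k x) (column B k)) (columns B (column B))
    ≡⟨ ∑-cong _ _ (λ k → sym (trans (∑-shift k (λ i → pos (k + m - i) * pe i k x) _ (fs-shift k (atMost-fs (k + m) k x))) (∑-cong _ _ (pt k)))) ⟩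
  ∑ (λ k → atMost (k + m) k x) (H-rows-fs m x) ∎
  where
  open ≡-Reasoning
  B : Box (λ j k → pos (m - j) * pe (k + j) k x)
  B = box (Box.side (rank-box x)) λ j k → ⊎-*ˡ (pos (m - j)) _ (Box.inside (rank-box x) j k)
  eq : ∀ k m j → k + m - (j + k) ≡ m - j
  eq = solve-∀
  pt : ∀ k j → pos (k + m - (j + k)) * pe (j + k) k x ≡ pos (m - j) * pe (k + j) k x
  pt k j = cong₂ (λ a b → pos a * pe b k x) (eq k m j) (+-comm j k)

-- Dyson's map: delete the largest part and add a column, on the level of atMost and bin.
dyson-pointwise : ∀ u j x → atMost (j + 1ℤ) (j + + u + 1ℤ) x ≡
                  atMost (j + (+ 2 + + u)) j (x - + 2 * (+ u + 1ℤ)) + pe (j + 1ℤ) (+ u) x * δ (j + 1ℤ)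
dyson-pointwise u (+ j) x = begin
  atMost (+ j + 1ℤ) (+ j + + u + 1ℤ) x
    ≡⟨ cong₂ (λ a b → atMost (+ a) (+ b) x) (ℕₚ.+-comm j 1) refl ⟩
  atMost (+ suc j) (+ (j ℕ.+ u ℕ.+ 1)) x
    ≡⟨ atMost-bin j (j ℕ.+ u ℕ.+ 1) x ⟩
  bin j (j ℕ.+ u ℕ.+ 1) (x - + 2 * (+ j + + u + 1ℤ))
    ≡⟨ bin-sym j (j ℕ.+ u ℕ.+ 1) _ ⟩
  bin (j ℕ.+ u ℕ.+ 1) j (x - + 2 * (+ j + + u + 1ℤ))
    ≡⟨ cong₂ (λ a b → bin a j b) (trans (ℕₚ.+-assoc j u 1) (cong (j ℕ.+_) (ℕₚ.+-comm u 1))) (eq x (+ j) (+ u)) ⟩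
  bin (j ℕ.+ suc u) j (x - + 2 * (+ u + 1ℤ) - + 2 * + j)
    ≡⟨ atMost-bin (j ℕ.+ suc u) j _ ⟨
  atMost (+ suc (j ℕ.+ suc u)) (+ j) (x - + 2 * (+ u + 1ℤ))
    ≡⟨ cong (λ a → atMost (+ a) (+ j) (x - + 2 * (+ u + 1ℤ))) (ℕₚ.+-suc j (suc u)) ⟨
  atMost (+ j + (+ 2 + + u)) (+ j) (x - + 2 * (+ u + 1ℤ))
    ≡⟨ +-identityʳ _ ⟨
  atMost (+ j + (+ 2 + + u)) (+ j) (x - + 2 * (+ u + 1ℤ)) + 0ℤ
    ≡⟨ cong (λ z → atMost (+ j + (+ 2 + + u)) (+ j) (x - + 2 * (+ u + 1ℤ)) + z) (*-zeroʳ (pe (+ j + 1ℤ) (+ u) x)) ⟨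
  atMost (+ j + (+ 2 + + u)) (+ j) (x - + 2 * (+ u + 1ℤ)) + pe (+ j + 1ℤ) (+ u) x * 0ℤ
    ≡⟨ cong (λ z → atMost (+ j + (+ 2 + + u)) (+ j) (x - + 2 * (+ u + 1ℤ)) + pe (+ j + 1ℤ) (+ u) x * δ (+ z)) (ℕₚ.+-comm 1 j) ⟩
  atMost (+ j + (+ 2 + + u)) (+ j) (x - + 2 * (+ u + 1ℤ)) + pe (+ j + 1ℤ) (+ u) x * δ (+ j + 1ℤ) ∎
  where
  open ≡-Reasoning
  eq : ∀ x j u → x - + 2 * (j + u + 1ℤ) ≡ x - + 2 * (u + 1ℤ) - + 2 * j
  eq = solve-∀
-- At `j = -1` the left side asks for `u` parts of size at most 0. Only the empty partition
-- qualifies, and Dyson's map does not apply to it; it makes up the correction term.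
dyson-pointwise u -[1+ 0 ] x = begin
  atMost 0ℤ (-1ℤ + + u + 1ℤ) x ≡⟨ atMost-0 _ x ⟩
  pe 0ℤ (-1ℤ + + u + 1ℤ) x ≡⟨ cong (λ z → pe 0ℤ z x) (eq (+ u)) ⟩
  pe 0ℤ (+ u) x          ≡⟨ *-identityʳ _ ⟨
  pe 0ℤ (+ u) x * 1ℤ     ≡⟨ +-identityˡ _ ⟨
  0ℤ + pe 0ℤ (+ u) x * 1ℤ ≡⟨ cong (_+ pe 0ℤ (+ u) x * 1ℤ) (atMost-negʳ (-1ℤ + (+ 2 + + u)) 0 (x - + 2 * (+ u + 1ℤ))) ⟨
  atMost (-1ℤ + (+ 2 + + u)) -1ℤ (x - + 2 * (+ u + 1ℤ)) + pe 0ℤ (+ u) x * 1ℤ ∎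
  where
  open ≡-Reasoning
  eq : ∀ u → -1ℤ + u + 1ℤ ≡ u
  eq = solve-∀
dyson-pointwise u -[1+ suc j ] x = trans (atMost-negˡ j _ x) (sym (cong (_+ 0ℤ) (atMost-negʳ (-[1+ suc j ] + (+ 2 + + u)) (suc j) (x - + 2 * (+ u + 1ℤ)))))

-- The number of parts on the left is `j + u + 1`, on the right it is `j`; summing the pointwise
-- identity over `j` gives the recurrence. The term `pe 0ℤ (+ u) x` is the empty partition, present
-- only for `u = 0`.
dyson : ∀ u x → H (- + u) x ≡ H (+ 2 + + u) (x - + 2 * (+ u + 1ℤ)) + pe 0ℤ (+ u) x
dyson u x = begin
  H (- + u) x
    ≡⟨ H-rows (- + u) x ⟩
  ∑ (λ k → atMost (k + - + u) k x) _
    ≡⟨ ∑-shift (+ u + 1ℤ) (λ k → atMost (k + - + u) k x) _ (fs-shift (+ u + 1ℤ) (H-rows-fs (- + u) x)) ⟩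
  ∑ (λ j → atMost (j + (+ u + 1ℤ) + - + u) (j + (+ u + 1ℤ)) x) _
    ≡⟨ ∑-cong _ r (λ j → trans (cong₂ (λ a b → atMost a b x) (eq j (+ u)) (sym (+-assoc j (+ u) 1ℤ))) (dyson-pointwise u j x)) ⟩
  ∑ (λ j → atMost (j + (+ 2 + + u)) j y + pe (j + 1ℤ) (+ u) x * δ (j + 1ℤ)) r
    ≡⟨ ∑-+ (H-rows-fs (+ 2 + + u) y) q r ⟩
  ∑ (λ j → atMost (j + (+ 2 + + u)) j y) _ + ∑ (λ j → pe (j + 1ℤ) (+ u) x * δ (j + 1ℤ)) q
    ≡⟨ cong₂ _+_ (sym (H-rows (+ 2 + + u) y)) (trans (∑-single q -1ℤ off) (*-identityʳ _)) ⟩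
  H (+ 2 + + u) y + pe 0ℤ (+ u) x ∎
  where
  open ≡-Reasoning
  y = x - + 2 * (+ u + 1ℤ)
  eq : ∀ j u → j + (u + 1ℤ) + - u ≡ j + 1ℤ
  eq = solve-∀
  back : ∀ j → j ≡ j + 1ℤ - 1ℤ
  back = solve-∀
  off : ∀ j → j ≢ -1ℤ → pe (j + 1ℤ) (+ u) x * δ (j + 1ℤ) ≡ 0ℤ
  off j ne = trans (cong (pe (j + 1ℤ) (+ u) x *_) (δ-≢ λ z → ne (trans (back j) (cong (_- 1ℤ) z)))) (*-zeroʳ (pe (j + 1ℤ) (+ u) x))
  q : FinSupp (λ j → pe (j + 1ℤ) (+ u) x * δ (j + 1ℤ))
  q = fs-single -1ℤ off
  r = fs-+ (H-rows-fs (+ 2 + + u) y) q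

-- Theta series acting on P

pronic-nonneg : ∀ i → 0ℤ ≤ i * (i + 1ℤ)
pronic-nonneg (+ n)        = *-nonneg {+ n} {+ n + 1ℤ} (+-≥0 n) (+-≥0 _)
pronic-nonneg -[1+ 0 ]     = +≤+ z≤n
pronic-nonneg -[1+ suc n ] = +≤+ z≤n

-- Summed over n, PT y is the product of the partition generating function and Σ (-1)ⁿ q^(n(3n+1)/2 + ny); D sums over all n and Lo over n < 0.
PT : ℤ → ℤ → ℤ → ℤ
PT y x n = sgn n * P (x - (n * (+ 3 * n + 1ℤ) + + 2 * n * y))

PT-fs : ∀ y x → FinSupp (PT y x)
PT-fs y x = fs-bounded (x + y * y + 1ℤ) w
  where
  e₁ : ∀ x y n → x + y * y + 1ℤ - n ≡ (x - (n * (+ 3 * n + 1ℤ) + + 2 * n * y)) + (n * n + n * n + (n + y) * (n + y) + 1ℤ)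
  e₁ = solve-∀
  e₂ : ∀ x y n → x + y * y + 1ℤ - - n ≡ (x - (n * (+ 3 * n + 1ℤ) + + 2 * n * y)) + (n * n + (n + 1ℤ) * (n + 1ℤ) + (n + y) * (n + y))
  e₂ = solve-∀
  w : ∀ n → PT y x n ≡ 0ℤ ⊎ + ∣ n ∣ ≤ x + y * y + 1ℤ
  w n with P-supp (x - (n * (+ 3 * n + 1ℤ) + + 2 * n * y))
  ... | inj₁ z = inj₁ (trans (cong (sgn n *_) z) (*-zeroʳ (sgn n)))
  ... | inj₂ h = inj₂ (∣∣-≤ n
          (≤-from (e₁ x y n) (+-nonneg h (+-nonneg (+-nonneg (+-nonneg (sq-nonneg n) (sq-nonneg n)) (sq-nonneg (n + y))) (+-≥0 1))))
          (≤-from (e₂ x y n) (+-nonneg h (+-nonneg (+-nonneg (sq-nonneg n) (sq-nonneg (n + 1ℤ))) (sq-nonneg (n + y))))))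

D : ℤ → ℤ → ℤ
D y x = ∑ (PT y x) (PT-fs y x)

Lo-fs : ∀ y x → FinSupp (λ n → pos (- n - 1ℤ) * PT y x n)
Lo-fs y x = fs-* (λ n → pos (- n - 1ℤ)) (PT-fs y x)

Lo : ℤ → ℤ → ℤ
Lo y x = ∑ (λ n → pos (- n - 1ℤ) * PT y x n) (Lo-fs y x)

PT-0 : ∀ y x → PT y x 0ℤ ≡ P x
PT-0 y x = trans (*-identityˡ _) (cong P (e x y))
  where
  e : ∀ x y → x - (0ℤ * (+ 3 * 0ℤ + 1ℤ) + + 2 * 0ℤ * y) ≡ x
  e = solve-∀

≤0-split : ∀ y x q → ∑ (λ n → pos (- n) * PT y x n) q ≡ P x + Lo y x
≤0-split y x q = begin
  ∑ (λ n → pos (- n) * PT y x n) q ≡⟨ ∑-cong q (fs-+ d (Lo-fs y x)) pt ⟩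
  ∑ (λ n → δ n * PT y x n + pos (- n - 1ℤ) * PT y x n) _ ≡⟨ ∑-+ d (Lo-fs y x) _ ⟩
  ∑ (λ n → δ n * PT y x n) d + Lo y x ≡⟨ cong (_+ Lo y x) (trans (∑-single d 0ℤ (λ n ne → cong (_* PT y x n) (δ-≢ ne)))
                                                   (trans (*-identityˡ _) (PT-0 y x))) ⟩
  P x + Lo y x ∎
  where
  open ≡-Reasoning
  d : FinSupp (λ n → δ n * PT y x n)
  d = fs-* δ (PT-fs y x)
  e : ∀ n → pos (- n) ≡ δ n + pos (- n - 1ℤ)
  e (+ 0)     = refl
  e (+ suc n) = refl
  e -[1+ n ]  = refl
  pt : ∀ n → pos (- n) * PT y x n ≡ δ n * PT y x n + pos (- n - 1ℤ) * PT y x n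
  pt n = trans (cong (_* PT y x n) (e n)) (*-distribʳ-+ (PT y x n) (δ n) _)

-- Moving `n` by one splits off the summand `n = -1`, which is the `P` term, and lowers `y` by 3.
-- The same step of 3 appears when Dyson's recurrence is combined with `H-compl`.
Lo-rec : ∀ y x → Lo y x ≡ - (P (x - + 2 * (1ℤ - y)) + Lo (y - + 3) (x - + 2 * (1ℤ - y)))
Lo-rec y x = begin
  Lo y x
    ≡⟨ ∑-shift -1ℤ (λ n → pos (- n - 1ℤ) * PT y x n) _ (fs-shift -1ℤ (Lo-fs y x)) ⟩
  ∑ (λ n → pos (- (n + -1ℤ) - 1ℤ) * PT y x (n + -1ℤ)) _
    ≡⟨ ∑-cong _ r pt ⟩
  ∑ (λ n → -1ℤ * (pos (- n) * PT (y - + 3) x′ n)) r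
    ≡⟨ ∑-* -1ℤ q r ⟩
  -1ℤ * ∑ (λ n → pos (- n) * PT (y - + 3) x′ n) q
    ≡⟨ -1*i≡-i _ ⟩
  - ∑ (λ n → pos (- n) * PT (y - + 3) x′ n) q
    ≡⟨ cong -_ (≤0-split (y - + 3) x′ q) ⟩
  - (P x′ + Lo (y - + 3) x′) ∎
  where
  open ≡-Reasoning
  x′ = x - + 2 * (1ℤ - y)
  q : FinSupp (λ n → pos (- n) * PT (y - + 3) x′ n)
  q = fs-* (λ n → pos (- n)) (PT-fs (y - + 3) x′)
  r = fs-* (λ _ → -1ℤ) q
  e₁ : ∀ n → - (n + -1ℤ) - 1ℤ ≡ - n
  e₁ = solve-∀
  e₂ : ∀ x y n → x - ((n + -1ℤ) * (+ 3 * (n + -1ℤ) + 1ℤ) + + 2 * (n + -1ℤ) * y) ≡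
                 x - + 2 * (1ℤ - y) - (n * (+ 3 * n + 1ℤ) + + 2 * n * (y - + 3))
  e₂ = solve-∀
  e₃ : ∀ n → n + -1ℤ ≡ n + 1ℤ + (-1ℤ + -1ℤ)
  e₃ = solve-∀
  e₄ : ∀ a s p → a * (- s * p) ≡ -1ℤ * (a * (s * p))
  e₄ = solve-∀
  pt : ∀ n → pos (- (n + -1ℤ) - 1ℤ) * PT y x (n + -1ℤ) ≡ -1ℤ * (pos (- n) * PT (y - + 3) x′ n)
  pt n = trans (cong₂ (λ a b → pos a * b) (e₁ n) (cong₂ (λ a b → a * P b) (sgn-odd (n + -1ℤ) n -1ℤ (e₃ n)) (e₂ x y n)))
               (e₄ (pos (- n)) (sgn n) _)

Lo-neg : ∀ u x → x + 1ℤ ≤ 0ℤ → Lo (- + u) x ≡ 0ℤ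
Lo-neg u x neg = ∑-zero _ z
  where
  e₂ : ∀ x l u → x ≡ (x - ((- (1ℤ + l)) * (+ 3 * (- (1ℤ + l)) + 1ℤ) + + 2 * (- (1ℤ + l)) * - u))
                 + ((1ℤ + l) * (+ 3 * l + + 2) + + 2 * ((1ℤ + l) * u))
  e₂ = solve-∀
  z : ∀ n → pos (- n - 1ℤ) * PT (- + u) x n ≡ 0ℤ
  z (+ 0)     = refl
  z (+ suc n) = refl
  z n@(-[1+ l ]) with P-supp (x - (n * (+ 3 * n + 1ℤ) + + 2 * n * - + u))
  ... | inj₁ p = trans (cong (pos (- n - 1ℤ) *_) (trans (cong (sgn n *_) p) (*-zeroʳ (sgn n)))) (*-zeroʳ (pos (- n - 1ℤ)))
  ... | inj₂ h = ⊥-elim (≤⇒≯ (≤-trans (+-monoˡ-≤ 1ℤ nonneg) neg) (ℤ.+<+ (s≤s z≤n)))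
    where
    nonneg : 0ℤ ≤ x
    nonneg = subst (0ℤ ≤_) (sym (e₂ x (+ l) (+ u)))
      (+-nonneg h (+-nonneg (*-nonneg {+ suc l} {+ 3 * + l + + 2} (+-≥0 _) (+-nonneg (*-nonneg {+ 3} {+ l} (+-≥0 _) (+-≥0 _)) (+-≥0 2)))
                            (*-nonneg {+ 2} {+ suc l * + u} (+-≥0 _) (*-nonneg {+ suc l} {+ u} (+-≥0 _) (+-≥0 _)))))

-- Dyson's recurrence with `H-compl` reads `H (-(u+1)) x = P x′ - H (-(u+4)) x′`, which is `Lo-rec`
-- for `- Lo`. As `x′ < x`, induction on a bound for `x + 1` applies; for negative `x` both sides
-- vanish.
H-Lo-bounded : ∀ b u x → x + 1ℤ ≤ + b → H (- + suc u) x ≡ - Lo (- + suc u) x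
H-Lo-bounded 0 u x l = trans (H0 x l) (sym (cong -_ (Lo-neg (suc u) x l)))
  where
  H0 : ∀ x → x + 1ℤ ≤ 0ℤ → H (- + suc u) x ≡ 0ℤ
  H0 (+ n) (+≤+ l) = ⊥-elim (ℕₚ.1+n≰n (ℕₚ.≤-trans (ℕₚ.m≤n+m 1 n) l))
  H0 -[1+ n ] _ = H-neg -[1+ u ] n
H-Lo-bounded (suc b) u x l = begin
  H (- + suc u) x
    ≡⟨ trans (dyson (suc u) x) (+-identityʳ _) ⟩
  H (+ 2 + + suc u) x′
    ≡⟨ add-sub (H (+ 2 + + suc u) x′) (H (- + suc v) x′) ⟩
  H (+ 2 + + suc u) x′ + H (- + suc v) x′ - H (- + suc v) x′
    ≡⟨ cong₂ _-_ (H-compl (+ 2 + + suc u) x′) (H-Lo-bounded b v x′ l′) ⟩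
  P x′ - - Lo (- + suc v) x′
    ≡⟨ dbl (P x′) (Lo (- + suc v) x′) ⟩
  - - (P x′ + Lo (- + suc v) x′)
    ≡⟨ cong₂ (λ a b → - - (P a + Lo b a)) (cong (λ z → x - + 2 * z) (e₂ (+ u))) (e₃ (+ u)) ⟩
  - - (P (x - + 2 * (1ℤ - - + suc u)) + Lo (- + suc u - + 3) (x - + 2 * (1ℤ - - + suc u)))
    ≡⟨ cong -_ (Lo-rec (- + suc u) x) ⟨
  - Lo (- + suc u) x ∎
  where
  open ≡-Reasoning
  x′ = x - + 2 * (+ suc u + 1ℤ)
  v = 3 ℕ.+ u
  add-sub : ∀ a b → a ≡ a + b - b
  add-sub = solve-∀
  dbl : ∀ a b → a - - b ≡ - - (a + b)
  dbl = solve-∀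
  e₂ : ∀ u → 1ℤ + u + 1ℤ ≡ 1ℤ - - (1ℤ + u)
  e₂ = solve-∀
  e₃ : ∀ u → - (+ 4 + u) ≡ - (1ℤ + u) - + 3
  e₃ = solve-∀
  e₄ : ∀ b x u → b - (x - + 2 * (1ℤ + u + 1ℤ) + 1ℤ) ≡ (1ℤ + b - (x + 1ℤ)) + (+ 2 * u + + 3)
  e₄ = solve-∀
  l′ : x′ + 1ℤ ≤ + b
  l′ = ≤-from (e₄ (+ b) x (+ u)) (+-nonneg (i≤j⇒0≤j-i l) (+-nonneg (*-nonneg {+ 2} {+ u} (+-≥0 _) (+-≥0 _)) (+-≥0 3)))

H-Lo : ∀ u x → H (- + suc u) x ≡ - Lo (- + suc u) x
H-Lo u x = H-Lo-bounded ∣ x + 1ℤ ∣ u x (∣∣-≥ (x + 1ℤ))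
  where
  ∣∣-≥ : ∀ i → i ≤ + ∣ i ∣
  ∣∣-≥ (+ n) = ≤-refl
  ∣∣-≥ -[1+ n ] = -≤+

-- The substitution `n ↦ -n` turns the exponent for `y` into the one for `-1 - y`, so the half
-- `n > 0` of `D y` is `Lo (-1 - y)`.
D-split : ∀ y x → D y x ≡ P x + Lo (-1ℤ - y) x + Lo y x
D-split y x = begin
  D y x
    ≡⟨ ∑-cong _ (fs-+ hi (Lo-fs y x)) pt ⟩
  ∑ (λ n → pos n * PT y x n + pos (- n - 1ℤ) * PT y x n) _
    ≡⟨ ∑-+ hi (Lo-fs y x) _ ⟩
  ∑ (λ n → pos n * PT y x n) hi + Lo y x
    ≡⟨ cong (_+ Lo y x) (∑-reflect 0ℤ (λ n → pos n * PT y x n) hi (fs-reflect 0ℤ hi)) ⟩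
  ∑ (λ n → pos (0ℤ - n) * PT y x (0ℤ - n)) _ + Lo y x
    ≡⟨ cong (_+ Lo y x) (∑-cong _ q pt′) ⟩
  ∑ (λ n → pos (- n) * PT (-1ℤ - y) x n) q + Lo y x
    ≡⟨ cong (_+ Lo y x) (≤0-split (-1ℤ - y) x q) ⟩
  P x + Lo (-1ℤ - y) x + Lo y x ∎
  where
  open ≡-Reasoning
  hi : FinSupp (λ n → pos n * PT y x n)
  hi = fs-* pos (PT-fs y x)
  q : FinSupp (λ n → pos (- n) * PT (-1ℤ - y) x n)
  q = fs-* (λ n → pos (- n)) (PT-fs (-1ℤ - y) x)
  pt : ∀ n → PT y x n ≡ pos n * PT y x n + pos (- n - 1ℤ) * PT y x n
  pt n = trans (trans (sym (*-identityˡ _)) (cong (_* PT y x n) (sym (pos-compl n)))) (*-distribʳ-+ (PT y x n) (pos n) _)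
  e : ∀ x y n → x - ((0ℤ - n) * (+ 3 * (0ℤ - n) + 1ℤ) + + 2 * (0ℤ - n) * y) ≡ x - (n * (+ 3 * n + 1ℤ) + + 2 * n * (-1ℤ - y))
  e = solve-∀
  pt′ : ∀ n → pos (0ℤ - n) * PT y x (0ℤ - n) ≡ pos (- n) * PT (-1ℤ - y) x n
  pt′ n = cong₂ (λ a b → pos a * b) (+-identityˡ (- n)) (cong₂ (λ a b → a * P b) (sgn-neg n) (e x y n))
    where
    sgn-neg : ∀ n → sgn (0ℤ - n) ≡ sgn n
    sgn-neg n = sgn-mod2 (0ℤ - n) n (- n) (f n)
      where
      f : ∀ n → 0ℤ - n ≡ n + (- n + - n)
      f = solve-∀

H-split-≥0 : ∀ m x → pos m ≡ 1ℤ → H (-1ℤ - m) x ≡ - Lo (-1ℤ - m) x → H m x ≡ pos m * D m x - Lo m x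
H-split-≥0 m x e h = begin
  H m x
    ≡⟨ add-sub (H m x) (H (-1ℤ - m) x) ⟩
  H m x + H (-1ℤ - m) x - H (-1ℤ - m) x
    ≡⟨ cong₂ _-_ (H-compl m x) h ⟩
  P x - - Lo (-1ℤ - m) x
    ≡⟨ fin (P x) (Lo (-1ℤ - m) x) (Lo m x) ⟩
  1ℤ * (P x + Lo (-1ℤ - m) x + Lo m x) - Lo m x
    ≡⟨ cong₂ (λ y z → y * z - Lo m x) (sym e) (sym (D-split m x)) ⟩
  pos m * D m x - Lo m x ∎
  where
  open ≡-Reasoning
  add-sub : ∀ a b → a ≡ a + b - b
  add-sub = solve-∀
  fin : ∀ p a b → p - - a ≡ 1ℤ * (p + a + b) - b
  fin = solve-∀

-- For `m ≥ 0` pass to `-1 - m` by `H-compl` and use `D-split`. The factor `pos m` merges the two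
-- cases into one formula that can be summed over `m`.
H-split : ∀ m x → H m x ≡ pos m * D m x - Lo m x
H-split -[1+ u ] x = trans (H-Lo u x) (sym (+-identityˡ _))
H-split (+ m)    x = H-split-≥0 (+ m) x refl (subst (λ z → H z x ≡ - Lo z x) (e (+ m)) (H-Lo m x))
  where
  e : ∀ m → - (1ℤ + m) ≡ -1ℤ - m
  e = solve-∀

-- Euler's theorem comes out of Dyson's recurrence at `u = 0`: by `H-split`, `D 0` is `H 0 + Lo 0`,
-- where `H 0 x` is `H 2 x′ + δ x` and `Lo-rec` makes `Lo 0 x` equal to `- H 2 x′`.
pentagonal : ∀ x → D 0ℤ x ≡ δ x
pentagonal x = begin
  D 0ℤ x
    ≡⟨ rearr (D 0ℤ x) (Lo 0ℤ x) ⟩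
  1ℤ * D 0ℤ x - Lo 0ℤ x + Lo 0ℤ x
    ≡⟨ cong₂ _+_ (sym (H-split 0ℤ x)) (Lo-rec 0ℤ x) ⟩
  H 0ℤ x + - (P x′ + Lo (- + 3) x′)
    ≡⟨ cong₂ (λ a b → a + - b) (dyson 0 x) low ⟩
  H (+ 2) x′ + δ x + - H (+ 2) x′
    ≡⟨ fin (H (+ 2) x′) (δ x) ⟩
  δ x ∎
  where
  open ≡-Reasoning
  x′ = x - + 2 * (1ℤ - 0ℤ)
  rearr : ∀ a b → a ≡ 1ℤ * a - b + b
  rearr = solve-∀
  fin : ∀ a b → a + b + - a ≡ b
  fin = solve-∀
  dbl : ∀ a b → a + b ≡ a - - b
  dbl = solve-∀
  sub : ∀ a b → a + b - b ≡ a
  sub = solve-∀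
  low : P x′ + Lo (- + 3) x′ ≡ H (+ 2) x′
  low = begin
    P x′ + Lo (- + 3) x′                      ≡⟨ dbl (P x′) (Lo (- + 3) x′) ⟩
    P x′ - - Lo (- + 3) x′                    ≡⟨ cong₂ _-_ (H-compl (+ 2) x′) (H-Lo 2 x′) ⟨
    H (+ 2) x′ + H (- + 3) x′ - H (- + 3) x′  ≡⟨ sub (H (+ 2) x′) (H (- + 3) x′) ⟩
    H (+ 2) x′ ∎

-- Shifting `n` by `v` absorbs the linear term `3v` and leaves the series at `y = 0`, displaced by a
-- constant exponent.
D-0 : ∀ v x → D (+ 3 * v) x ≡ sgn v * δ (x + (+ 3 * v * v + v))
D-0 v x = begin
  D (+ 3 * v) x
    ≡⟨ ∑-shift (- v) (PT (+ 3 * v) x) _ (fs-shift (- v) (PT-fs (+ 3 * v) x)) ⟩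
  ∑ (λ n → PT (+ 3 * v) x (n + - v)) _
    ≡⟨ ∑-cong _ r pt ⟩
  ∑ (λ n → sgn v * PT 0ℤ x′ n) r
    ≡⟨ ∑-* (sgn v) (PT-fs 0ℤ x′) r ⟩
  sgn v * D 0ℤ x′
    ≡⟨ cong (sgn v *_) (pentagonal x′) ⟩
  sgn v * δ x′ ∎
  where
  open ≡-Reasoning
  x′ = x + (+ 3 * v * v + v)
  r = fs-* (λ _ → sgn v) (PT-fs 0ℤ x′)
  e₁ : ∀ x v n → x - ((n + - v) * (+ 3 * (n + - v) + 1ℤ) + + 2 * (n + - v) * (+ 3 * v)) ≡ x + (+ 3 * v * v + v) - (n * (+ 3 * n + 1ℤ) + + 2 * n * 0ℤ)
  e₁ = solve-∀
  e₂ : ∀ n v → n + - v ≡ v + n + (- v + - v)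
  e₂ = solve-∀
  pt : ∀ n → PT (+ 3 * v) x (n + - v) ≡ sgn v * PT 0ℤ x′ n
  pt n = trans (cong₂ (λ a b → a * P b) (trans (sgn-mod2 (n + - v) (v + n) (- v) (e₂ n v)) (sgn-+ v n)) (e₁ x v n))
               (*-assoc (sgn v) (sgn n) _)

-- Here a reflection, `n ↦ -1 - v - n`, is what carries the series to `y = 0`; it also contributes
-- the extra sign.
D-2 : ∀ v x → D (+ 3 * v + + 2) x ≡ - sgn v * δ (x + (+ 3 * v * v + + 5 * v + + 2))
D-2 v x = begin
  D y x
    ≡⟨ ∑-reflect (-1ℤ - v) (PT y x) _ (fs-reflect (-1ℤ - v) (PT-fs y x)) ⟩
  ∑ (λ n → PT y x (-1ℤ - v - n)) _
    ≡⟨ ∑-cong _ r pt ⟩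
  ∑ (λ n → - sgn v * PT 0ℤ x′ n) r
    ≡⟨ ∑-* (- sgn v) (PT-fs 0ℤ x′) r ⟩
  - sgn v * D 0ℤ x′
    ≡⟨ cong (- sgn v *_) (pentagonal x′) ⟩
  - sgn v * δ x′ ∎
  where
  open ≡-Reasoning
  y = + 3 * v + + 2
  x′ = x + (+ 3 * v * v + + 5 * v + + 2)
  r = fs-* (λ _ → - sgn v) (PT-fs 0ℤ x′)
  e₁ : ∀ x v n → x - ((-1ℤ - v - n) * (+ 3 * (-1ℤ - v - n) + 1ℤ) + + 2 * (-1ℤ - v - n) * (+ 3 * v + + 2)) ≡
                 x + (+ 3 * v * v + + 5 * v + + 2) - (n * (+ 3 * n + 1ℤ) + + 2 * n * 0ℤ)
  e₁ = solve-∀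
  e₃ : ∀ n v → -1ℤ - v - n ≡ v + n + 1ℤ + ((-1ℤ - v - n) + (-1ℤ - v - n))
  e₃ = solve-∀
  pt : ∀ n → PT y x (-1ℤ - v - n) ≡ - sgn v * PT 0ℤ x′ n
  pt n = trans (cong₂ (λ a b → a * P b) (trans (sgn-odd (-1ℤ - v - n) (v + n) (-1ℤ - v - n) (e₃ n v)) (trans (cong -_ (sgn-+ v n)) (neg-distribˡ-* (sgn v) (sgn n)))) (e₁ x v n))
               (*-assoc (- sgn v) (sgn n) _)

self-neg : ∀ a → a ≡ - a → a ≡ 0ℤ
self-neg (+ 0)     _ = refl
self-neg (+ suc n) ()
self-neg -[1+ n ]  ()

-- The reflection `n ↦ -1 - 2v - n` preserves the exponent and reverses the sign, so the terms
-- cancel in pairs.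
D-1 : ∀ v x → D (+ 3 * v + 1ℤ) x ≡ 0ℤ
D-1 v x = self-neg _ (begin
  D y x
    ≡⟨ ∑-reflect (-1ℤ - + 2 * v) (PT y x) _ (fs-reflect (-1ℤ - + 2 * v) (PT-fs y x)) ⟩
  ∑ (λ n → PT y x (-1ℤ - + 2 * v - n)) _
    ≡⟨ ∑-cong _ r pt ⟩
  ∑ (λ n → -1ℤ * PT y x n) r
    ≡⟨ ∑-* -1ℤ (PT-fs y x) r ⟩
  -1ℤ * D y x
    ≡⟨ -1*i≡-i _ ⟩
  - D y x ∎)
  where
  open ≡-Reasoning
  y = + 3 * v + 1ℤ
  r = fs-* (λ _ → -1ℤ) (PT-fs y x)
  e₁ : ∀ x v n → x - ((-1ℤ - + 2 * v - n) * (+ 3 * (-1ℤ - + 2 * v - n) + 1ℤ) + + 2 * (-1ℤ - + 2 * v - n) * (+ 3 * v + 1ℤ)) ≡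
                 x - (n * (+ 3 * n + 1ℤ) + + 2 * n * (+ 3 * v + 1ℤ))
  e₁ = solve-∀
  e₃ : ∀ n v → -1ℤ - + 2 * v - n ≡ n + 1ℤ + ((-1ℤ - v - n) + (-1ℤ - v - n))
  e₃ = solve-∀
  e₄ : ∀ s p → - s * p ≡ -1ℤ * (s * p)
  e₄ = solve-∀
  pt : ∀ n → PT y x (-1ℤ - + 2 * v - n) ≡ -1ℤ * PT y x n
  pt n = trans (cong₂ (λ a b → a * P b) (sgn-odd (-1ℤ - + 2 * v - n) n (-1ℤ - v - n) (e₃ n v)) (e₁ x v n)) (e₄ (sgn n) _)

-- The product of the rank generating function with a theta series

theta-bound : ∀ x k → 0ℤ ≤ x - + 3 * (k * (k - 1ℤ)) → + ∣ k ∣ ≤ x + + 4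
theta-bound x k h = ∣∣-≤ k
    (≤-from (e₁ x k) (+-nonneg h (+-nonneg (+-nonneg (+-nonneg (sq-nonneg (k - 1ℤ)) (sq-nonneg (k - 1ℤ))) (sq-nonneg k)) (+-≥0 2))))
    (≤-from (e₂ x k) (+-nonneg h (+-nonneg (+-nonneg (+-nonneg (sq-nonneg (k - 1ℤ)) (sq-nonneg k)) (sq-nonneg k)) (+-≥0 3))))
  where
  e₁ : ∀ x k → x + + 4 - k ≡ (x - + 3 * (k * (k - 1ℤ))) + ((k - 1ℤ) * (k - 1ℤ) + (k - 1ℤ) * (k - 1ℤ) + k * k + + 2)
  e₁ = solve-∀
  e₂ : ∀ x k → x + + 4 - - k ≡ (x - + 3 * (k * (k - 1ℤ))) + ((k - 1ℤ) * (k - 1ℤ) + k * k + k * k + + 3)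
  e₂ = solve-∀

E-fs : ∀ t x → FinSupp (λ k → sgn k * H (t - + 2 * k) (x - + 3 * (k * (k - 1ℤ))))
E-fs t x = fs-bounded (x + + 4) λ k → ⊎-*ˡ (sgn k) (H (t - + 2 * k) (x - + 3 * (k * (k - 1ℤ))))
  (Sum.map₂ (theta-bound x k) (H-supp (t - + 2 * k) (x - + 3 * (k * (k - 1ℤ)))))

-- The coefficient of `z^t` in the product of the generating function of `H m` (marked by `z^m`)
-- with `Σ (-1)^k z^(2k) q^(3k(k-1)/2)`.
E : ℤ → ℤ → ℤ
E t x = ∑ (λ k → sgn k * H (t - + 2 * k) (x - + 3 * (k * (k - 1ℤ)))) (E-fs t x)

-- Under `k ↦ 1 - k` the rank bound `m` becomes `-1 - m`, so `H-compl` applies. The `P` terms left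
-- over form the theta series at `y = -2`, which is 0 by `D-1`.
E-sym : ∀ t x → E (1ℤ - t) x ≡ E t x
E-sym t x = begin
  E (1ℤ - t) x
    ≡⟨ ∑-reflect 1ℤ (λ k → sgn k * H (1ℤ - t - + 2 * k) (x - + 3 * (k * (k - 1ℤ)))) _ (fs-reflect 1ℤ (E-fs (1ℤ - t) x)) ⟩
  ∑ (λ k → sgn (1ℤ - k) * H (1ℤ - t - + 2 * (1ℤ - k)) (x - + 3 * ((1ℤ - k) * (1ℤ - k - 1ℤ)))) _
    ≡⟨ ∑-cong _ r pt ⟩
  ∑ (λ k → sgn k * H (t - + 2 * k) (x - + 3 * (k * (k - 1ℤ))) + -1ℤ * PT (- + 2) x k) r
    ≡⟨ ∑-+ (E-fs t x) q r ⟩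
  E t x + ∑ (λ k → -1ℤ * PT (- + 2) x k) q
    ≡⟨ cong (λ z → E t x + z) (trans (∑-* -1ℤ (PT-fs (- + 2) x) q) (cong (-1ℤ *_) (D-1 -1ℤ x))) ⟩
  E t x + 0ℤ
    ≡⟨ +-identityʳ _ ⟩
  E t x ∎
  where
  open ≡-Reasoning
  q : FinSupp (λ k → -1ℤ * PT (- + 2) x k)
  q = fs-* (λ _ → -1ℤ) (PT-fs (- + 2) x)
  r = fs-+ (E-fs t x) q
  e₁ : ∀ k → 1ℤ - k ≡ k + 1ℤ + (- k + - k)
  e₁ = solve-∀
  e₂ : ∀ t k → 1ℤ - t - + 2 * (1ℤ - k) ≡ -1ℤ - (t - + 2 * k)
  e₂ = solve-∀
  e₃ : ∀ x k → x - + 3 * ((1ℤ - k) * (1ℤ - k - 1ℤ)) ≡ x - + 3 * (k * (k - 1ℤ))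
  e₃ = solve-∀
  e₄ : ∀ x k → x - + 3 * (k * (k - 1ℤ)) ≡ x - (k * (+ 3 * k + 1ℤ) + + 2 * k * - + 2)
  e₄ = solve-∀
  e₅ : ∀ s a b → - s * b ≡ s * a + -1ℤ * (s * (a + b))
  e₅ = solve-∀
  pt : ∀ k → sgn (1ℤ - k) * H (1ℤ - t - + 2 * (1ℤ - k)) (x - + 3 * ((1ℤ - k) * (1ℤ - k - 1ℤ))) ≡
             sgn k * H (t - + 2 * k) (x - + 3 * (k * (k - 1ℤ))) + -1ℤ * PT (- + 2) x k
  pt k = begin
    sgn (1ℤ - k) * H (1ℤ - t - + 2 * (1ℤ - k)) (x - + 3 * ((1ℤ - k) * (1ℤ - k - 1ℤ)))
      ≡⟨ cong₂ _*_ (sgn-odd (1ℤ - k) k (- k) (e₁ k)) (cong₂ H (e₂ t k) (e₃ x k)) ⟩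
    - sgn k * H (-1ℤ - m) y
      ≡⟨ e₅ (sgn k) (H m y) (H (-1ℤ - m) y) ⟩
    sgn k * H m y + -1ℤ * (sgn k * (H m y + H (-1ℤ - m) y))
      ≡⟨ cong (λ z → sgn k * H m y + -1ℤ * (sgn k * z)) (trans (H-compl m y) (cong P (e₄ x k))) ⟩
    sgn k * H m y + -1ℤ * PT (- + 2) x k ∎
    where
    m = t - + 2 * k
    y = x - + 3 * (k * (k - 1ℤ))

-- The sparse side of the product identity

-- The two exponents arise from the two nonvanishing cases `D-0` and `D-2`. With `δ` for `φ` this is
-- a pair of monomials; with `P₉` it is the summand of the final formula.
G : (ℤ → ℤ) → ℤ → ℤ → ℤ → ℤ
G φ x r v = φ (x - (+ 3 * (r * (r + 1ℤ)) + + 2 * (+ 3 * r + 1ℤ) * v))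
          + φ (x - (+ 3 * (r * (r + 1ℤ)) + + 2 * (+ 3 * r + + 2) * (v + 1ℤ)))

G-supp : ∀ φ → (∀ y → φ y ≡ 0ℤ ⊎ 0ℤ ≤ y) → ∀ x r v → 0ℤ ≤ r → 0ℤ ≤ v → G φ x r v ≡ 0ℤ ⊎ (r ≤ x × v ≤ x)
G-supp φ supp x r v p q with supp (x - (+ 3 * (r * (r + 1ℤ)) + + 2 * (+ 3 * r + 1ℤ) * v))
                            | supp (x - (+ 3 * (r * (r + 1ℤ)) + + 2 * (+ 3 * r + + 2) * (v + 1ℤ)))
... | inj₁ a | inj₁ b = inj₁ (cong₂ _+_ a b)
... | inj₂ h | _ = inj₂
    ( ≤-from (e₁ x r v) (+-nonneg h (+-nonneg (+-nonneg (*-nonneg (+-≥0 3) (*-nonneg p p)) (*-nonneg (+-≥0 2) p))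
                          (*-nonneg (+-≥0 2) (*-nonneg (+-nonneg (*-nonneg (+-≥0 3) p) (+-≥0 1)) q))))
    , ≤-from (e₂ x r v) (+-nonneg h (+-nonneg (+-nonneg (*-nonneg (+-≥0 3) (*-nonneg p (+-nonneg p (+-≥0 1)))) (*-nonneg (+-≥0 6) (*-nonneg p q))) q)))
  where
  e₁ : ∀ x r v → x - r ≡ (x - (+ 3 * (r * (r + 1ℤ)) + + 2 * (+ 3 * r + 1ℤ) * v)) + (+ 3 * (r * r) + + 2 * r + + 2 * ((+ 3 * r + 1ℤ) * v))
  e₁ = solve-∀
  e₂ : ∀ x r v → x - v ≡ (x - (+ 3 * (r * (r + 1ℤ)) + + 2 * (+ 3 * r + 1ℤ) * v)) + (+ 3 * (r * (r + 1ℤ)) + + 6 * (r * v) + v)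
  e₂ = solve-∀
... | inj₁ _ | inj₂ h = inj₂
    ( ≤-from (e₁ x r v) (+-nonneg h (+-nonneg (+-nonneg (+-nonneg (*-nonneg (+-≥0 3) (*-nonneg p p)) (*-nonneg (+-≥0 8) p)) (+-≥0 4))
                          (*-nonneg (+-≥0 2) (*-nonneg (+-nonneg (*-nonneg (+-≥0 3) p) (+-≥0 2)) q))))
    , ≤-from (e₂ x r v) (+-nonneg h (+-nonneg (+-nonneg (+-nonneg (+-nonneg (*-nonneg (+-≥0 3) (*-nonneg p p)) (*-nonneg (+-≥0 9) p)) (+-≥0 4))
                          (*-nonneg (+-≥0 6) (*-nonneg p q))) (*-nonneg (+-≥0 3) q))))
  where
  e₁ : ∀ x r v → x - r ≡ (x - (+ 3 * (r * (r + 1ℤ)) + + 2 * (+ 3 * r + + 2) * (v + 1ℤ))) + (+ 3 * (r * r) + + 8 * r + + 4 + + 2 * ((+ 3 * r + + 2) * v))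
  e₁ = solve-∀
  e₂ : ∀ x r v → x - v ≡ (x - (+ 3 * (r * (r + 1ℤ)) + + 2 * (+ 3 * r + + 2) * (v + 1ℤ))) + (+ 3 * (r * r) + + 9 * r + + 4 + + 6 * (r * v) + + 3 * v)
  e₂ = solve-∀

δ-supp₀ : ∀ y → δ y ≡ 0ℤ ⊎ 0ℤ ≤ y
δ-supp₀ (+ _)    = inj₂ (+-≥0 _)
δ-supp₀ -[1+ _ ] = inj₁ refl

G-bounds : ∀ φ → (∀ y → φ y ≡ 0ℤ ⊎ 0ℤ ≤ y) → ∀ x r v → pos r * (pos v * (sgn r * G φ x r v)) ≡ 0ℤ ⊎ (+ ∣ r ∣ ≤ x × + ∣ v ∣ ≤ x)
G-bounds φ supp x -[1+ r ] v        = inj₁ refl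
G-bounds φ supp x (+ r)    -[1+ v ] = inj₁ refl
G-bounds φ supp x (+ r)    (+ v) with G-supp φ supp x (+ r) (+ v) (+-≥0 r) (+-≥0 v)
... | inj₂ b = inj₂ b
... | inj₁ z = inj₁ (trans (cong (λ z → 1ℤ * (1ℤ * (sgn (+ r) * z))) z) (e (sgn (+ r))))
  where
  e : ∀ s → 1ℤ * (1ℤ * (s * 0ℤ)) ≡ 0ℤ
  e = solve-∀

abstract
  F-term : ℤ → ℤ → ℤ → ℤ
  F-term x t r = pos r * (pos (t + + 2 * r) * (sgn r * G δ x r (t + + 2 * r)))

  F-term-def : ∀ x t r → F-term x t r ≡ pos r * (pos (t + + 2 * r) * (sgn r * G δ x r (t + + 2 * r)))
  F-term-def x t r = refl

  F-term-bounds : ∀ x t r → F-term x t r ≡ 0ℤ ⊎ (+ ∣ r ∣ ≤ x × + ∣ t + + 2 * r ∣ ≤ x)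
  F-term-bounds x t r = G-bounds δ δ-supp₀ x r (t + + 2 * r)

F-fs : ∀ t x → FinSupp (F-term x t)
F-fs t x = fs-bounded x (λ r → Sum.map₂ proj₁ (F-term-bounds x t r))

F : ℤ → ℤ → ℤ
F t x = ∑ (F-term x t) (F-fs t x)

abstract
  Lo-part : ℤ → ℤ → ℤ → ℤ
  Lo-part t x k = sgn k * Lo (t - + 2 * k) (x - + 3 * (k * (k - 1ℤ)))

  Lo-part-def : ∀ t x k → Lo-part t x k ≡ sgn k * Lo (t - + 2 * k) (x - + 3 * (k * (k - 1ℤ)))
  Lo-part-def t x k = refl

  D-part : ℤ → ℤ → ℤ → ℤ
  D-part t x k = sgn k * (pos (t - + 2 * k) * D (t - + 2 * k) (x - + 3 * (k * (k - 1ℤ))))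

  D-part-def : ∀ t x k → D-part t x k ≡ sgn k * (pos (t - + 2 * k) * D (t - + 2 * k) (x - + 3 * (k * (k - 1ℤ))))
  D-part-def t x k = refl

-- The quadratic part of the exponent is `3k² - 4kn + 3n² = 2(k-n)² + k² + n²`, hence positive
-- definite, and only finitely many pairs contribute. The identities `e₁` to `e₄` spend the squares
-- on the linear terms.
Lo-box : ∀ t x → Box (λ k n → sgn k * (pos (- n - 1ℤ) * PT (t - + 2 * k) (x - + 3 * (k * (k - 1ℤ))) n))
Lo-box t x = box-bounded C w
  where
  C = x + + 4 + t * t + (t + 1ℤ) * (t + 1ℤ)
  Q : ℤ → ℤ → ℤ
  Q k n = x - + 3 * (k * (k - 1ℤ)) - (n * (+ 3 * n + 1ℤ) + + 2 * n * (t - + 2 * k))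
  e₁ : ∀ x t k n → x + + 4 + t * t + (t + 1ℤ) * (t + 1ℤ) - k ≡
       (x - + 3 * (k * (k - 1ℤ)) - (n * (+ 3 * n + 1ℤ) + + 2 * n * (t - + 2 * k))) +
       ((k - n) * (k - n) + (k - n) * (k - n) + ((k - + 2) * (k - + 2) + ((n + t) * (n + t + 1ℤ) + (t * (t + 1ℤ) + 1ℤ))))
  e₁ = solve-∀
  e₂ : ∀ x t k n → x + + 4 + t * t + (t + 1ℤ) * (t + 1ℤ) - - k ≡
       (x - + 3 * (k * (k - 1ℤ)) - (n * (+ 3 * n + 1ℤ) + + 2 * n * (t - + 2 * k))) +
       ((k - n) * (k - n) + (k - n) * (k - n) + ((k - 1ℤ) * (k - 1ℤ) + ((n + t) * (n + t + 1ℤ) + (t * (t + 1ℤ) + + 4))))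
  e₂ = solve-∀
  e₃ : ∀ x t k n → x + + 4 + t * t + (t + 1ℤ) * (t + 1ℤ) - n ≡
       (x - + 3 * (k * (k - 1ℤ)) - (n * (+ 3 * n + 1ℤ) + + 2 * n * (t - + 2 * k))) +
       ((k - n) * (k - n) + (k - n) * (k - n) + ((k - + 2) * (k - + 2 + 1ℤ) + ((n + t) * (n + t) + ((t + 1ℤ) * (t + 1ℤ) + + 2))))
  e₃ = solve-∀
  e₄ : ∀ x t k n → x + + 4 + t * t + (t + 1ℤ) * (t + 1ℤ) - - n ≡
       (x - + 3 * (k * (k - 1ℤ)) - (n * (+ 3 * n + 1ℤ) + + 2 * n * (t - + 2 * k))) +
       ((k - n) * (k - n) + (k - n) * (k - n) + ((k - + 2) * (k - + 2 + 1ℤ) + ((n + t + 1ℤ) * (n + t + 1ℤ) + (t * t + + 2))))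
  e₄ = solve-∀
  sum : ∀ k n {a b c d} → 0ℤ ≤ Q k n → 0ℤ ≤ a → 0ℤ ≤ b → 0ℤ ≤ c → 0ℤ ≤ d →
        0ℤ ≤ Q k n + ((k - n) * (k - n) + (k - n) * (k - n) + (a + (b + (c + d))))
  sum k n h a b c d = +-nonneg h (+-nonneg (+-nonneg (sq-nonneg (k - n)) (sq-nonneg (k - n))) (+-nonneg a (+-nonneg b (+-nonneg c d))))
  zero : ∀ a b c → a * (b * (c * 0ℤ)) ≡ 0ℤ
  zero = solve-∀
  bounds : ∀ k n → 0ℤ ≤ Q k n → + ∣ k ∣ ≤ C × + ∣ n ∣ ≤ C
  bounds k n h =
      ∣∣-≤ k (≤-from (e₁ x t k n) (sum k n h (sq-nonneg (k - + 2)) (pronic-nonneg (n + t)) (pronic-nonneg t) (+-≥0 1)))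
             (≤-from (e₂ x t k n) (sum k n h (sq-nonneg (k - 1ℤ)) (pronic-nonneg (n + t)) (pronic-nonneg t) (+-≥0 4)))
    , ∣∣-≤ n (≤-from (e₃ x t k n) (sum k n h (pronic-nonneg (k - + 2)) (sq-nonneg (n + t)) (sq-nonneg (t + 1ℤ)) (+-≥0 2)))
             (≤-from (e₄ x t k n) (sum k n h (pronic-nonneg (k - + 2)) (sq-nonneg (n + t + 1ℤ)) (sq-nonneg t) (+-≥0 2)))
  w : ∀ k n → sgn k * (pos (- n - 1ℤ) * PT (t - + 2 * k) (x - + 3 * (k * (k - 1ℤ))) n) ≡ 0ℤ ⊎ (+ ∣ k ∣ ≤ C × + ∣ n ∣ ≤ C)
  w k n = Sum.map (λ z → trans (cong (λ z → sgn k * (pos (- n - 1ℤ) * (sgn n * z))) z) (zero (sgn k) (pos (- n - 1ℤ)) (sgn n))) (bounds k n) (P-supp (Q k n))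

Lo-part-fs : ∀ t x → FinSupp (Lo-part t x)
Lo-part-fs t x = fs-cong (λ k → trans (∑-* (sgn k) (Lo-fs (t - + 2 * k) (x - + 3 * (k * (k - 1ℤ)))) (row (Lo-box t x) k)) (sym (Lo-part-def t x k)))
                         (rows (Lo-box t x) (row (Lo-box t x)))

H-parts : ∀ t x k → sgn k * H (t - + 2 * k) (x - + 3 * (k * (k - 1ℤ))) ≡ D-part t x k + -1ℤ * Lo-part t x k
H-parts t x k = trans (expand k (t - + 2 * k) (x - + 3 * (k * (k - 1ℤ)))) (sym (cong₂ (λ a b → a + -1ℤ * b) (D-part-def t x k) (Lo-part-def t x k)))
  where
  e : ∀ s a b → s * (a - b) ≡ s * a + -1ℤ * (s * b)
  e = solve-∀
  expand : ∀ k m y → sgn k * H m y ≡ sgn k * (pos m * D m y) + -1ℤ * (sgn k * Lo m y)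
  expand k m y = trans (cong (sgn k *_) (H-split m y)) (e (sgn k) (pos m * D m y) (Lo m y))

-- Finiteness is inherited: the summand is that of `E` plus that of `Lo-part`, both already known to
-- have finite support.
D-part-fs : ∀ t x → FinSupp (D-part t x)
D-part-fs t x = fs-cong (λ k → trans (cong (_+ Lo-part t x k) (H-parts t x k)) (e (D-part t x k) (Lo-part t x k)))
                        (fs-+ (E-fs t x) (Lo-part-fs t x))
  where
  e : ∀ a b → a + -1ℤ * b + b ≡ a
  e = solve-∀

E-split : ∀ t x → E t x ≡ ∑ (D-part t x) (D-part-fs t x) + - ∑ (Lo-part t x) (Lo-part-fs t x)
E-split t x = begin
  E t x
    ≡⟨ ∑-cong _ r (H-parts t x) ⟩
  ∑ (λ k → D-part t x k + -1ℤ * Lo-part t x k) r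
    ≡⟨ ∑-+ (D-part-fs t x) q r ⟩
  ∑ (D-part t x) (D-part-fs t x) + ∑ (λ k → -1ℤ * Lo-part t x k) q
    ≡⟨ cong (λ z → ∑ (D-part t x) (D-part-fs t x) + z) (trans (∑-* -1ℤ (Lo-part-fs t x) q) (-1*i≡-i _)) ⟩
  ∑ (D-part t x) (D-part-fs t x) + - ∑ (Lo-part t x) (Lo-part-fs t x) ∎
  where
  open ≡-Reasoning
  q : FinSupp (λ k → -1ℤ * Lo-part t x k)
  q = fs-* (λ _ → -1ℤ) (Lo-part-fs t x)
  r = fs-+ (D-part-fs t x) q

pos-< : ∀ i → 0ℤ ≤ -1ℤ - i → pos i ≡ 0ℤ
pos-< (+ 0)       ()
pos-< (+ suc n)   ()
pos-< -[1+ n ]    _ = refl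

pos-affine : ∀ c s → s ℕ.≤ c → ∀ i → pos (+ suc c * i + + s) ≡ pos i
pos-affine c s l (+ n)    = pos-≥ {+ suc c * + n + + s} (+-nonneg (*-nonneg {+ suc c} {+ n} (+-≥0 _) (+-≥0 n)) (+-≥0 s))
pos-affine c s l -[1+ n ] = pos-< (+ suc c * -[1+ n ] + + s)
    (subst (0ℤ ≤_) (sym (e (+ c) (+ n) (+ s))) (+-nonneg (i≤j⇒0≤j-i {+ s} {+ c} (+≤+ l)) (*-nonneg {1ℤ + + c} {+ n} (+-≥0 _) (+-≥0 n))))
  where
  e : ∀ c n s → -1ℤ - ((1ℤ + c) * - (1ℤ + n) + s) ≡ c - s + (1ℤ + c) * n
  e = solve-∀

D-even : ∀ r y → D (+ 3 * (+ 2 * r)) y ≡ δ (y + (+ 3 * (+ 2 * r) * (+ 2 * r) + + 2 * r))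
D-even r y = trans (D-0 (+ 2 * r) y) (trans (cong (_* δ (y + (+ 3 * (+ 2 * r) * (+ 2 * r) + + 2 * r))) (sgn-mod2 (+ 2 * r) 0ℤ r (e r))) (*-identityˡ _))
  where
  e : ∀ r → + 2 * r ≡ 0ℤ + (r + r)
  e = solve-∀

D-even-2 : ∀ r y → D (+ 3 * (+ 2 * r) + + 2) y ≡ - δ (y + (+ 3 * (+ 2 * r) * (+ 2 * r) + + 5 * (+ 2 * r) + + 2))
D-even-2 r y = trans (D-2 (+ 2 * r) y) (trans (cong (λ s → - s * δ (y + (+ 3 * (+ 2 * r) * (+ 2 * r) + + 5 * (+ 2 * r) + + 2))) (sgn-mod2 (+ 2 * r) 0ℤ r (e r))) (-1*i≡-i _))
  where
  e : ∀ r → + 2 * r ≡ 0ℤ + (r + r)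
  e = solve-∀

abstract
  -- The sum over k of the n-th column of Lo-part, for n = -1 - j.
  Lo-column : ℤ → ℤ → ℤ → ℤ
  Lo-column t x j = pos j * (sgn (-1ℤ - j) * D (+ 2 * j) (x - ((1ℤ + j) * (+ 3 * j + + 2) - + 2 * (1ℤ + j) * t)))

  Lo-column-def : ∀ t x j → Lo-column t x j ≡ pos j * (sgn (-1ℤ - j) * D (+ 2 * j) (x - ((1ℤ + j) * (+ 3 * j + + 2) - + 2 * (1ℤ + j) * t)))
  Lo-column-def t x j = refl

-- For fixed `n = -1 - j` the exponent as a polynomial in `k` is again `k(3k+1) + 2k(2j)` up to a
-- constant. So the sum over `k` is the complete series `D (2j)`, decided by `j` modulo 3.
Lo-column-sum : ∀ t x j → ∑ (λ k → sgn k * (pos (- (-1ℤ - j) - 1ℤ) * PT (t - + 2 * k) (x - + 3 * (k * (k - 1ℤ))) (-1ℤ - j))) (column (Lo-box t x) (-1ℤ - j))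
                        ≡ Lo-column t x j
Lo-column-sum t x j = trans (∑-cong _ r pt) (trans (∑-* (pos j * sgn n) (PT-fs (+ 2 * j) y) r)
    (trans (*-assoc (pos j) (sgn n) _) (sym (Lo-column-def t x j))))
  where
  n = -1ℤ - j
  y = x - ((1ℤ + j) * (+ 3 * j + + 2) - + 2 * (1ℤ + j) * t)
  r = fs-* (λ _ → pos j * sgn n) (PT-fs (+ 2 * j) y)
  e₀ : ∀ j → - (-1ℤ - j) - 1ℤ ≡ j
  e₀ = solve-∀
  e₁ : ∀ p s u q → s * (p * (u * q)) ≡ p * u * (s * q)
  e₁ = solve-∀
  e₂ : ∀ x t k j → x - + 3 * (k * (k - 1ℤ)) - ((-1ℤ - j) * (+ 3 * (-1ℤ - j) + 1ℤ) + + 2 * (-1ℤ - j) * (t - + 2 * k)) ≡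
                   x - ((1ℤ + j) * (+ 3 * j + + 2) - + 2 * (1ℤ + j) * t) - (k * (+ 3 * k + 1ℤ) + + 2 * k * (+ 2 * j))
  e₂ = solve-∀
  pt : ∀ k → sgn k * (pos (- n - 1ℤ) * PT (t - + 2 * k) (x - + 3 * (k * (k - 1ℤ))) n) ≡ pos j * sgn n * PT (+ 2 * j) y k
  pt k = trans (cong₂ (λ a b → sgn k * (pos a * (sgn n * P b))) (e₀ j) (e₂ x t k j)) (e₁ (pos j) (sgn k) (sgn n) _)

Lo-column-value : ∀ t x j {p s d} → pos j ≡ p → sgn (-1ℤ - j) ≡ s → D (+ 2 * j) (x - ((1ℤ + j) * (+ 3 * j + + 2) - + 2 * (1ℤ + j) * t)) ≡ d → Lo-column t x j ≡ p * (s * d)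
Lo-column-value t x j e₁ e₂ e₃ = trans (Lo-column-def t x j) (cong₂ _*_ e₁ (cong₂ _*_ e₂ e₃))

Lo-column-0 : ∀ t x r → Lo-column t x (+ 3 * r + 0ℤ) ≡ pos r * (- sgn r * δ (x - (+ 3 * (r * (r + 1ℤ)) + + 2 * (+ 3 * r + 1ℤ) * (1ℤ - t + + 2 * r))))
Lo-column-0 t x r = Lo-column-value t x (+ 3 * r + 0ℤ) (pos-affine 2 0 z≤n r) (sgn-odd (-1ℤ - (+ 3 * r + 0ℤ)) r (-1ℤ - + 2 * r) (e₁ r))
    (trans (cong₂ D (e₂ r) (e₃ x t r)) (trans (D-even r y) (cong δ (e₄ r (x - (+ 3 * (r * (r + 1ℤ)) + + 2 * (+ 3 * r + 1ℤ) * (1ℤ - t + + 2 * r)))))))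
  where
  y = x - (+ 3 * (r * (r + 1ℤ)) + + 2 * (+ 3 * r + 1ℤ) * (1ℤ - t + + 2 * r)) - (+ 3 * (+ 2 * r) * (+ 2 * r) + + 2 * r)
  e₁ : ∀ r → -1ℤ - (+ 3 * r + 0ℤ) ≡ r + 1ℤ + ((-1ℤ - + 2 * r) + (-1ℤ - + 2 * r))
  e₁ = solve-∀
  e₂ : ∀ r → + 2 * (+ 3 * r + 0ℤ) ≡ + 3 * (+ 2 * r)
  e₂ = solve-∀
  e₃ : ∀ x t r → x - ((1ℤ + (+ 3 * r + 0ℤ)) * (+ 3 * (+ 3 * r + 0ℤ) + + 2) - + 2 * (1ℤ + (+ 3 * r + 0ℤ)) * t)
               ≡ x - (+ 3 * (r * (r + 1ℤ)) + + 2 * (+ 3 * r + 1ℤ) * (1ℤ - t + + 2 * r)) - (+ 3 * (+ 2 * r) * (+ 2 * r) + + 2 * r)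
  e₃ = solve-∀
  e₄ : ∀ r z → z - (+ 3 * (+ 2 * r) * (+ 2 * r) + + 2 * r) + (+ 3 * (+ 2 * r) * (+ 2 * r) + + 2 * r) ≡ z
  e₄ = solve-∀

Lo-column-1 : ∀ t x r → Lo-column t x (+ 3 * r + 1ℤ) ≡ pos r * (sgn r * - δ (x - (+ 3 * (r * (r + 1ℤ)) + + 2 * (+ 3 * r + + 2) * (1ℤ - t + + 2 * r + 1ℤ))))
Lo-column-1 t x r = Lo-column-value t x (+ 3 * r + 1ℤ) (pos-affine 2 1 (s≤s z≤n) r) (sgn-mod2 (-1ℤ - (+ 3 * r + 1ℤ)) r (-1ℤ - + 2 * r) (e₁ r))
    (trans (cong₂ D (e₂ r) (e₃ x t r)) (trans (D-even-2 r y) (cong (λ d → - δ d) (e₄ r (x - (+ 3 * (r * (r + 1ℤ)) + + 2 * (+ 3 * r + + 2) * (1ℤ - t + + 2 * r + 1ℤ)))))))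
  where
  y = x - (+ 3 * (r * (r + 1ℤ)) + + 2 * (+ 3 * r + + 2) * (1ℤ - t + + 2 * r + 1ℤ)) - (+ 3 * (+ 2 * r) * (+ 2 * r) + + 5 * (+ 2 * r) + + 2)
  e₁ : ∀ r → -1ℤ - (+ 3 * r + 1ℤ) ≡ r + ((-1ℤ - + 2 * r) + (-1ℤ - + 2 * r))
  e₁ = solve-∀
  e₂ : ∀ r → + 2 * (+ 3 * r + 1ℤ) ≡ + 3 * (+ 2 * r) + + 2
  e₂ = solve-∀
  e₃ : ∀ x t r → x - ((1ℤ + (+ 3 * r + 1ℤ)) * (+ 3 * (+ 3 * r + 1ℤ) + + 2) - + 2 * (1ℤ + (+ 3 * r + 1ℤ)) * t)
               ≡ x - (+ 3 * (r * (r + 1ℤ)) + + 2 * (+ 3 * r + + 2) * (1ℤ - t + + 2 * r + 1ℤ)) - (+ 3 * (+ 2 * r) * (+ 2 * r) + + 5 * (+ 2 * r) + + 2)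
  e₃ = solve-∀
  e₄ : ∀ r z → z - (+ 3 * (+ 2 * r) * (+ 2 * r) + + 5 * (+ 2 * r) + + 2) + (+ 3 * (+ 2 * r) * (+ 2 * r) + + 5 * (+ 2 * r) + + 2) ≡ z
  e₄ = solve-∀

Lo-column-2 : ∀ t x r → Lo-column t x (+ 3 * r + + 2) ≡ 0ℤ
Lo-column-2 t x r = trans (Lo-column-value t x (+ 3 * r + + 2) refl refl (trans (cong (λ z → D z y) (e r)) (D-1 (+ 2 * r + 1ℤ) y)))
    (z (pos (+ 3 * r + + 2)) (sgn (-1ℤ - (+ 3 * r + + 2))))
  where
  y = x - ((1ℤ + (+ 3 * r + + 2)) * (+ 3 * (+ 3 * r + + 2) + + 2) - + 2 * (1ℤ + (+ 3 * r + + 2)) * t)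
  e : ∀ r → + 2 * (+ 3 * r + + 2) ≡ + 3 * (+ 2 * r + 1ℤ) + 1ℤ
  e = solve-∀
  z : ∀ a b → a * (b * 0ℤ) ≡ 0ℤ
  z = solve-∀

pos-monotone : ∀ t r → t ≤ 0ℤ → pos r ≡ pos r * pos (1ℤ - t + + 2 * r)
pos-monotone t -[1+ r ] l = refl
pos-monotone t (+ r)    l = sym (trans (*-identityˡ _) (pos-≥ (+-nonneg (+-nonneg (+-≥0 1) (neg-mono-≤ l)) (*-nonneg {+ 2} {+ r} (+-≥0 2) (+-≥0 r)))))

-- The columns `j = 3r` and `j = 3r + 1` give the two halves of `G` at `v = 1 - t + 2r`. For `t ≤ 0`
-- this `v` is nonnegative whenever `r` is, so the cutoff in `F-term` holds automatically.
Lo-column-F : ∀ t x r → t ≤ 0ℤ → Lo-column t x (+ 3 * r + 0ℤ) + Lo-column t x (+ 3 * r + 1ℤ) ≡ -1ℤ * F-term x (1ℤ - t) r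
Lo-column-F t x r l = begin
  Lo-column t x (+ 3 * r + 0ℤ) + Lo-column t x (+ 3 * r + 1ℤ)
    ≡⟨ cong₂ _+_ (Lo-column-0 t x r) (Lo-column-1 t x r) ⟩
  pos r * (- sgn r * d₀) + pos r * (sgn r * - d₁)
    ≡⟨ cong (λ p → p * (- sgn r * d₀) + p * (sgn r * - d₁)) (pos-monotone t r l) ⟩
  pos r * pos v * (- sgn r * d₀) + pos r * pos v * (sgn r * - d₁)
    ≡⟨ e (pos r) (pos v) (sgn r) d₀ d₁ ⟩
  -1ℤ * (pos r * (pos v * (sgn r * (d₀ + d₁))))
    ≡⟨ cong (-1ℤ *_) (F-term-def x (1ℤ - t) r) ⟨
  -1ℤ * F-term x (1ℤ - t) r ∎
  where
  open ≡-Reasoning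
  v = 1ℤ - t + + 2 * r
  d₀ = δ (x - (+ 3 * (r * (r + 1ℤ)) + + 2 * (+ 3 * r + 1ℤ) * v))
  d₁ = δ (x - (+ 3 * (r * (r + 1ℤ)) + + 2 * (+ 3 * r + + 2) * (v + 1ℤ)))
  e : ∀ p u s a b → p * u * (- s * a) + p * u * (s * - b) ≡ -1ℤ * (p * (u * (s * (a + b))))
  e = solve-∀

∑-two-classes : ∀ (f : ℤ → ℤ) p q → (∀ r → f (+ 3 * r + + 2) ≡ 0ℤ) → ∑ f p ≡ ∑ (λ r → f (+ 3 * r + 0ℤ) + f (+ 3 * r + 1ℤ)) q
∑-two-classes f p q z = trans (∑-split3 p q₀ q₁ q₂)
  (trans (cong (λ w → ∑ (λ r → f (+ 3 * r + 0ℤ)) q₀ + (∑ (λ r → f (+ 3 * r + 1ℤ)) q₁ + w)) (∑-zero q₂ z))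
  (trans (cong (λ w → ∑ (λ r → f (+ 3 * r + 0ℤ)) q₀ + w) (+-identityʳ _)) (sym (∑-+ q₀ q₁ q))))
  where
  q₀ = fs-affine (+ 3) 0ℤ p
  q₁ = fs-affine (+ 3) 1ℤ p
  q₂ = fs-affine (+ 3) (+ 2) p

∑-Lo-part : ∀ t x → t ≤ 0ℤ → ∑ (Lo-part t x) (Lo-part-fs t x) ≡ - F (1ℤ - t) x
∑-Lo-part t x l = begin
  ∑ (Lo-part t x) (Lo-part-fs t x)
    ≡⟨ ∑-cong _ rs (λ k → trans (Lo-part-def t x k) (sym (∑-* (sgn k) (Lo-fs (t - + 2 * k) (x - + 3 * (k * (k - 1ℤ)))) (row B k)))) ⟩
  ∑ (λ k → ∑ (λ n → sgn k * (pos (- n - 1ℤ) * PT (t - + 2 * k) (x - + 3 * (k * (k - 1ℤ))) n)) (row B k)) rs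
    ≡⟨ ∑-swap B (row B) (column B) rs cs ⟩
  ∑ (λ n → ∑ (λ k → sgn k * (pos (- n - 1ℤ) * PT (t - + 2 * k) (x - + 3 * (k * (k - 1ℤ))) n)) (column B n)) cs
    ≡⟨ ∑-reflect -1ℤ (λ n → ∑ (λ k → sgn k * (pos (- n - 1ℤ) * PT (t - + 2 * k) (x - + 3 * (k * (k - 1ℤ))) n)) (column B n)) cs cs′ ⟩
  ∑ (λ j → ∑ (λ k → sgn k * (pos (- (-1ℤ - j) - 1ℤ) * PT (t - + 2 * k) (x - + 3 * (k * (k - 1ℤ))) (-1ℤ - j))) (column B (-1ℤ - j))) cs′
    ≡⟨ ∑-cong cs′ L-fs (Lo-column-sum t x) ⟩
  ∑ (Lo-column t x) L-fs
    ≡⟨ ∑-two-classes (Lo-column t x) L-fs (fs-cong (λ r → sym (Lo-column-F t x r l)) mF) (Lo-column-2 t x) ⟩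
  ∑ (λ r → Lo-column t x (+ 3 * r + 0ℤ) + Lo-column t x (+ 3 * r + 1ℤ)) _
    ≡⟨ ∑-cong _ mF (λ r → Lo-column-F t x r l) ⟩
  ∑ (λ r → -1ℤ * F-term x (1ℤ - t) r) mF
    ≡⟨ trans (∑-* -1ℤ (F-fs (1ℤ - t) x) mF) (-1*i≡-i _) ⟩
  - F (1ℤ - t) x ∎
  where
  open ≡-Reasoning
  B = Lo-box t x
  rs = rows B (row B)
  cs = columns B (column B)
  cs′ = fs-reflect -1ℤ cs
  L-fs : FinSupp (Lo-column t x)
  L-fs = fs-cong (Lo-column-sum t x) cs′
  mF : FinSupp (λ r → -1ℤ * F-term x (1ℤ - t) r)
  mF = fs-* (λ _ → -1ℤ) (F-fs (1ℤ - t) x)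

D-part-0 : ∀ t x k v → t - + 2 * k ≡ + 3 * v → D-part t x k ≡ pos v * (sgn (k + v) * δ (x - + 3 * (k * (k - 1ℤ)) + (+ 3 * v * v + v)))
D-part-0 t x k v e = begin
  D-part t x k                            ≡⟨ D-part-def t x k ⟩
  sgn k * (pos (t - + 2 * k) * D (t - + 2 * k) y) ≡⟨ cong (λ z → sgn k * (pos z * D z y)) e ⟩
  sgn k * (pos (+ 3 * v) * D (+ 3 * v) y) ≡⟨ cong₂ (λ p d → sgn k * (p * d)) (trans (cong pos (sym (+-identityʳ (+ 3 * v)))) (pos-affine 2 0 z≤n v)) (D-0 v y) ⟩
  sgn k * (pos v * (sgn v * d))           ≡⟨ e′ (sgn k) (pos v) (sgn v) d ⟩
  pos v * (sgn k * sgn v * d)             ≡⟨ cong (λ s → pos v * (s * d)) (sgn-+ k v) ⟨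
  pos v * (sgn (k + v) * d) ∎
  where
  open ≡-Reasoning
  y = x - + 3 * (k * (k - 1ℤ))
  d = δ (y + (+ 3 * v * v + v))
  e′ : ∀ s p u d → s * (p * (u * d)) ≡ p * (s * u * d)
  e′ = solve-∀

D-part-2 : ∀ t x k v → t - + 2 * k ≡ + 3 * v + + 2 → D-part t x k ≡ pos v * (- sgn (k + v) * δ (x - + 3 * (k * (k - 1ℤ)) + (+ 3 * v * v + + 5 * v + + 2)))
D-part-2 t x k v e = begin
  D-part t x k                            ≡⟨ D-part-def t x k ⟩
  sgn k * (pos (t - + 2 * k) * D (t - + 2 * k) y) ≡⟨ cong (λ z → sgn k * (pos z * D z y)) e ⟩
  sgn k * (pos (+ 3 * v + + 2) * D (+ 3 * v + + 2) y) ≡⟨ cong₂ (λ p d → sgn k * (p * d)) (pos-affine 2 2 ℕₚ.≤-refl v) (D-2 v y) ⟩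
  sgn k * (pos v * (- sgn v * d))         ≡⟨ e′ (sgn k) (pos v) (sgn v) d ⟩
  pos v * (- (sgn k * sgn v) * d)         ≡⟨ cong (λ s → pos v * (- s * d)) (sgn-+ k v) ⟨
  pos v * (- sgn (k + v) * d) ∎
  where
  open ≡-Reasoning
  y = x - + 3 * (k * (k - 1ℤ))
  d = δ (y + (+ 3 * v * v + + 5 * v + + 2))
  e′ : ∀ s p u d → s * (p * (- u * d)) ≡ p * (- (s * u) * d)
  e′ = solve-∀

D-part-1 : ∀ t x k v → t - + 2 * k ≡ + 3 * v + 1ℤ → D-part t x k ≡ 0ℤ
D-part-1 t x k v e = trans (D-part-def t x k) (trans (cong (λ d → sgn k * (pos (t - + 2 * k) * d))
    (trans (cong (λ z → D z (x - + 3 * (k * (k - 1ℤ)))) e) (D-1 v (x - + 3 * (k * (k - 1ℤ)))))) (z (sgn k) (pos (t - + 2 * k))))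
  where
  z : ∀ a b → a * (b * 0ℤ) ≡ 0ℤ
  z = solve-∀

pos-restrict : ∀ t r → t ≤ 0ℤ → pos (t + + 2 * r) ≡ pos r * pos (t + + 2 * r)
pos-restrict t (+ r)    l = sym (*-identityˡ _)
pos-restrict t -[1+ r ] l = pos-< (t + + 2 * -[1+ r ])
    (subst (0ℤ ≤_) (sym (e t (+ r))) (+-nonneg (+-nonneg (neg-mono-≤ l) (+-≥0 (r ℕ.+ r))) (+-≥0 1)))
  where
  e : ∀ t r → -1ℤ - (t + + 2 * - (1ℤ + r)) ≡ - t + (r + r) + 1ℤ
  e = solve-∀

-- With `k = -t - 3r` the rank bound `t - 2k` is `3(t + 2r)`, with `k = -t - 3r - 1` it is
-- `3(t + 2r) + 2`: the cases `D-0` and `D-2`. Since `t ≤ 0`, `t + 2r ≥ 0` forces `r ≥ 0`.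
D-part-F : ∀ t x r → t ≤ 0ℤ → D-part t x (- t - (+ 3 * r + 0ℤ)) + D-part t x (- t - (+ 3 * r + 1ℤ)) ≡ F-term x t r
D-part-F t x r l = begin
  D-part t x k₀ + D-part t x k₁
    ≡⟨ cong₂ _+_ (D-part-0 t x k₀ v (a₁ t r)) (D-part-2 t x k₁ v (b₁ t r)) ⟩
  pos v * (sgn (k₀ + v) * δ (x - + 3 * (k₀ * (k₀ - 1ℤ)) + (+ 3 * v * v + v))) + pos v * (- sgn (k₁ + v) * δ (x - + 3 * (k₁ * (k₁ - 1ℤ)) + (+ 3 * v * v + + 5 * v + + 2)))
    ≡⟨ cong₂ (λ p q → pos v * p + pos v * q)
         (cong₂ (λ s d → s * δ d) (sgn-mod2 (k₀ + v) r (- r) (a₂ t r)) (a₃ x t r))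
         (cong₂ (λ s d → s * δ d) (trans (cong -_ (sgn-odd (k₁ + v) r (-1ℤ - r) (b₂ t r))) (neg-involutive (sgn r))) (b₃ x t r)) ⟩
  pos v * (sgn r * d₀) + pos v * (sgn r * d₁)
    ≡⟨ cong (λ p → p * (sgn r * d₀) + p * (sgn r * d₁)) (pos-restrict t r l) ⟩
  pos r * pos v * (sgn r * d₀) + pos r * pos v * (sgn r * d₁)
    ≡⟨ e (pos r) (pos v) (sgn r) d₀ d₁ ⟩
  pos r * (pos v * (sgn r * (d₀ + d₁)))
    ≡⟨ F-term-def x t r ⟨
  F-term x t r ∎
  where
  open ≡-Reasoning
  v = t + + 2 * r
  k₀ = - t - (+ 3 * r + 0ℤ)
  k₁ = - t - (+ 3 * r + 1ℤ)
  d₀ = δ (x - (+ 3 * (r * (r + 1ℤ)) + + 2 * (+ 3 * r + 1ℤ) * v))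
  d₁ = δ (x - (+ 3 * (r * (r + 1ℤ)) + + 2 * (+ 3 * r + + 2) * (v + 1ℤ)))
  a₁ : ∀ t r → t - + 2 * (- t - (+ 3 * r + 0ℤ)) ≡ + 3 * (t + + 2 * r)
  a₁ = solve-∀
  a₂ : ∀ t r → - t - (+ 3 * r + 0ℤ) + (t + + 2 * r) ≡ r + (- r + - r)
  a₂ = solve-∀
  a₃ : ∀ x t r → x - + 3 * ((- t - (+ 3 * r + 0ℤ)) * (- t - (+ 3 * r + 0ℤ) - 1ℤ)) + (+ 3 * (t + + 2 * r) * (t + + 2 * r) + (t + + 2 * r))
                 ≡ x - (+ 3 * (r * (r + 1ℤ)) + + 2 * (+ 3 * r + 1ℤ) * (t + + 2 * r))
  a₃ = solve-∀
  b₁ : ∀ t r → t - + 2 * (- t - (+ 3 * r + 1ℤ)) ≡ + 3 * (t + + 2 * r) + + 2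
  b₁ = solve-∀
  b₂ : ∀ t r → - t - (+ 3 * r + 1ℤ) + (t + + 2 * r) ≡ r + 1ℤ + ((-1ℤ - r) + (-1ℤ - r))
  b₂ = solve-∀
  b₃ : ∀ x t r → x - + 3 * ((- t - (+ 3 * r + 1ℤ)) * (- t - (+ 3 * r + 1ℤ) - 1ℤ)) + (+ 3 * (t + + 2 * r) * (t + + 2 * r) + + 5 * (t + + 2 * r) + + 2)
                 ≡ x - (+ 3 * (r * (r + 1ℤ)) + + 2 * (+ 3 * r + + 2) * (t + + 2 * r + 1ℤ))
  b₃ = solve-∀
  e : ∀ p u s a b → p * u * (s * a) + p * u * (s * b) ≡ p * (u * (s * (a + b)))
  e = solve-∀

∑-D-part : ∀ t x → t ≤ 0ℤ → ∑ (D-part t x) (D-part-fs t x) ≡ F t x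
∑-D-part t x l = trans (∑-reflect (- t) (D-part t x) (D-part-fs t x) L-fs)
  (trans (∑-two-classes (λ j → D-part t x (- t - j)) L-fs (fs-cong (λ r → sym (D-part-F t x r l)) (F-fs t x))
            (λ r → D-part-1 t x (- t - (+ 3 * r + + 2)) (t + + 2 * r + 1ℤ) (e t r)))
         (∑-cong _ _ (λ r → D-part-F t x r l)))
  where
  L-fs : FinSupp (λ j → D-part t x (- t - j))
  L-fs = fs-reflect (- t) (D-part-fs t x)
  e : ∀ t r → t - + 2 * (- t - (+ 3 * r + + 2)) ≡ + 3 * (t + + 2 * r + 1ℤ) + 1ℤ
  e = solve-∀

E-F-≤0 : ∀ t x → t ≤ 0ℤ → E t x ≡ F t x + F (1ℤ - t) x
E-F-≤0 t x l = trans (E-split t x) (cong₂ _+_ (∑-D-part t x l) (trans (cong -_ (∑-Lo-part t x l)) (neg-involutive _)))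

E-F-reflected : ∀ s t x → s ≡ 1ℤ - t → t ≡ 1ℤ - s → s ≤ 0ℤ → E t x ≡ F t x + F s x
E-F-reflected s t x e e′ l = begin
  E t x              ≡⟨ E-sym t x ⟨
  E (1ℤ - t) x       ≡⟨ cong (λ z → E z x) e ⟨
  E s x              ≡⟨ E-F-≤0 s x l ⟩
  F s x + F (1ℤ - s) x ≡⟨ cong (λ z → F s x + F z x) e′ ⟨
  F s x + F t x      ≡⟨ +-comm (F s x) (F t x) ⟩
  F t x + F s x      ∎
  where open ≡-Reasoning

-- The evaluation above covers `t ≤ 0`. Otherwise `1 - t ≤ 0`, and both sides are invariant under
-- `t ↦ 1 - t`.
E-F : ∀ t x → E t x ≡ F t x + F (1ℤ - t) x
E-F t x = go (t ℤₚ.≤? 0ℤ)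
  where
  e : ∀ t → t ≡ 1ℤ - (1ℤ - t)
  e = solve-∀
  go : Dec (t ≤ 0ℤ) → E t x ≡ F t x + F (1ℤ - t) x
  go (yes l) = E-F-≤0 t x l
  go (no nl) = E-F-reflected (1ℤ - t) t x refl (e t) (i≤j⇒i-j≤0 {1ℤ} {t} (i<j⇒suc[i]≤j (≰⇒> nl)))

-- Weights modulo 3

pick : ℤ → ℤ → ℤ → ℕ → ℤ
pick a b c 0             = a
pick a b c 1             = b
pick a b c (suc (suc _)) = c

cyc : ℤ → ℤ → ℤ → ℤ → ℤ
cyc a b c m = pick a b c (m %ℕ 3)

cyc-at : ∀ a b c r q → r ℕ.< 3 → cyc a b c (+ r + q * + 3) ≡ pick a b c r
cyc-at a b c r q l = cong (pick a b c) (%ℕ-unique 3 r q l)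

data Mod3 : ℤ → Set where
  mod0 : ∀ q → Mod3 (+ 0 + q * + 3)
  mod1 : ∀ q → Mod3 (+ 1 + q * + 3)
  mod2 : ∀ q → Mod3 (+ 2 + q * + 3)

mod3 : ∀ m → Mod3 m
mod3 m = subst Mod3 (sym (a≡a%ℕn+[a/ℕn]*n m 3)) (go (m %ℕ 3) (n%ℕd<d m 3))
  where
  go : ∀ r → r ℕ.< 3 → Mod3 (+ r + (m /ℕ 3) * + 3)
  go 0 _ = mod0 (m /ℕ 3)
  go 1 _ = mod1 (m /ℕ 3)
  go 2 _ = mod2 (m /ℕ 3)
  go (suc (suc (suc _))) (s≤s (s≤s (s≤s ())))

private
  0<3 : 0 ℕ.< 3
  0<3 = s≤s z≤n
  1<3 : 1 ℕ.< 3
  1<3 = s≤s (s≤s z≤n)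
  2<3 : 2 ℕ.< 3
  2<3 = s≤s (s≤s (s≤s z≤n))

cyc-0 : ∀ a b c q → cyc a b c (+ 0 + q * + 3) ≡ a
cyc-0 a b c q = cyc-at a b c 0 q 0<3

cyc-1 : ∀ a b c q → cyc a b c (+ 1 + q * + 3) ≡ b
cyc-1 a b c q = cyc-at a b c 1 q 1<3

cyc-2 : ∀ a b c q → cyc a b c (+ 2 + q * + 3) ≡ c
cyc-2 a b c q = cyc-at a b c 2 q 2<3

cyc-suc : ∀ a b c m → cyc a b c (m + 1ℤ) ≡ cyc b c a m
cyc-suc a b c m with mod3 m
... | mod0 q = trans (cong (cyc a b c) (e q)) (trans (cyc-1 a b c q) (sym (cyc-0 b c a q)))
  where
  e : ∀ q → + 0 + q * + 3 + 1ℤ ≡ + 1 + q * + 3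
  e = solve-∀
... | mod1 q = trans (cong (cyc a b c) (e q)) (trans (cyc-2 a b c q) (sym (cyc-1 b c a q)))
  where
  e : ∀ q → + 1 + q * + 3 + 1ℤ ≡ + 2 + q * + 3
  e = solve-∀
... | mod2 q = trans (cong (cyc a b c) (e q)) (trans (cyc-0 a b c (q + 1ℤ)) (sym (cyc-2 b c a q)))
  where
  e : ∀ q → + 2 + q * + 3 + 1ℤ ≡ + 0 + (q + 1ℤ) * + 3
  e = solve-∀

cyc-neg : ∀ a b c m → cyc a b c (- m) ≡ cyc a c b m
cyc-neg a b c m with mod3 m
... | mod0 q = trans (cong (cyc a b c) (e q)) (trans (cyc-0 a b c (- q)) (sym (cyc-0 a c b q)))
  where
  e : ∀ q → - (+ 0 + q * + 3) ≡ + 0 + (- q) * + 3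
  e = solve-∀
... | mod1 q = trans (cong (cyc a b c) (e q)) (trans (cyc-2 a b c (-1ℤ - q)) (sym (cyc-1 a c b q)))
  where
  e : ∀ q → - (+ 1 + q * + 3) ≡ + 2 + (-1ℤ - q) * + 3
  e = solve-∀
... | mod2 q = trans (cong (cyc a b c) (e q)) (trans (cyc-1 a b c (-1ℤ - q)) (sym (cyc-2 a c b q)))
  where
  e : ∀ q → - (+ 2 + q * + 3) ≡ + 1 + (-1ℤ - q) * + 3
  e = solve-∀

cyc-periodic : ∀ a b c m p → cyc a b c (m + p * + 3) ≡ cyc a b c m
cyc-periodic a b c m p with mod3 m
... | mod0 q = trans (cong (cyc a b c) (e q p)) (trans (cyc-0 a b c (q + p)) (sym (cyc-0 a b c q)))
  where
  e : ∀ q p → + 0 + q * + 3 + p * + 3 ≡ + 0 + (q + p) * + 3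
  e = solve-∀
... | mod1 q = trans (cong (cyc a b c) (e q p)) (trans (cyc-1 a b c (q + p)) (sym (cyc-1 a b c q)))
  where
  e : ∀ q p → + 1 + q * + 3 + p * + 3 ≡ + 1 + (q + p) * + 3
  e = solve-∀
... | mod2 q = trans (cong (cyc a b c) (e q p)) (trans (cyc-2 a b c (q + p)) (sym (cyc-2 a b c q)))
  where
  e : ∀ q p → + 2 + q * + 3 + p * + 3 ≡ + 2 + (q + p) * + 3
  e = solve-∀

cyc-map₂ : ∀ (h : ℤ → ℤ → ℤ) a b c a′ b′ c′ m → h (cyc a b c m) (cyc a′ b′ c′ m) ≡ cyc (h a a′) (h b b′) (h c c′) m
cyc-map₂ h a b c a′ b′ c′ m with m %ℕ 3
... | 0           = refl
... | 1           = refl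
... | suc (suc _) = refl

-- Rank differences modulo 3

weighted : (ℤ → ℤ) → ℤ → ℤ
weighted w x = ∑ (λ m → w m * N₌ m x) (fs-* w (N₌-fs x))

weighted-cong : ∀ {w w′} x → (∀ m → w m ≡ w′ m) → weighted w x ≡ weighted w′ x
weighted-cong {w} {w′} x e = ∑-cong (fs-* w (N₌-fs x)) (fs-* w′ (N₌-fs x)) (λ m → cong (_* N₌ m x) (e m))

weighted-reflect : ∀ w x → weighted w x ≡ weighted (w ∘ -_) x
weighted-reflect w x = trans (∑-reflect 0ℤ (λ m → w m * N₌ m x) (fs-* w (N₌-fs x)) (fs-reflect 0ℤ (fs-* w (N₌-fs x))))
  (∑-cong (fs-reflect 0ℤ (fs-* w (N₌-fs x))) (fs-* (w ∘ -_) (N₌-fs x))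
    (λ m → cong₂ (λ a b → w a * b) (+-identityˡ (- m)) (trans (cong (λ z → N₌ z x) (+-identityˡ (- m))) (N₌-sym m x))))

weighted-scale : ∀ c w x → weighted (λ m → c * w m) x ≡ c * weighted w x
weighted-scale c w x = trans
  (∑-cong (fs-* (λ m → c * w m) (N₌-fs x)) (fs-* (λ _ → c) (fs-* w (N₌-fs x))) (λ m → *-assoc c (w m) (N₌ m x)))
  (∑-* c (fs-* w (N₌-fs x)) (fs-* (λ _ → c) (fs-* w (N₌-fs x))))

-- The coefficients of Σ (N(0,3;n) - N(1,3;n)) qⁿ, see N-C.
C : ℤ → ℤ
C = weighted (cyc 1ℤ -1ℤ 0ℤ)

C-supp : ∀ x → C x ≡ 0ℤ ⊎ 0ℤ ≤ x
C-supp (+ n)    = inj₂ (+-≥0 n)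
C-supp -[1+ n ] = inj₁ (∑-zero (fs-* (cyc 1ℤ -1ℤ 0ℤ) (N₌-fs -[1+ n ]))
  (λ m → trans (cong (cyc 1ℤ -1ℤ 0ℤ m *_) (N₌-neg m n)) (*-zeroʳ (cyc 1ℤ -1ℤ 0ℤ m))))

-- Chosen for two properties: every weight `κ (m + 2k)` reduces to a multiple of `C`, and
-- `κ t - κ (t + 1)` is the weight `ω` that is invariant under `t ↦ 1 - t`.
κ : ℤ → ℤ
κ = cyc 1ℤ 0ℤ -1ℤ

-- Ranks 1 and 2 modulo 3 are equally frequent by conjugation, so a weight with values `a`, `b`, `c`
-- of sum 0 contributes `a` times `C`. Here `a = κ (2k)`, which is 1, -1, 0 according to `k` modulo
-- 3.
weighted-κ : ∀ k x → weighted (λ m → κ (m + + 2 * k)) x ≡ cyc 1ℤ -1ℤ 0ℤ k * C x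
weighted-κ k x with mod3 k
... | mod0 q = begin
  weighted (λ m → κ (m + + 2 * k′)) x
    ≡⟨ weighted-cong x (λ m → trans (cong κ (e m q)) (trans (cyc-periodic 1ℤ 0ℤ -1ℤ m (+ 2 * q)) (sym (cyc-neg 1ℤ -1ℤ 0ℤ m)))) ⟩
  weighted (cyc 1ℤ -1ℤ 0ℤ ∘ -_) x
    ≡⟨ weighted-reflect (cyc 1ℤ -1ℤ 0ℤ) x ⟨
  C x
    ≡⟨ *-identityˡ (C x) ⟨
  1ℤ * C x
    ≡⟨ cong (_* C x) (cyc-0 1ℤ -1ℤ 0ℤ q) ⟨
  cyc 1ℤ -1ℤ 0ℤ k′ * C x ∎
  where
  open ≡-Reasoning
  k′ = + 0 + q * + 3
  e : ∀ m q → m + + 2 * (+ 0 + q * + 3) ≡ m + + 2 * q * + 3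
  e = solve-∀
... | mod1 q = begin
  weighted (λ m → κ (m + + 2 * k′)) x
    ≡⟨ weighted-cong x w ⟩
  weighted (λ m → -1ℤ * cyc 1ℤ -1ℤ 0ℤ m) x
    ≡⟨ weighted-scale -1ℤ (cyc 1ℤ -1ℤ 0ℤ) x ⟩
  -1ℤ * C x
    ≡⟨ cong (_* C x) (cyc-1 1ℤ -1ℤ 0ℤ q) ⟨
  cyc 1ℤ -1ℤ 0ℤ k′ * C x ∎
  where
  open ≡-Reasoning
  k′ = + 1 + q * + 3
  e : ∀ m q → m + + 2 * (+ 1 + q * + 3) ≡ m + 1ℤ + 1ℤ + + 2 * q * + 3
  e = solve-∀
  w : ∀ m → κ (m + + 2 * k′) ≡ -1ℤ * cyc 1ℤ -1ℤ 0ℤ m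
  w m = trans (cong κ (e m q)) (trans (cyc-periodic 1ℤ 0ℤ -1ℤ (m + 1ℤ + 1ℤ) (+ 2 * q))
    (trans (cyc-suc 1ℤ 0ℤ -1ℤ (m + 1ℤ)) (trans (cyc-suc 0ℤ -1ℤ 1ℤ m) (sym (cyc-map₂ (λ a _ → -1ℤ * a) 1ℤ -1ℤ 0ℤ 0ℤ 0ℤ 0ℤ m)))))
... | mod2 q = begin
  weighted (λ m → κ (m + + 2 * k′)) x
    ≡⟨ weighted-cong x w ⟩
  Z
    ≡⟨ self-neg Z odd ⟩
  0ℤ
    ≡⟨ cong (_* C x) (cyc-2 1ℤ -1ℤ 0ℤ q) ⟨
  cyc 1ℤ -1ℤ 0ℤ k′ * C x ∎
  where
  open ≡-Reasoning
  k′ = + 2 + q * + 3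
  Z = weighted (cyc 0ℤ -1ℤ 1ℤ) x
  e : ∀ m q → m + + 2 * (+ 2 + q * + 3) ≡ m + 1ℤ + (+ 2 * q + 1ℤ) * + 3
  e = solve-∀
  w : ∀ m → κ (m + + 2 * k′) ≡ cyc 0ℤ -1ℤ 1ℤ m
  w m = trans (cong κ (e m q)) (trans (cyc-periodic 1ℤ 0ℤ -1ℤ (m + 1ℤ) (+ 2 * q + 1ℤ)) (cyc-suc 1ℤ 0ℤ -1ℤ m))
  odd : Z ≡ - Z
  odd = begin
    Z ≡⟨ weighted-reflect (cyc 0ℤ -1ℤ 1ℤ) x ⟩
    weighted (cyc 0ℤ -1ℤ 1ℤ ∘ -_) x
      ≡⟨ weighted-cong x (λ m → trans (cyc-neg 0ℤ -1ℤ 1ℤ m) (sym (cyc-map₂ (λ a _ → -1ℤ * a) 0ℤ -1ℤ 1ℤ 0ℤ 0ℤ 0ℤ m))) ⟩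
    weighted (λ m → -1ℤ * cyc 0ℤ -1ℤ 1ℤ m) x ≡⟨ weighted-scale -1ℤ (cyc 0ℤ -1ℤ 1ℤ) x ⟩
    -1ℤ * Z ≡⟨ -1*i≡-i Z ⟩
    - Z ∎

abstract
  θ-term : (ℤ → ℤ) → ℤ → ℤ → ℤ
  θ-term φ x k = sgn k * (cyc 1ℤ -1ℤ 0ℤ k * φ (x - + 3 * (k * (k - 1ℤ))))

  θ-value : ∀ φ x k {s c w} → sgn k ≡ s → cyc 1ℤ -1ℤ 0ℤ k ≡ c → φ (x - + 3 * (k * (k - 1ℤ))) ≡ w → θ-term φ x k ≡ s * (c * w)
  θ-value φ x k refl refl refl = refl

-- `Θ` multiplies the series with coefficients `φ` by `Σ (-1)^k χ(k) q^(3k(k-1)/2)`, where `χ` has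
-- period 3 and values 1, -1, 0. Vanishing of `φ` at negative arguments keeps the sum finite.
module Theta (φ : ℤ → ℤ) (supp : ∀ y → φ y ≡ 0ℤ ⊎ 0ℤ ≤ y) where

  θ-fs : ∀ x → FinSupp (θ-term φ x)
  θ-fs x = fs-bounded (x + + 4) λ k → Sum.map (vanish k) (theta-bound x k) (supp (x - + 3 * (k * (k - 1ℤ))))
    where
    z : ∀ s c → s * (c * 0ℤ) ≡ 0ℤ
    z = solve-∀
    vanish : ∀ k → φ (x - + 3 * (k * (k - 1ℤ))) ≡ 0ℤ → θ-term φ x k ≡ 0ℤ
    vanish k e = trans (θ-value φ x k refl refl e) (z (sgn k) (cyc 1ℤ -1ℤ 0ℤ k))

  Θ : ℤ → ℤ
  Θ x = ∑ (θ-term φ x) (θ-fs x)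

open Theta

N₌-supp : ∀ j x → N₌ j x ≡ 0ℤ ⊎ (0ℤ ≤ x × + ∣ j ∣ ≤ x + x)
N₌-supp j -[1+ n ] = inj₁ (N₌-neg j n)
N₌-supp j x@(+ n) with + ∣ j ∣ ℤₚ.≤? x + x
... | yes l = inj₂ (+-≥0 n , l)
... | no nl = inj₁ (∑-zero (row (rank-box x) j) z)
  where
  e : ∀ k j → (k + j) - k ≡ j
  e = solve-∀
  z : ∀ k → pe (k + j) k x ≡ 0ℤ
  z k with pe-supp (k + j) k x
  ... | inj₁ p = p
  ... | inj₂ (a , b) = ⊥-elim (nl (subst (λ i → + ∣ i ∣ ≤ x + x) (e k j) (diff-≤ (k + j) k a b)))

∣∣-triangle : ∀ a b {z w} → + ∣ a ∣ ≤ z → + ∣ b ∣ ≤ w → + ∣ a + b ∣ ≤ z + w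
∣∣-triangle a b {+ z} {+ w} (+≤+ p) (+≤+ q) = +≤+ (ℕₚ.≤-trans (∣i+j∣≤∣i∣+∣j∣ a b) (ℕₚ.+-mono-≤ p q))

EN-term : ℤ → ℤ → ℤ → ℤ
EN-term x k t = sgn k * (κ t * N₌ (t - + 2 * k) (x - + 3 * (k * (k - 1ℤ))))

EN-box : ∀ x → Box (EN-term x)
EN-box x = box-bounded (x + x + (x + + 4 + (x + + 4))) w
  where
  back : ∀ t k → t - + 2 * k + (k + k) ≡ t
  back = solve-∀
  e₁ : ∀ x k → x - (x - + 3 * (k * (k - 1ℤ))) ≡ + 3 * ((k - 1ℤ) * (k - 1ℤ + 1ℤ))
  e₁ = solve-∀
  e₂ : ∀ x → x + x + (x + + 4 + (x + + 4)) - (x + + 4) ≡ x + x + x + + 4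
  e₂ = solve-∀
  w : ∀ k t → EN-term x k t ≡ 0ℤ ⊎ (+ ∣ k ∣ ≤ x + x + (x + + 4 + (x + + 4)) × + ∣ t ∣ ≤ x + x + (x + + 4 + (x + + 4)))
  w k t with N₌-supp (t - + 2 * k) (x - + 3 * (k * (k - 1ℤ)))
  ... | inj₁ z = inj₁ (trans (cong (λ z → sgn k * (κ t * z)) z) (trans (cong (sgn k *_) (*-zeroʳ (κ t))) (*-zeroʳ (sgn k))))
  ... | inj₂ (h , l) = inj₂
      ( ≤-trans kb (≤-from (e₂ x) (+-nonneg (+-nonneg (+-nonneg x≥0 x≥0) x≥0) (+-≥0 4)))
      , subst (λ z → + ∣ z ∣ ≤ x + x + (x + + 4 + (x + + 4))) (back t k)
          (∣∣-triangle (t - + 2 * k) (k + k) (≤-trans l (+-mono-≤ y≤x y≤x)) (∣∣-triangle k k kb kb)))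
    where
    y = x - + 3 * (k * (k - 1ℤ))
    kb = theta-bound x k h
    y≤x : y ≤ x
    y≤x = ≤-from (e₁ x k) (*-nonneg (+-≥0 3) (pronic-nonneg (k - 1ℤ)))
    x≥0 = ≤-trans h y≤x

ω : ℤ → ℤ
ω = cyc 1ℤ 1ℤ (- + 2)

F-term-boundsₜ : ∀ x t r → F-term x t r ≡ 0ℤ ⊎ (+ ∣ t ∣ ≤ x + (x + x) × + ∣ r ∣ ≤ x)
F-term-boundsₜ x t r = Sum.map₂ bounds (F-term-bounds x t r)
  where
  back : ∀ t r → t + + 2 * r + (- r + - r) ≡ t
  back = solve-∀
  bounds : + ∣ r ∣ ≤ x × + ∣ t + + 2 * r ∣ ≤ x → + ∣ t ∣ ≤ x + (x + x) × + ∣ r ∣ ≤ x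
  bounds (a , b) = subst (λ z → + ∣ z ∣ ≤ x + (x + x)) (back t r) (∣∣-triangle (t + + 2 * r) (- r + - r) b (∣∣-triangle (- r) (- r) a′ a′)) , a
    where
    a′ : + ∣ - r ∣ ≤ x
    a′ = subst (λ n → + n ≤ x) (sym (∣-i∣≡∣i∣ r)) a

F-supp : ∀ x t → F t x ≡ 0ℤ ⊎ + ∣ t ∣ ≤ x + (x + x)
F-supp x t = go (+ ∣ t ∣ ℤₚ.≤? x + (x + x))
  where
  go : Dec (+ ∣ t ∣ ≤ x + (x + x)) → F t x ≡ 0ℤ ⊎ + ∣ t ∣ ≤ x + (x + x)
  go (yes l) = inj₂ l
  go (no nl) = inj₁ (∑-zero (F-fs t x) (λ r → Sum.[ (λ z → z) , (λ (a , _) → ⊥-elim (nl a)) ]′ (F-term-boundsₜ x t r)))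

F-fsₜ : ∀ x → FinSupp (λ t → F t x)
F-fsₜ x = fs-bounded (x + (x + x)) (F-supp x)

-- For large `t` the values of `H` become those of `P`, so the summands of `E` need not vanish. That
-- their sum does is read off from `E-F`.
E-fsₜ : ∀ x → FinSupp (λ t → E t x)
E-fsₜ x = fs-cong (λ t → sym (E-F t x)) (fs-+ (F-fsₜ x) (fs-reflect 1ℤ (F-fsₜ x)))

ωF-fs : ∀ x → FinSupp (λ t → ω t * F t x)
ωF-fs x = fs-* ω (F-fsₜ x)

-- By `weighted-κ` the left side is a sum of `(-1)^k κ(t) N₌ (t - 2k)` over `k` and `t`. As `N₌` is
-- a difference of consecutive `H`, the sum over `k` is `κ(t) (E t - E (t-1))`, and summation by
-- parts moves the difference onto `κ`, giving `ω`. The 2 comes from `E t = F t + F (1 - t)` and the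
-- symmetry of `ω`.
Θ-C : ∀ x → Θ C C-supp x ≡ + 2 * ∑ (λ t → ω t * F t x) (ωF-fs x)
Θ-C x = begin
  Θ C C-supp x
    ≡⟨ ∑-cong (θ-fs C C-supp x) rs rowSum ⟩
  ∑ (λ k → ∑ (EN-term x k) (row B k)) rs
    ≡⟨ ∑-swap B (row B) (column B) rs cs ⟩
  ∑ (λ t → ∑ (λ k → EN-term x k t) (column B t)) cs
    ≡⟨ ∑-cong cs (fs-+ κE κE′) colSum ⟩
  ∑ (λ t → κ t * E t x + -1ℤ * κ t * E (t - 1ℤ) x) (fs-+ κE κE′)
    ≡⟨ ∑-+ κE κE′ (fs-+ κE κE′) ⟩
  ∑ (λ t → κ t * E t x) κE + ∑ (λ t → -1ℤ * κ t * E (t - 1ℤ) x) κE′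
    ≡⟨ cong (λ z → ∑ (λ t → κ t * E t x) κE + z) (trans (∑-shift 1ℤ (λ t → -1ℤ * κ t * E (t - 1ℤ) x) κE′ (fs-shift 1ℤ κE′)) (∑-cong (fs-shift 1ℤ κE′) κE″ (λ t → cong (λ z → -1ℤ * κ (t + 1ℤ) * E z x) (e₁ t)))) ⟩
  ∑ (λ t → κ t * E t x) κE + ∑ (λ t → -1ℤ * κ (t + 1ℤ) * E t x) κE″
    ≡⟨ ∑-+ κE κE″ (fs-+ κE κE″) ⟨
  ∑ (λ t → κ t * E t x + -1ℤ * κ (t + 1ℤ) * E t x) (fs-+ κE κE″)
    ≡⟨ ∑-cong (fs-+ κE κE″) (fs-+ (ωF-fs x) ωF′) toF ⟩
  ∑ (λ t → ω t * F t x + ω t * F (1ℤ - t) x) (fs-+ (ωF-fs x) ωF′)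
    ≡⟨ ∑-+ (ωF-fs x) ωF′ (fs-+ (ωF-fs x) ωF′) ⟩
  V + ∑ (λ t → ω t * F (1ℤ - t) x) ωF′
    ≡⟨ cong (λ z → V + z) (trans (∑-reflect 1ℤ (λ t → ω t * F (1ℤ - t) x) ωF′ (fs-reflect 1ℤ ωF′))
         (∑-cong (fs-reflect 1ℤ ωF′) (ωF-fs x) (λ t → cong₂ (λ a b → a * F b x) (ω-sym t) (e₂ t)))) ⟩
  V + V
    ≡⟨ e₃ V ⟩
  + 2 * V ∎
  where
  open ≡-Reasoning
  B = EN-box x
  rs = rows B (row B)
  cs = columns B (column B)
  V = ∑ (λ t → ω t * F t x) (ωF-fs x)
  κE : FinSupp (λ t → κ t * E t x)
  κE = fs-* κ (E-fsₜ x)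
  κE′ : FinSupp (λ t → -1ℤ * κ t * E (t - 1ℤ) x)
  κE′ = fs-* (λ t → -1ℤ * κ t) (fs-shift -1ℤ (E-fsₜ x))
  κE″ : FinSupp (λ t → -1ℤ * κ (t + 1ℤ) * E t x)
  κE″ = fs-* (λ t → -1ℤ * κ (t + 1ℤ)) (E-fsₜ x)
  ωF′ : FinSupp (λ t → ω t * F (1ℤ - t) x)
  ωF′ = fs-* ω (fs-reflect 1ℤ (F-fsₜ x))
  e₁ : ∀ t → t + 1ℤ - 1ℤ ≡ t
  e₁ = solve-∀
  e₂ : ∀ t → 1ℤ - (1ℤ - t) ≡ t
  e₂ = solve-∀
  e₃ : ∀ v → v + v ≡ + 2 * v
  e₃ = solve-∀
  rowSum : ∀ k → θ-term C x k ≡ ∑ (EN-term x k) (row B k)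
  rowSum k = sym (begin
    ∑ (EN-term x k) (row B k)
      ≡⟨ ∑-shift (+ 2 * k) (EN-term x k) (row B k) (fs-shift (+ 2 * k) (row B k)) ⟩
    ∑ (λ m → EN-term x k (m + + 2 * k)) (fs-shift (+ 2 * k) (row B k))
      ≡⟨ ∑-cong (fs-shift (+ 2 * k) (row B k)) (fs-* (λ _ → sgn k) q) (λ m → cong (λ z → sgn k * (κ (m + + 2 * k) * N₌ z y)) (e m k)) ⟩
    ∑ (λ m → sgn k * (κ (m + + 2 * k) * N₌ m y)) (fs-* (λ _ → sgn k) q)
      ≡⟨ ∑-* (sgn k) q (fs-* (λ _ → sgn k) q) ⟩
    sgn k * weighted (λ m → κ (m + + 2 * k)) y
      ≡⟨ trans (cong (sgn k *_) (weighted-κ k y)) (sym (θ-value C x k refl refl refl)) ⟩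
    θ-term C x k ∎)
    where
    y = x - + 3 * (k * (k - 1ℤ))
    q : FinSupp (λ m → κ (m + + 2 * k) * N₌ m y)
    q = fs-* (λ m → κ (m + + 2 * k)) (N₌-fs y)
    e : ∀ m k → m + + 2 * k - + 2 * k ≡ m
    e = solve-∀
  colSum : ∀ t → ∑ (λ k → EN-term x k t) (column B t) ≡ κ t * E t x + -1ℤ * κ t * E (t - 1ℤ) x
  colSum t = begin
    ∑ (λ k → EN-term x k t) (column B t)
      ≡⟨ ∑-cong (column B t) (fs-+ p q) pt ⟩
    ∑ (λ k → κ t * (sgn k * H (t - + 2 * k) (y k)) + -1ℤ * κ t * (sgn k * H (t - 1ℤ - + 2 * k) (y k))) (fs-+ p q)
      ≡⟨ ∑-+ p q (fs-+ p q) ⟩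
    ∑ (λ k → κ t * (sgn k * H (t - + 2 * k) (y k))) p + ∑ (λ k → -1ℤ * κ t * (sgn k * H (t - 1ℤ - + 2 * k) (y k))) q
      ≡⟨ cong₂ _+_ (∑-* (κ t) (E-fs t x) p) (∑-* (-1ℤ * κ t) (E-fs (t - 1ℤ) x) q) ⟩
    κ t * E t x + -1ℤ * κ t * E (t - 1ℤ) x ∎
    where
    y : ℤ → ℤ
    y k = x - + 3 * (k * (k - 1ℤ))
    p : FinSupp (λ k → κ t * (sgn k * H (t - + 2 * k) (y k)))
    p = fs-* (λ _ → κ t) (E-fs t x)
    q : FinSupp (λ k → -1ℤ * κ t * (sgn k * H (t - 1ℤ - + 2 * k) (y k)))
    q = fs-* (λ _ → -1ℤ * κ t) (E-fs (t - 1ℤ) x)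
    e : ∀ t k → t - + 2 * k - 1ℤ ≡ t - 1ℤ - + 2 * k
    e = solve-∀
    e′ : ∀ s u a n → s * (u * n) ≡ u * (s * (a + n)) + -1ℤ * u * (s * a)
    e′ = solve-∀
    pt : ∀ k → EN-term x k t ≡ κ t * (sgn k * H (t - + 2 * k) (y k)) + -1ℤ * κ t * (sgn k * H (t - 1ℤ - + 2 * k) (y k))
    pt k = trans (e′ (sgn k) (κ t) (H (t - 1ℤ - + 2 * k) (y k)) (N₌ (t - + 2 * k) (y k)))
      (cong (λ z → κ t * (sgn k * z) + -1ℤ * κ t * (sgn k * H (t - 1ℤ - + 2 * k) (y k)))
        (sym (trans (H-step (t - + 2 * k) (y k)) (cong (λ z → H z (y k) + N₌ (t - + 2 * k) (y k)) (e t k)))))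
  toF : ∀ t → κ t * E t x + -1ℤ * κ (t + 1ℤ) * E t x ≡ ω t * F t x + ω t * F (1ℤ - t) x
  toF t = begin
    κ t * E t x + -1ℤ * κ (t + 1ℤ) * E t x   ≡⟨ e (κ t) (κ (t + 1ℤ)) (E t x) ⟩
    (κ t - κ (t + 1ℤ)) * E t x               ≡⟨ cong₂ _*_ κ-diff (E-F t x) ⟩
    ω t * (F t x + F (1ℤ - t) x)             ≡⟨ *-distribˡ-+ (ω t) (F t x) (F (1ℤ - t) x) ⟩
    ω t * F t x + ω t * F (1ℤ - t) x         ∎
    where
    e : ∀ a b c → a * c + -1ℤ * b * c ≡ (a - b) * c
    e = solve-∀
    κ-diff : κ t - κ (t + 1ℤ) ≡ ω t
    κ-diff = trans (cong (λ z → κ t - z) (cyc-suc 1ℤ 0ℤ -1ℤ t)) (cyc-map₂ _-_ 1ℤ 0ℤ -1ℤ 0ℤ -1ℤ 1ℤ t)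
  ω-sym : ∀ t → ω (1ℤ - t) ≡ ω t
  ω-sym t = trans (cong ω (+-comm 1ℤ (- t))) (trans (cyc-suc 1ℤ 1ℤ (- + 2) (- t)) (cyc-neg 1ℤ (- + 2) 1ℤ t))

-- Inverting the theta series

-- The coefficients of `1/(q⁹;q⁹)_∞`, still with doubled exponents: a nonzero value needs an
-- argument divisible by 18.
P₉ : ℤ → ℤ
P₉ y = [ y %ℕ 9 ≟ 0 ] * P (y /ℕ 9)

P₉-at : ∀ r q → r ℕ.< 9 → P₉ (+ r + q * + 9) ≡ [ r ≟ 0 ] * P q
P₉-at r q l = cong₂ (λ a b → [ a ≟ 0 ] * P b) (%ℕ-unique 9 r q l) (/ℕ-unique 9 r q l)

P₉-supp : ∀ y → P₉ y ≡ 0ℤ ⊎ 0ℤ ≤ y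
P₉-supp y with P-supp (y /ℕ 9)
... | inj₁ z = inj₁ (trans (cong ([ y %ℕ 9 ≟ 0 ] *_) z) (*-zeroʳ [ y %ℕ 9 ≟ 0 ]))
... | inj₂ h = inj₂ (subst (0ℤ ≤_) (sym (a≡a%ℕn+[a/ℕn]*n y 9)) (+-nonneg (+-≥0 (y %ℕ 9)) (*-nonneg h (+-≥0 9))))

δ-at : ∀ x → [ x %ℕ 9 ≟ 0 ] * δ (x /ℕ 9) ≡ δ x
δ-at x with δ-supp x
... | inj₂ refl = refl
... | inj₁ z = trans (go (x %ℕ 9) (x /ℕ 9) (a≡a%ℕn+[a/ℕn]*n x 9)) (sym z)
  where
  go : ∀ r q → x ≡ + r + q * + 9 → [ r ≟ 0 ] * δ q ≡ 0ℤ
  go 0       q e = trans (*-identityˡ (δ q)) (dil q (trans (sym z) (cong δ e)))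
    where
    dil : ∀ q → 0ℤ ≡ δ (+ 0 + q * + 9) → δ q ≡ 0ℤ
    dil (+ 0)     ()
    dil (+ suc _) _ = refl
    dil -[1+ _ ]  _ = refl
  go (suc r) q e = refl

-- In the theta factor `k = 3i` and `k = 3i + 1` each give the pentagonal number series in `q⁹`, the
-- former with `i` reflected, and `k = 3i + 2` has weight 0. So the factor is `2 (q⁹;q⁹)_∞`.
Θ-P₉ : ∀ x → Θ P₉ P₉-supp x ≡ + 2 * δ x
Θ-P₉ x = begin
  Θ P₉ P₉-supp x
    ≡⟨ ∑-two-classes (θ-term P₉ x) (θ-fs P₉ P₉-supp x) (fs-cong (λ i → sym (classes i)) r) class₂ ⟩
  ∑ (λ i → θ-term P₉ x (+ 3 * i + 0ℤ) + θ-term P₉ x (+ 3 * i + 1ℤ)) (fs-cong (λ i → sym (classes i)) r)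
    ≡⟨ ∑-cong (fs-cong (λ i → sym (classes i)) r) r classes ⟩
  ∑ (λ i → c * PT 0ℤ q (0ℤ - i) + c * PT 0ℤ q i) r
    ≡⟨ ∑-+ p₁ p₂ r ⟩
  ∑ (λ i → c * PT 0ℤ q (0ℤ - i)) p₁ + ∑ (λ i → c * PT 0ℤ q i) p₂
    ≡⟨ cong (_+ ∑ (λ i → c * PT 0ℤ q i) p₂) (trans (∑-reflect 0ℤ (λ i → c * PT 0ℤ q (0ℤ - i)) p₁ (fs-reflect 0ℤ p₁)) (∑-cong (fs-reflect 0ℤ p₁) p₂ (λ i → cong (λ z → c * PT 0ℤ q z) (e₀ i)))) ⟩
  ∑ (λ i → c * PT 0ℤ q i) p₂ + ∑ (λ i → c * PT 0ℤ q i) p₂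
    ≡⟨ cong (λ z → z + z) (trans (∑-* c (PT-fs 0ℤ q) p₂) (trans (cong (c *_) (pentagonal q)) (δ-at x))) ⟩
  δ x + δ x
    ≡⟨ dbl (δ x) ⟩
  + 2 * δ x ∎
  where
  open ≡-Reasoning
  q = x /ℕ 9
  c = [ x %ℕ 9 ≟ 0 ]
  p₁ : FinSupp (λ i → c * PT 0ℤ q (0ℤ - i))
  p₁ = fs-* (λ _ → c) (fs-reflect 0ℤ (PT-fs 0ℤ q))
  p₂ : FinSupp (λ i → c * PT 0ℤ q i)
  p₂ = fs-* (λ _ → c) (PT-fs 0ℤ q)
  r = fs-+ p₁ p₂
  e₀ : ∀ i → 0ℤ - (0ℤ - i) ≡ i
  e₀ = solve-∀
  dbl : ∀ a → a + a ≡ + 2 * a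
  dbl = solve-∀
  P₉-shift : ∀ z → P₉ (x - + 9 * z) ≡ c * P (q - z)
  P₉-shift z = trans (cong P₉ (trans (cong (_- + 9 * z) (a≡a%ℕn+[a/ℕn]*n x 9)) (e (+ (x %ℕ 9)) q z))) (P₉-at (x %ℕ 9) (q - z) (n%ℕd<d x 9))
    where
    e : ∀ r q z → r + q * + 9 - + 9 * z ≡ r + (q - z) * + 9
    e = solve-∀
  form : ∀ i s → + 3 * i + s ≡ s + i * + 3
  form = solve-∀
  class₂ : ∀ i → θ-term P₉ x (+ 3 * i + + 2) ≡ 0ℤ
  class₂ i = trans (θ-value P₉ x (+ 3 * i + + 2) refl (trans (cong (cyc 1ℤ -1ℤ 0ℤ) (form i (+ 2))) (cyc-2 1ℤ -1ℤ 0ℤ i)) refl) (*-zeroʳ (sgn (+ 3 * i + + 2)))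
  class₀ : ∀ i → θ-term P₉ x (+ 3 * i + 0ℤ) ≡ c * PT 0ℤ q (0ℤ - i)
  class₀ i = trans (θ-value P₉ x (+ 3 * i + 0ℤ) (sgn-mod2 (+ 3 * i + 0ℤ) (0ℤ - i) (+ 2 * i) (e₂ i))
      (trans (cong (cyc 1ℤ -1ℤ 0ℤ) (form i 0ℤ)) (cyc-0 1ℤ -1ℤ 0ℤ i)) (trans (cong P₉ (e₁ x i)) (P₉-shift z))) (e₃ (sgn (0ℤ - i)) c (P (q - z)))
    where
    z = (0ℤ - i) * (+ 3 * (0ℤ - i) + 1ℤ) + + 2 * (0ℤ - i) * 0ℤ
    e₁ : ∀ x i → x - + 3 * ((+ 3 * i + 0ℤ) * (+ 3 * i + 0ℤ - 1ℤ)) ≡ x - + 9 * ((0ℤ - i) * (+ 3 * (0ℤ - i) + 1ℤ) + + 2 * (0ℤ - i) * 0ℤ)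
    e₁ = solve-∀
    e₂ : ∀ i → + 3 * i + 0ℤ ≡ 0ℤ - i + (+ 2 * i + + 2 * i)
    e₂ = solve-∀
    e₃ : ∀ s c p → s * (1ℤ * (c * p)) ≡ c * (s * p)
    e₃ = solve-∀
  class₁ : ∀ i → θ-term P₉ x (+ 3 * i + 1ℤ) ≡ c * PT 0ℤ q i
  class₁ i = trans (θ-value P₉ x (+ 3 * i + 1ℤ) (sgn-odd (+ 3 * i + 1ℤ) i i (e₂ i))
      (trans (cong (cyc 1ℤ -1ℤ 0ℤ) (form i 1ℤ)) (cyc-1 1ℤ -1ℤ 0ℤ i)) (trans (cong P₉ (e₁ x i)) (P₉-shift z))) (e₃ (sgn i) c (P (q - z)))
    where
    z = i * (+ 3 * i + 1ℤ) + + 2 * i * 0ℤ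
    e₁ : ∀ x i → x - + 3 * ((+ 3 * i + 1ℤ) * (+ 3 * i + 1ℤ - 1ℤ)) ≡ x - + 9 * (i * (+ 3 * i + 1ℤ) + + 2 * i * 0ℤ)
    e₁ = solve-∀
    e₂ : ∀ i → + 3 * i + 1ℤ ≡ i + 1ℤ + (i + i)
    e₂ = solve-∀
    e₃ : ∀ s c p → - s * (-1ℤ * (c * p)) ≡ c * (s * p)
    e₃ = solve-∀
  classes : ∀ i → θ-term P₉ x (+ 3 * i + 0ℤ) + θ-term P₉ x (+ 3 * i + 1ℤ) ≡ c * PT 0ℤ q (0ℤ - i) + c * PT 0ℤ q i
  classes i = cong₂ _+_ (class₀ i) (class₁ i)

∑-at-0-1 : ∀ {h} (p : FinSupp h) → (∀ k → k ≢ 0ℤ → k ≢ 1ℤ → h k ≡ 0ℤ) → ∑ h p ≡ h 0ℤ + h 1ℤ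
∑-at-0-1 {h} p off = trans (∑-cong p (fs-+ s₀ s₁) pt) (trans (∑-+ s₀ s₁ (fs-+ s₀ s₁))
    (cong₂ _+_ (trans (∑-single s₀ 0ℤ off₀) (*-identityˡ (h 0ℤ))) (trans (∑-single s₁ 1ℤ off₁) (*-identityˡ (h 1ℤ)))))
  where
  s₀ : FinSupp (λ k → δ k * h k)
  s₀ = fs-* δ p
  s₁ : FinSupp (λ k → δ (k - 1ℤ) * h k)
  s₁ = fs-* (λ k → δ (k - 1ℤ)) p
  off₀ : ∀ k → k ≢ 0ℤ → δ k * h k ≡ 0ℤ
  off₀ k ne = cong (_* h k) (δ-≢ ne)
  off₁ : ∀ k → k ≢ 1ℤ → δ (k - 1ℤ) * h k ≡ 0ℤ
  off₁ k ne = cong (_* h k) (δ-≢ (λ z → ne (i-j≡0⇒i≡j k 1ℤ z)))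
  far : ∀ k → k ≢ 0ℤ → k ≢ 1ℤ → h k ≡ δ k * h k + δ (k - 1ℤ) * h k
  far k n₀ n₁ = trans (off k n₀ n₁) (sym (cong₂ _+_ (off₀ k n₀) (off₁ k n₁)))
  pt : ∀ k → h k ≡ δ k * h k + δ (k - 1ℤ) * h k
  pt (+ 0)             = f (h 0ℤ)
    where
    f : ∀ a → a ≡ 1ℤ * a + 0ℤ * a
    f = solve-∀
  pt (+ 1)             = f (h 1ℤ)
    where
    f : ∀ a → a ≡ 0ℤ * a + 1ℤ * a
    f = solve-∀
  pt k@(+ suc (suc _)) = far k (λ ()) (λ ())
  pt k@(-[1+ _ ])      = far k (λ ()) (λ ())

double-injective : ∀ a b → a + a + -1ℤ * (b + b) ≡ 0ℤ → a ≡ b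
double-injective a b e = i-j≡0⇒i≡j a b (self-neg (a - b) (trans (f a b) (trans (cong (_+ - (a - b)) e) (+-identityˡ (- (a - b))))))
  where
  f : ∀ a b → a - b ≡ a + a + -1ℤ * (b + b) + - (a - b)
  f = solve-∀

module _ (Y Z : ℤ → ℤ) (suppY : ∀ x → Y x ≡ 0ℤ ⊎ 0ℤ ≤ x) (suppZ : ∀ x → Z x ≡ 0ℤ ⊎ 0ℤ ≤ x) where

  private
    θ-0 : ∀ Y x → θ-term Y x 0ℤ ≡ Y x
    θ-0 Y x = trans (θ-value Y x 0ℤ refl refl (cong Y (+-identityʳ x))) (f (Y x))
      where
      f : ∀ a → 1ℤ * (1ℤ * a) ≡ a
      f = solve-∀

    θ-1 : ∀ Y x → θ-term Y x 1ℤ ≡ Y x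
    θ-1 Y x = trans (θ-value Y x 1ℤ refl refl (cong Y (+-identityʳ x))) (f (Y x))
      where
      f : ∀ a → -1ℤ * (-1ℤ * a) ≡ a
      f = solve-∀

    leading : ∀ x → Θ Y suppY x ≡ Θ Z suppZ x → (∀ k → k ≢ 0ℤ → k ≢ 1ℤ → θ-term Y x k ≡ θ-term Z x k) → Y x ≡ Z x
    leading x e same = double-injective (Y x) (Z x) (begin
      Y x + Y x + -1ℤ * (Z x + Z x)
        ≡⟨ f (Y x) (Z x) ⟩
      (Y x + -1ℤ * Z x) + (Y x + -1ℤ * Z x)
        ≡⟨ cong₂ _+_ (cong₂ g (θ-0 Y x) (θ-0 Z x)) (cong₂ g (θ-1 Y x) (θ-1 Z x)) ⟨
      (θ-term Y x 0ℤ + -1ℤ * θ-term Z x 0ℤ) + (θ-term Y x 1ℤ + -1ℤ * θ-term Z x 1ℤ)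
        ≡⟨ ∑-at-0-1 hf (λ k n₀ n₁ → trans (cong (_+ -1ℤ * θ-term Z x k) (same k n₀ n₁)) (i (θ-term Z x k))) ⟨
      ∑ (λ k → θ-term Y x k + -1ℤ * θ-term Z x k) hf
        ≡⟨ ∑-+ (θ-fs Y suppY x) mZ hf ⟩
      Θ Y suppY x + ∑ (λ k → -1ℤ * θ-term Z x k) mZ
        ≡⟨ cong₂ _+_ e (∑-* -1ℤ (θ-fs Z suppZ x) mZ) ⟩
      Θ Z suppZ x + -1ℤ * Θ Z suppZ x
        ≡⟨ i (Θ Z suppZ x) ⟩
      0ℤ ∎)
      where
      open ≡-Reasoning
      g : ℤ → ℤ → ℤ
      g a b = a + -1ℤ * b
      mZ : FinSupp (λ k → -1ℤ * θ-term Z x k)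
      mZ = fs-* (λ _ → -1ℤ) (θ-fs Z suppZ x)
      hf : FinSupp (λ k → θ-term Y x k + -1ℤ * θ-term Z x k)
      hf = fs-+ (θ-fs Y suppY x) mZ
      f : ∀ a b → a + a + -1ℤ * (b + b) ≡ (a + -1ℤ * b) + (a + -1ℤ * b)
      f = solve-∀
      i : ∀ a → a + -1ℤ * a ≡ 0ℤ
      i = solve-∀

  Θ-injective : (∀ x → Θ Y suppY x ≡ Θ Z suppZ x) → ∀ x → Y x ≡ Z x
  Θ-injective eq x = step ∣ x + 1ℤ ∣ x (i≤∣i∣ (x + 1ℤ))
    where
    i≤∣i∣ : ∀ i → i ≤ + ∣ i ∣
    i≤∣i∣ (+ n)    = ≤-refl
    i≤∣i∣ -[1+ n ] = -≤+
    negative : ∀ n → Y -[1+ n ] ≡ 0ℤ ⊎ 0ℤ ≤ -[1+ n ] → Z -[1+ n ] ≡ 0ℤ ⊎ 0ℤ ≤ -[1+ n ] → Y -[1+ n ] ≡ Z -[1+ n ]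
    negative n (inj₁ a) (inj₁ b) = trans a (sym b)
    e₁ : ∀ x b n → b - (x - + 3 * ((+ 2 + n) * (+ 2 + n - 1ℤ)) + 1ℤ) ≡ (1ℤ + b - (x + 1ℤ)) + (+ 3 * (n * n) + + 9 * n + + 5)
    e₁ = solve-∀
    e₂ : ∀ x b n → b - (x - + 3 * ((- (1ℤ + n)) * (- (1ℤ + n) - 1ℤ)) + 1ℤ) ≡ (1ℤ + b - (x + 1ℤ)) + (+ 3 * (n * n) + + 9 * n + + 5)
    e₂ = solve-∀
    room : ∀ x b n → x + 1ℤ ≤ + suc b → 0ℤ ≤ (1ℤ + + b - (x + 1ℤ)) + (+ 3 * (+ n * + n) + + 9 * + n + + 5)
    room x b n l = +-nonneg (i≤j⇒0≤j-i l) (+-nonneg (+-nonneg (*-nonneg (+-≥0 3) (*-nonneg (+-≥0 n) (+-≥0 n))) (*-nonneg (+-≥0 9) (+-≥0 n))) (+-≥0 5))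
    smaller : ∀ x b → x + 1ℤ ≤ + suc b → ∀ k → k ≢ 0ℤ → k ≢ 1ℤ → x - + 3 * (k * (k - 1ℤ)) + 1ℤ ≤ + b
    smaller x b l (+ 0)           n₀ n₁ = ⊥-elim (n₀ refl)
    smaller x b l (+ 1)           n₀ n₁ = ⊥-elim (n₁ refl)
    smaller x b l (+ suc (suc n)) n₀ n₁ = ≤-from (e₁ x (+ b) (+ n)) (room x b n l)
    smaller x b l -[1+ n ]        n₀ n₁ = ≤-from (e₂ x (+ b) (+ n)) (room x b n l)
    -- The summands k = 0 and k = 1 of Θ both equal the leading value; every other one is known by induction.
    step : ∀ b x → x + 1ℤ ≤ + b → Y x ≡ Z x
    step 0       (+ n)      (+≤+ l) = ⊥-elim (ℕₚ.1+n≰n (ℕₚ.≤-trans (ℕₚ.m≤n+m 1 n) l))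
    step 0       (-[1+ n ]) _       = negative n (suppY -[1+ n ]) (suppZ -[1+ n ])
    step (suc b) x          l       = leading x (eq x) (λ k n₀ n₁ →
      trans (θ-value Y x k refl refl (step b (x - + 3 * (k * (k - 1ℤ))) (smaller x b l k n₀ n₁))) (sym (θ-value Z x k refl refl refl)))

-- The double sum as an operator, and the formula for `C`

module Kernel (φ : ℤ → ℤ) (supp : ∀ y → φ y ≡ 0ℤ ⊎ 0ℤ ≤ y) where

  abstract
    K-term : ℤ → ℤ → ℤ → ℤ
    K-term x r v = ω (r + v) * (pos r * (pos v * (sgn r * G φ x r v)))

    K-term-def : ∀ x r v → K-term x r v ≡ ω (r + v) * (pos r * (pos v * (sgn r * G φ x r v)))
    K-term-def x r v = refl

    K-bounds : ∀ x r v → K-term x r v ≡ 0ℤ ⊎ (+ ∣ r ∣ ≤ x × + ∣ v ∣ ≤ x)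
    K-bounds x r v = ⊎-*ˡ (ω (r + v)) (pos r * (pos v * (sgn r * G φ x r v))) (G-bounds φ supp x r v)

  K-box : ∀ x → Box (K-term x)
  K-box x = box-bounded x (K-bounds x)

  K-fs : ∀ x → FinSupp (λ r → ∑ (K-term x r) (row (K-box x) r))
  K-fs x = rows (K-box x) (row (K-box x))

  K : ℤ → ℤ
  K x = ∑ (λ r → ∑ (K-term x r) (row (K-box x) r)) (K-fs x)

  K-supp : ∀ x → K x ≡ 0ℤ ⊎ 0ℤ ≤ x
  K-supp (+ n)    = inj₂ (+-≥0 n)
  K-supp x@(-[1+ n ]) = inj₁ (∑-zero (K-fs x) (λ r → ∑-zero (row (K-box x) r) (z r)))
    where
    z : ∀ r v → K-term x r v ≡ 0ℤ
    z r v with K-bounds x r v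
    ... | inj₁ p = p
    ... | inj₂ (() , _)

open Kernel

K-cong : ∀ φ ψ sφ sψ c → (∀ y → φ y ≡ c * ψ y) → ∀ x → K φ sφ x ≡ c * K ψ sψ x
K-cong φ ψ sφ sψ c eq x = trans (∑-cong (K-fs φ sφ x) cK inner) (∑-* c (K-fs ψ sψ x) cK)
  where
  cK = fs-* (λ _ → c) (K-fs ψ sψ x)
  e : ∀ w p q s c a b → w * (p * (q * (s * (c * a + c * b)))) ≡ c * (w * (p * (q * (s * (a + b)))))
  e = solve-∀
  scale : ∀ r v → K-term φ sφ x r v ≡ c * K-term ψ sψ x r v
  scale r v = trans (K-term-def φ sφ x r v) (trans (cong₂ (λ a b → ω (r + v) * (pos r * (pos v * (sgn r * (a + b))))) (eq y₁) (eq y₂))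
      (trans (e (ω (r + v)) (pos r) (pos v) (sgn r) c (ψ y₁) (ψ y₂)) (cong (c *_) (sym (K-term-def ψ sψ x r v)))))
    where
    y₁ = x - (+ 3 * (r * (r + 1ℤ)) + + 2 * (+ 3 * r + 1ℤ) * v)
    y₂ = x - (+ 3 * (r * (r + 1ℤ)) + + 2 * (+ 3 * r + + 2) * (v + 1ℤ))
  inner : ∀ r → ∑ (K-term φ sφ x r) (row (K-box φ sφ x) r) ≡ c * ∑ (K-term ψ sψ x r) (row (K-box ψ sψ x) r)
  inner r = trans (∑-cong (row (K-box φ sφ x) r) cR (scale r)) (∑-* c (row (K-box ψ sψ x) r) cR)
    where
    cR = fs-* (λ _ → c) (row (K-box ψ sψ x) r)

-- The substitution `t = v - 2r` makes the second index of `G` a free variable, and `v - 2r ≡ r + v`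
-- modulo 3 turns the weight into `ω (r + v)`.
∑-ωF : ∀ x → ∑ (λ t → ω t * F t x) (ωF-fs x) ≡ K δ δ-supp₀ x
∑-ωF x = begin
  ∑ (λ t → ω t * F t x) (ωF-fs x)
    ≡⟨ ∑-cong (ωF-fs x) rs (λ t → sym (∑-* (ω t) (F-fs t x) (row B t))) ⟩
  ∑ (λ t → ∑ (λ r → ω t * F-term x t r) (row B t)) rs
    ≡⟨ ∑-swap B (row B) (column B) rs cs ⟩
  ∑ (λ r → ∑ (λ t → ω t * F-term x t r) (column B r)) cs
    ≡⟨ ∑-cong cs (K-fs δ δ-supp₀ x) colSum ⟩
  K δ δ-supp₀ x ∎
  where
  open ≡-Reasoning
  e₀ : ∀ x → x + (x + x) - x ≡ x + x
  e₀ = solve-∀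
  B : Box (λ t r → ω t * F-term x t r)
  B = box-bounded (x + (x + x)) λ t r → ⊎-*ˡ (ω t) (F-term x t r) (Sum.map₂ (λ (a , b) → a , wider r b) (F-term-boundsₜ x t r))
    where
    wider : ∀ r → + ∣ r ∣ ≤ x → + ∣ r ∣ ≤ x + (x + x)
    wider r l = ≤-trans l (≤-from (e₀ x) (+-nonneg x≥0 x≥0))
      where x≥0 = ≤-trans (+-≥0 ∣ r ∣) l
  rs = rows B (row B)
  cs = columns B (column B)
  e₁ : ∀ v r → v + - (+ 2 * r) + + 2 * r ≡ v
  e₁ = solve-∀
  e₂ : ∀ v r → v + - (+ 2 * r) ≡ r + v + (- r) * + 3
  e₂ = solve-∀
  colSum : ∀ r → ∑ (λ t → ω t * F-term x t r) (column B r) ≡ ∑ (K-term δ δ-supp₀ x r) (row (K-box δ δ-supp₀ x) r)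
  colSum r = trans (∑-shift (- (+ 2 * r)) (λ t → ω t * F-term x t r) (column B r) (fs-shift (- (+ 2 * r)) (column B r)))
    (∑-cong (fs-shift (- (+ 2 * r)) (column B r)) (row (K-box δ δ-supp₀ x) r) pt)
    where
    pt : ∀ v → ω (v + - (+ 2 * r)) * F-term x (v + - (+ 2 * r)) r ≡ K-term δ δ-supp₀ x r v
    pt v = trans (cong (ω (v + - (+ 2 * r)) *_) (F-term-def x (v + - (+ 2 * r)) r)) (trans (cong₂ (λ a b → a * (pos r * (pos b * (sgn r * G δ x r b))))
      (trans (cong ω (e₂ v r)) (cyc-periodic 1ℤ 1ℤ (- + 2) (r + v) (- r))) (e₁ v r)) (sym (K-term-def δ δ-supp₀ x r v)))

module _ (φ : ℤ → ℤ) (supp : ∀ y → φ y ≡ 0ℤ ⊎ 0ℤ ≤ y) (suppΘ : ∀ y → Θ φ supp y ≡ 0ℤ ⊎ 0ℤ ≤ y) where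

  private
    shifted : ℤ → ℤ → ℤ
    shifted x k = x - + 3 * (k * (k - 1ℤ))

    T : ℤ → ℤ → ℤ → ℤ → ℤ
    T x k r v = sgn k * (cyc 1ℤ -1ℤ 0ℤ k * K-term φ supp (shifted x k) r v)

    T-bounds : ∀ x k r v → T x k r v ≡ 0ℤ ⊎ (+ ∣ k ∣ ≤ x + + 4 × + ∣ r ∣ ≤ x + + 4 × + ∣ v ∣ ≤ x + + 4)
    T-bounds x k r v = ⊎-*ˡ (sgn k) (cyc 1ℤ -1ℤ 0ℤ k * K-term φ supp (shifted x k) r v)
        (⊎-*ˡ (cyc 1ℤ -1ℤ 0ℤ k) (K-term φ supp (shifted x k) r v) (Sum.map₂ bounds (K-bounds φ supp (shifted x k) r v)))
      where
      e : ∀ x k → x + + 4 - (x - + 3 * (k * (k - 1ℤ))) ≡ + 4 + + 3 * ((k - 1ℤ) * (k - 1ℤ + 1ℤ))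
      e = solve-∀
      y≤ : shifted x k ≤ x + + 4
      y≤ = ≤-from (e x k) (+-nonneg (+-≥0 4) (*-nonneg (+-≥0 3) (pronic-nonneg (k - 1ℤ))))
      bounds : + ∣ r ∣ ≤ shifted x k × + ∣ v ∣ ≤ shifted x k → + ∣ k ∣ ≤ x + + 4 × + ∣ r ∣ ≤ x + + 4 × + ∣ v ∣ ≤ x + + 4
      bounds (a , b) = theta-bound x k (≤-trans (+-≥0 ∣ r ∣) a) , ≤-trans a y≤ , ≤-trans b y≤

    box-r : ∀ x k → Box (T x k)
    box-r x k = box-bounded (x + + 4) λ r v → Sum.map₂ (λ (_ , a , b) → a , b) (T-bounds x k r v)

    box-k : ∀ x r → Box (λ k v → T x k r v)
    box-k x r = box-bounded (x + + 4) λ k v → Sum.map₂ (λ (a , _ , b) → a , b) (T-bounds x k r v)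

    inner : ℤ → ℤ → ℤ → ℤ
    inner x k r = ∑ (T x k r) (row (box-r x k) r)

    box-kr : ∀ x → Box (inner x)
    box-kr x = box-bounded (x + + 4) λ k r → go k r (+ ∣ k ∣ ℤₚ.≤? x + + 4) (+ ∣ r ∣ ℤₚ.≤? x + + 4)
      where
      go : ∀ k r → Dec (+ ∣ k ∣ ≤ x + + 4) → Dec (+ ∣ r ∣ ≤ x + + 4) → inner x k r ≡ 0ℤ ⊎ (+ ∣ k ∣ ≤ x + + 4 × + ∣ r ∣ ≤ x + + 4)
      go k r (yes a) (yes b) = inj₂ (a , b)
      go k r (no na) _ = inj₁ (∑-zero (row (box-r x k) r) λ v → Sum.[ (λ z → z) , (λ (a , _) → ⊥-elim (na a)) ]′ (T-bounds x k r v))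
      go k r _ (no nb) = inj₁ (∑-zero (row (box-r x k) r) λ v → Sum.[ (λ z → z) , (λ (_ , b , _) → ⊥-elim (nb b)) ]′ (T-bounds x k r v))

  ∑-θ-pair : ∀ c a b {f} (p : FinSupp f) → (∀ k → f k ≡ c * (θ-term φ a k + θ-term φ b k)) → ∑ f p ≡ c * (Θ φ supp a + Θ φ supp b)
  ∑-θ-pair c a b p e = trans (∑-cong p (fs-* (λ _ → c) pq) e)
      (trans (∑-* c pq (fs-* (λ _ → c) pq)) (cong (c *_) (∑-+ (θ-fs φ supp a) (θ-fs φ supp b) pq)))
    where
    pq : FinSupp (λ k → θ-term φ a k + θ-term φ b k)
    pq = fs-+ (θ-fs φ supp a) (θ-fs φ supp b)

  -- Both operators add translates of `φ` with weights independent of `x`, so they commute as soon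
  -- as the triple sum over `k`, `r`, `v` may be reordered; `T-bounds` confines it to a cube.
  Θ-K : ∀ x → Θ (K φ supp) (K-supp φ supp) x ≡ K (Θ φ supp) suppΘ x
  Θ-K x = begin
    Θ (K φ supp) (K-supp φ supp) x
      ≡⟨ ∑-cong (θ-fs (K φ supp) (K-supp φ supp) x) rs expand ⟩
    ∑ (λ k → ∑ (inner x k) (row B k)) rs
      ≡⟨ ∑-swap B (row B) (column B) rs cs ⟩
    ∑ (λ r → ∑ (λ k → inner x k r) (column B r)) cs
      ≡⟨ ∑-cong cs (K-fs (Θ φ supp) suppΘ x) (λ r → trans
           (∑-cong (column B r) (rows (box-k x r) (row (box-k x r))) (λ k → ∑-cong (row (box-r x k) r) (row (box-k x r) k) (λ _ → refl)))
           (trans (∑-swap (box-k x r) (row (box-k x r)) (column (box-k x r)) (rows (box-k x r) (row (box-k x r))) (columns (box-k x r) (column (box-k x r))))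
                  (∑-cong (columns (box-k x r) (column (box-k x r))) (row (K-box (Θ φ supp) suppΘ x) r) (collect r)))) ⟩
    K (Θ φ supp) suppΘ x ∎
    where
    open ≡-Reasoning
    B = box-kr x
    rs = rows B (row B)
    cs = columns B (column B)
    d : ℤ → ℤ
    d = cyc 1ℤ -1ℤ 0ℤ
    expand : ∀ k → θ-term (K φ supp) x k ≡ ∑ (inner x k) (row B k)
    expand k = begin
      θ-term (K φ supp) x k
        ≡⟨ θ-value (K φ supp) x k refl refl refl ⟩
      sgn k * (d k * K φ supp y)
        ≡⟨ *-assoc (sgn k) (d k) (K φ supp y) ⟨
      sgn k * d k * K φ supp y
        ≡⟨ ∑-* (sgn k * d k) (K-fs φ supp y) q ⟨
      ∑ (λ r → sgn k * d k * ∑ (K-term φ supp y r) (row (K-box φ supp y) r)) q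
        ≡⟨ ∑-cong q (row B k) (λ r → trans (sym (∑-* (sgn k * d k) (row (K-box φ supp y) r) (q′ r)))
             (∑-cong (q′ r) (row (box-r x k) r) (λ v → *-assoc (sgn k) (d k) (K-term φ supp y r v)))) ⟩
      ∑ (inner x k) (row B k) ∎
      where
      y = shifted x k
      q : FinSupp (λ r → sgn k * d k * ∑ (K-term φ supp y r) (row (K-box φ supp y) r))
      q = fs-* (λ _ → sgn k * d k) (K-fs φ supp y)
      q′ : ∀ r → FinSupp (λ v → sgn k * d k * K-term φ supp y r v)
      q′ r = fs-* (λ _ → sgn k * d k) (row (K-box φ supp y) r)
    collect : ∀ r v → ∑ (λ k → T x k r v) (column (box-k x r) v) ≡ K-term (Θ φ supp) suppΘ x r v
    collect r v = begin
      ∑ (λ k → T x k r v) (column (box-k x r) v)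
        ≡⟨ ∑-θ-pair (ω (r + v) * (pos r * (pos v * sgn r))) (x - (+ 3 * (r * (r + 1ℤ)) + + 2 * (+ 3 * r + 1ℤ) * v)) (x - (+ 3 * (r * (r + 1ℤ)) + + 2 * (+ 3 * r + + 2) * (v + 1ℤ))) (column (box-k x r) v) pt ⟩
      ω (r + v) * (pos r * (pos v * sgn r)) * (Θ φ supp (x - (+ 3 * (r * (r + 1ℤ)) + + 2 * (+ 3 * r + 1ℤ) * v)) + Θ φ supp (x - (+ 3 * (r * (r + 1ℤ)) + + 2 * (+ 3 * r + + 2) * (v + 1ℤ))))
        ≡⟨ assoc (ω (r + v)) (pos r) (pos v) (sgn r) (Θ φ supp (x - (+ 3 * (r * (r + 1ℤ)) + + 2 * (+ 3 * r + 1ℤ) * v)) + Θ φ supp (x - (+ 3 * (r * (r + 1ℤ)) + + 2 * (+ 3 * r + + 2) * (v + 1ℤ)))) (G (Θ φ supp) x r v) refl ⟩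
      ω (r + v) * (pos r * (pos v * (sgn r * G (Θ φ supp) x r v)))
        ≡⟨ K-term-def (Θ φ supp) suppΘ x r v ⟨
      K-term (Θ φ supp) suppΘ x r v ∎
      where
      assoc′ : ∀ w p q s g → w * (p * (q * s)) * g ≡ w * (p * (q * (s * g)))
      assoc′ = solve-∀
      assoc : ∀ w p q s g g′ → g ≡ g′ → w * (p * (q * s)) * g ≡ w * (p * (q * (s * g′)))
      assoc w p q s g g′ e = trans (assoc′ w p q s g) (cong (λ z → w * (p * (q * (s * z)))) e)
      swap : ∀ x a b → x - a - b ≡ x - b - a
      swap = solve-∀
      distr : ∀ u d w p q s a b → u * (d * (w * (p * (q * (s * (a + b)))))) ≡ w * (p * (q * s)) * (u * (d * a) + u * (d * b))
      distr = solve-∀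
      pt : ∀ k → T x k r v ≡ ω (r + v) * (pos r * (pos v * sgn r)) * (θ-term φ (x - (+ 3 * (r * (r + 1ℤ)) + + 2 * (+ 3 * r + 1ℤ) * v)) k + θ-term φ (x - (+ 3 * (r * (r + 1ℤ)) + + 2 * (+ 3 * r + + 2) * (v + 1ℤ))) k)
      pt k = trans (cong (λ z → sgn k * (d k * z)) (K-term-def φ supp (shifted x k) r v))
        (trans (distr (sgn k) (d k) (ω (r + v)) (pos r) (pos v) (sgn r) (φ (shifted x k - (+ 3 * (r * (r + 1ℤ)) + + 2 * (+ 3 * r + 1ℤ) * v))) (φ (shifted x k - (+ 3 * (r * (r + 1ℤ)) + + 2 * (+ 3 * r + + 2) * (v + 1ℤ)))))
               (cong (ω (r + v) * (pos r * (pos v * sgn r)) *_) (cong₂ _+_ (value (+ 3 * (r * (r + 1ℤ)) + + 2 * (+ 3 * r + 1ℤ) * v)) (value (+ 3 * (r * (r + 1ℤ)) + + 2 * (+ 3 * r + + 2) * (v + 1ℤ))))))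
        where
        value : ∀ m → sgn k * (d k * φ (shifted x k - m)) ≡ θ-term φ (x - m) k
        value m = sym (θ-value φ (x - m) k refl refl (cong φ (swap x m (+ 3 * (k * (k - 1ℤ))))))

-- Both sides have image `2 K δ` under the injective `Θ`: for `C` by `Θ-C` and `∑-ωF`, for `K P₉`
-- because `Θ` passes through `K` and `Θ P₉ = 2 δ`.
C-formula : ∀ x → C x ≡ K P₉ P₉-supp x
C-formula = Θ-injective C (K P₉ P₉-supp) C-supp (K-supp P₉ P₉-supp) λ x → begin
  Θ C C-supp x
    ≡⟨ Θ-C x ⟩
  + 2 * ∑ (λ t → ω t * F t x) (ωF-fs x)
    ≡⟨ cong (+ 2 *_) (∑-ωF x) ⟩
  + 2 * K δ δ-supp₀ x
    ≡⟨ K-cong (Θ P₉ P₉-supp) δ Θ-P₉-supp δ-supp₀ (+ 2) Θ-P₉ x ⟨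
  K (Θ P₉ P₉-supp) Θ-P₉-supp x
    ≡⟨ Θ-K P₉ P₉-supp Θ-P₉-supp x ⟨
  Θ (K P₉ P₉-supp) (K-supp P₉ P₉-supp) x ∎
  where
  open ≡-Reasoning
  Θ-P₉-supp : ∀ y → Θ P₉ P₉-supp y ≡ 0ℤ ⊎ 0ℤ ≤ y
  Θ-P₉-supp y = Sum.map (λ z → trans (Θ-P₉ y) (cong (+ 2 *_) z)) (λ l → l) (δ-supp₀ y)

-- Lists of partitions

listSum : {A : Set} → (A → ℤ) → List A → ℤ
listSum h []       = 0ℤ
listSum h (p ∷ ps) = h p + listSum h ps

listSum-++ : ∀ {A : Set} (h : A → ℤ) ps qs → listSum h (ps ++ qs) ≡ listSum h ps + listSum h qs
listSum-++ h []       qs = sym (+-identityˡ _)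
listSum-++ h (p ∷ ps) qs = trans (cong (λ z → h p + z) (listSum-++ h ps qs)) (sym (+-assoc (h p) _ _))

listSum-map : ∀ {A B : Set} (h : B → ℤ) (c : A → B) ps → listSum h (map c ps) ≡ listSum (λ p → h (c p)) ps
listSum-map h c []       = refl
listSum-map h c (p ∷ ps) = cong (λ z → h (c p) + z) (listSum-map h c ps)

listSum-- : ∀ {A : Set} (g h : A → ℤ) ps → listSum g ps - listSum h ps ≡ listSum (λ p → g p - h p) ps
listSum-- g h []       = refl
listSum-- g h (p ∷ ps) = trans (e (g p) (listSum g ps) (h p) (listSum h ps)) (cong (λ z → g p - h p + z) (listSum-- g h ps))
  where
  e : ∀ a b c d → a + b - (c + d) ≡ a - c + (b - d)
  e = solve-∀

listSum-cong : ∀ {A : Set} {g h : A → ℤ} → (∀ p → g p ≡ h p) → ∀ ps → listSum g ps ≡ listSum h ps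
listSum-cong e []       = refl
listSum-cong e (p ∷ ps) = cong₂ _+_ (e p) (listSum-cong e ps)

choose′ : (f n k : ℕ) → List (List ℕ)
choose′ f n k with k ℕ.≤? suc n
... | yes _ = map (k ∷_) (partsBounded f k (suc n ℕ.∸ k))
... | no  _ = []

private
  -- The first component is the local function of partsBounded, which has no name outside its definition.
  capture : ∀ f m n → Σ (ℕ → List (List ℕ)) (λ h → partsBounded (suc f) m (suc n) ≡ concatMap h (map suc (downFrom m)))
  capture f m n = _ , refl

  capture-choose : ∀ f m n k → proj₁ (capture f m n) k ≡ choose′ f n k
  capture-choose f m n k with k ℕ.≤? suc n
  ... | yes _ = refl
  ... | no  _ = refl

concatMap-cong : ∀ {A B : Set} {g h : A → List B} → (∀ k → g k ≡ h k) → ∀ ks → concatMap g ks ≡ concatMap h ks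
concatMap-cong e []       = refl
concatMap-cong e (k ∷ ks) = cong₂ _++_ (e k) (concatMap-cong e ks)

partsBounded-unfold : ∀ f m n → partsBounded (suc f) m (suc n) ≡ concatMap (choose′ f n) (map suc (downFrom m))
partsBounded-unfold f m n = trans (proj₂ (capture f m n)) (concatMap-cong (capture-choose f m n) (map suc (downFrom m)))

rangeSum : ℕ → (ℤ → ℤ) → ℤ
rangeSum 0       q = 0ℤ
rangeSum (suc m) q = q (+ suc m) + rangeSum m q

pe-fsʳ : ∀ l x → FinSupp (λ k → pe l k x)
pe-fsʳ l x = fs-bounded x (λ k → Sum.map₂ proj₂ (pe-supp l k x))

atMost-supp : ∀ l k x → atMost l k x ≡ 0ℤ ⊎ + ∣ k ∣ ≤ x
atMost-supp l k x = go (+ ∣ k ∣ ℤₚ.≤? x)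
  where
  go : Dec (+ ∣ k ∣ ≤ x) → atMost l k x ≡ 0ℤ ⊎ + ∣ k ∣ ≤ x
  go (yes h) = inj₂ h
  go (no nh) = inj₁ (∑-zero (atMost-fs l k x) z)
    where
    z : ∀ i → pos (l - i) * pe i k x ≡ 0ℤ
    z i with pe-supp i k x
    ... | inj₁ p = trans (cong (pos (l - i) *_) p) (*-zeroʳ (pos (l - i)))
    ... | inj₂ (_ , h) = ⊥-elim (nh h)

atMost-fsʳ : ∀ l x → FinSupp (λ k → atMost l k x)
atMost-fsʳ l x = fs-bounded x (λ k → atMost-supp l k x)

atMost-neg : ∀ l k n → atMost l k -[1+ n ] ≡ 0ℤ
atMost-neg l k n with atMost-supp l k -[1+ n ]
... | inj₁ z = z
... | inj₂ ()

-- Deleting the largest part `suc m` leaves `k` parts, all at most `suc m`; this is the recursion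
-- step of `partsBounded`.
pe-atMost : ∀ m k x → pe (+ suc m) (k + 1ℤ) x ≡ atMost (+ suc m) k (x - + 2 * + suc m)
pe-atMost m (+ k) x = trans (cong (λ z → pe (+ suc m) (+ z) x) (ℕₚ.+-comm k 1))
  (trans (cong (bin m k) (e x (+ m) (+ k))) (sym (atMost-bin m k (x - + 2 * + suc m))))
  where
  e : ∀ x m k → x - + 2 * (m + k + 1ℤ) ≡ x - + 2 * (1ℤ + m) - + 2 * k
  e = solve-∀
pe-atMost m -[1+ 0 ]     x = sym (atMost-negʳ (+ suc m) 0 (x - + 2 * + suc m))
pe-atMost m -[1+ suc k ] x = sym (atMost-negʳ (+ suc m) (suc k) (x - + 2 * + suc m))

partSum : (ℤ → ℤ → ℤ) → ℤ → ℤ → ℤ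
partSum W x l = ∑ (λ k → W l k * pe l k x) (fs-* (W l) (pe-fsʳ l x))

lengthSum : (ℤ → ℤ) → ℤ → ℤ → ℤ
lengthSum g l x = ∑ (λ k → g k * atMost l k x) (fs-* g (atMost-fsʳ l x))

partSum-lengthSum : ∀ W m x → partSum W x (+ suc m) ≡ lengthSum (λ k → W (+ suc m) (k + 1ℤ)) (+ suc m) (x - + 2 * + suc m)
partSum-lengthSum W m x = trans
  (∑-shift 1ℤ (λ k → W (+ suc m) k * pe (+ suc m) k x) (fs-* (W (+ suc m)) (pe-fsʳ (+ suc m) x)) (fs-shift 1ℤ (fs-* (W (+ suc m)) (pe-fsʳ (+ suc m) x))))
  (∑-cong (fs-shift 1ℤ (fs-* (W (+ suc m)) (pe-fsʳ (+ suc m) x))) (fs-* (λ k → W (+ suc m) (k + 1ℤ)) (atMost-fsʳ (+ suc m) (x - + 2 * + suc m)))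
    (λ k → cong (W (+ suc m) (k + 1ℤ) *_) (pe-atMost m k x)))

rangeSum-lengthSum : ∀ g m n → rangeSum m (partSum (λ _ → g) (+ 2 * + suc n)) ≡ lengthSum g (+ m) (+ 2 * + suc n)
rangeSum-lengthSum g 0 n = sym (∑-zero (fs-* g (atMost-fsʳ 0ℤ (+ 2 * + suc n))) (λ k → trans (cong (g k *_) (trans (atMost-0 k (+ 2 * + suc n)) (z k))) (*-zeroʳ (g k))))
  where
  z : ∀ k → pe 0ℤ k (+ 2 * + suc n) ≡ 0ℤ
  z (+ 0)     = refl
  z (+ suc k) = refl
  z -[1+ k ]  = refl
rangeSum-lengthSum g (suc m) n = begin
  partSum (λ _ → g) x (+ suc m) + rangeSum m (partSum (λ _ → g) x)
    ≡⟨ cong (λ z → partSum (λ _ → g) x (+ suc m) + z) (rangeSum-lengthSum g m n) ⟩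
  partSum (λ _ → g) x (+ suc m) + lengthSum g (+ m) x
    ≡⟨ ∑-+ p q (fs-+ p q) ⟨
  ∑ (λ k → g k * pe (+ suc m) k x + g k * atMost (+ m) k x) (fs-+ p q)
    ≡⟨ ∑-cong (fs-+ p q) (fs-* g (atMost-fsʳ (+ suc m) x)) pt ⟩
  lengthSum g (+ suc m) x ∎
  where
  open ≡-Reasoning
  x = + 2 * + suc n
  p : FinSupp (λ k → g k * pe (+ suc m) k x)
  p = fs-* g (pe-fsʳ (+ suc m) x)
  q : FinSupp (λ k → g k * atMost (+ m) k x)
  q = fs-* g (atMost-fsʳ (+ m) x)
  step : ∀ k → atMost (+ suc m) k x ≡ atMost (+ m) k x + pe (+ suc m) k x
  step k = subst (λ s → atMost (+ s) k x ≡ atMost (+ m) k x + pe (+ s) k x) (ℕₚ.+-comm m 1) (atMost-step (+ m) k x)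
  e : ∀ g a b → g * a + g * b ≡ g * (b + a)
  e = solve-∀
  pt : ∀ k → g k * pe (+ suc m) k x + g k * atMost (+ m) k x ≡ g k * atMost (+ suc m) k x
  pt k = trans (e (g k) (pe (+ suc m) k x) (atMost (+ m) k x)) (cong (g k *_) (sym (step k)))

lengthSum-0 : ∀ g m → lengthSum g (+ m) 0ℤ ≡ g 0ℤ
lengthSum-0 g m = trans (∑-single (fs-* g (atMost-fsʳ (+ m) 0ℤ)) 0ℤ off)
    (trans (cong (g 0ℤ *_) (trans (∑-single (atMost-fs (+ m) 0ℤ 0ℤ) 0ℤ off′) (cong (_* 1ℤ) (cong pos (+-identityʳ (+ m)))))) (*-identityʳ (g 0ℤ)))
  where
  zero : ∀ k → + ∣ k ∣ ≤ 0ℤ → k ≡ 0ℤ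
  zero k (+≤+ l) = ∣i∣≡0⇒i≡0 (ℕₚ.n≤0⇒n≡0 l)
  off : ∀ k → k ≢ 0ℤ → g k * atMost (+ m) k 0ℤ ≡ 0ℤ
  off k ne with atMost-supp (+ m) k 0ℤ
  ... | inj₁ z = trans (cong (g k *_) z) (*-zeroʳ (g k))
  ... | inj₂ l = ⊥-elim (ne (zero k l))
  off′ : ∀ i → i ≢ 0ℤ → pos (+ m - i) * pe i 0ℤ 0ℤ ≡ 0ℤ
  off′ i ne with pe-supp i 0ℤ 0ℤ
  ... | inj₁ z = trans (cong (pos (+ m - i) *_) z) (*-zeroʳ (pos (+ m - i)))
  ... | inj₂ (l , _) = ⊥-elim (ne (zero i l))

mutual
  -- Once the largest part has been split off, a weight depends on the remaining list through its
  -- length only. Hence the mutual recursion: weights of two arguments reduce to weights of the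
  -- length, with one unit of fuel less.
  parts-lengthSum : ∀ f m n g → n ℕ.≤ f → listSum (λ p → g (+ length p)) (partsBounded f m n) ≡ lengthSum g (+ m) (+ 2 * + n)
  parts-lengthSum f       m 0       g l = trans (+-identityʳ (g 0ℤ)) (sym (lengthSum-0 g m))
  parts-lengthSum (suc f) m (suc n) g (s≤s l) = trans (parts-rangeSum f m n (λ _ → g) l) (rangeSum-lengthSum g m n)

  parts-rangeSum : ∀ f m n W → n ℕ.≤ f → listSum (λ p → W (+ largestPart p) (+ length p)) (partsBounded (suc f) m (suc n)) ≡
                   rangeSum m (partSum W (+ 2 * + suc n))
  parts-rangeSum f m n W l = trans (cong (listSum h) (partsBounded-unfold f m n)) (go m)
    where
    h : List ℕ → ℤ
    h p = W (+ largestPart p) (+ length p)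
    go : ∀ m → listSum h (concatMap (choose′ f n) (map suc (downFrom m))) ≡ rangeSum m (partSum W (+ 2 * + suc n))
    go 0       = refl
    go (suc m) = trans (listSum-++ h (choose′ f n (suc m)) (concatMap (choose′ f n) (map suc (downFrom m)))) (cong₂ _+_ (choose-sum f m n W l) (go m))

  choose-sum : ∀ f m n W → n ℕ.≤ f → listSum (λ p → W (+ largestPart p) (+ length p)) (choose′ f n (suc m)) ≡ partSum W (+ 2 * + suc n) (+ suc m)
  choose-sum f m n W l with suc m ℕ.≤? suc n
  ... | yes (s≤s m≤n) = begin
    listSum h (map (suc m ∷_) (partsBounded f (suc m) (n ℕ.∸ m)))
      ≡⟨ listSum-map h (suc m ∷_) (partsBounded f (suc m) (n ℕ.∸ m)) ⟩
    listSum (λ p → W (+ suc m) (+ suc (length p))) (partsBounded f (suc m) (n ℕ.∸ m))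
      ≡⟨ listSum-cong (λ p → cong (λ z → W (+ suc m) (+ z)) (ℕₚ.+-comm 1 (length p))) (partsBounded f (suc m) (n ℕ.∸ m)) ⟩
    listSum (λ p → W (+ suc m) (+ length p + 1ℤ)) (partsBounded f (suc m) (n ℕ.∸ m))
      ≡⟨ parts-lengthSum f (suc m) (n ℕ.∸ m) (λ k → W (+ suc m) (k + 1ℤ)) (ℕₚ.≤-trans (ℕₚ.m∸n≤m n m) l) ⟩
    lengthSum (λ k → W (+ suc m) (k + 1ℤ)) (+ suc m) (+ 2 * + (n ℕ.∸ m))
      ≡⟨ cong (lengthSum (λ k → W (+ suc m) (k + 1ℤ)) (+ suc m)) arg ⟩
    lengthSum (λ k → W (+ suc m) (k + 1ℤ)) (+ suc m) (+ 2 * + suc n - + 2 * + suc m)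
      ≡⟨ partSum-lengthSum W m (+ 2 * + suc n) ⟨
    partSum W (+ 2 * + suc n) (+ suc m) ∎
    where
    open ≡-Reasoning
    h : List ℕ → ℤ
    h p = W (+ largestPart p) (+ length p)
    e : ∀ n m → + 2 * (n - m) ≡ + 2 * (1ℤ + n) - + 2 * (1ℤ + m)
    e = solve-∀
    arg : + 2 * + (n ℕ.∸ m) ≡ + 2 * + suc n - + 2 * + suc m
    arg = trans (cong (+ 2 *_) (trans (sym (⊖-≥ m≤n)) (sym ([+m]-[+n]≡m⊖n n m)))) (e (+ n) (+ m))
  -- A part larger than the number: the list is empty, and on the other side the argument left after
  -- removing the part is negative.
  ... | no gt = sym (trans (partSum-lengthSum W m (+ 2 * + suc n)) (∑-zero (fs-* (λ k → W (+ suc m) (k + 1ℤ)) (atMost-fsʳ (+ suc m) y)) z))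
    where
    y = + 2 * + suc n - + 2 * + suc m
    e : ∀ n d → + 2 * (1ℤ + n) - + 2 * (1ℤ + (1ℤ + n + d)) ≡ - (1ℤ + (1ℤ + (d + d)))
    e = solve-∀
    m≡ : m ≡ suc n ℕ.+ (m ℕ.∸ suc n)
    m≡ = sym (ℕₚ.m+[n∸m]≡n (ℕₚ.≤-pred (ℕₚ.≰⇒> gt)))
    y≡ : y ≡ -[1+ suc (m ℕ.∸ suc n ℕ.+ (m ℕ.∸ suc n)) ]
    y≡ = trans (cong (λ z → + 2 * + suc n - + 2 * + suc z) m≡) (e (+ n) (+ (m ℕ.∸ suc n)))
    z : ∀ k → W (+ suc m) (k + 1ℤ) * atMost (+ suc m) k y ≡ 0ℤ
    z k = trans (cong (W (+ suc m) (k + 1ℤ) *_) (trans (cong (atMost (+ suc m) k) y≡) (atMost-neg (+ suc m) k (suc (m ℕ.∸ suc n ℕ.+ (m ℕ.∸ suc n)))))) (*-zeroʳ (W (+ suc m) (k + 1ℤ)))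

pe-box : ∀ (W : ℤ → ℤ → ℤ) x → Box (λ l k → W l k * pe l k x)
pe-box W x = box-bounded x λ l k → ⊎-*ˡ (W l k) (pe l k x) (pe-supp l k x)

weighted-parts : ∀ w x → weighted w x ≡ ∑ (partSum (λ l k → w (l - k)) x) (rows (pe-box (λ l k → w (l - k)) x) (λ l → fs-* (λ k → w (l - k)) (pe-fsʳ l x)))
weighted-parts w x = begin
  weighted w x
    ≡⟨ ∑-cong (fs-* w (N₌-fs x)) (rows B (row B)) (λ j → sym (∑-* (w j) (row (rank-box x) j) (row B j))) ⟩
  ∑ (λ j → ∑ (λ k → w j * pe (k + j) k x) (row B j)) (rows B (row B))
    ≡⟨ ∑-swap B (row B) (column B) (rows B (row B)) (columns B (column B)) ⟩
  ∑ (λ k → ∑ (λ j → w j * pe (k + j) k x) (column B k)) (columns B (column B))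
    ≡⟨ ∑-cong (columns B (column B)) (columns B′ (column B′)) (λ k → sym (trans
         (∑-shift k (λ l → w (l - k) * pe l k x) (column B′ k) (fs-shift k (column B′ k)))
         (∑-cong (fs-shift k (column B′ k)) (column B k) (λ j → cong₂ (λ a b → w a * pe b k x) (e j k) (+-comm j k))))) ⟩
  ∑ (λ k → ∑ (λ l → w (l - k) * pe l k x) (column B′ k)) (columns B′ (column B′))
    ≡⟨ ∑-swap B′ (λ l → fs-* (λ k → w (l - k)) (pe-fsʳ l x)) (column B′) (rows B′ (λ l → fs-* (λ k → w (l - k)) (pe-fsʳ l x))) (columns B′ (column B′)) ⟨
  ∑ (partSum (λ l k → w (l - k)) x) (rows B′ (λ l → fs-* (λ k → w (l - k)) (pe-fsʳ l x))) ∎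
  where
  open ≡-Reasoning
  B : Box (λ j k → w j * pe (k + j) k x)
  B = box (Box.side (rank-box x)) λ j k → ⊎-*ˡ (w j) (pe (k + j) k x) (Box.inside (rank-box x) j k)
  B′ = pe-box (λ l k → w (l - k)) x
  e : ∀ j k → j + k - k ≡ j
  e = solve-∀

S-rangeSum : ∀ q m → q 0ℤ ≡ 0ℤ → (∀ n → q -[1+ n ] ≡ 0ℤ) → S m q ≡ rangeSum m q
S-rangeSum q 0       z zn = z
S-rangeSum q (suc m) z zn = trans (cong₂ (λ a b → a + (q (+ suc m) + b)) (S-rangeSum q m z zn) (zn m)) (e (rangeSum m q) (q (+ suc m)))
  where
  e : ∀ a b → a + (b + 0ℤ) ≡ b + a
  e = solve-∀

partSum-supp : ∀ W n l → partSum W (+ 2 * + suc n) l ≡ 0ℤ ⊎ ∣ l ∣ ℕ.≤ suc n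
partSum-supp W n -[1+ l ]  = inj₁ (∑-zero (fs-* (W -[1+ l ]) (pe-fsʳ -[1+ l ] (+ 2 * + suc n))) (λ k → *-zeroʳ (W -[1+ l ] k)))
partSum-supp W n (+ 0)     = inj₂ z≤n
partSum-supp W n (+ suc l) with suc l ℕ.≤? suc n
... | yes h = inj₂ h
... | no gt = inj₁ (trans (sym (choose-sum n l n W ℕₚ.≤-refl)) (empty gt))
  where
  empty : ¬ suc l ℕ.≤ suc n → listSum (λ p → W (+ largestPart p) (+ length p)) (choose′ n n (suc l)) ≡ 0ℤ
  empty gt with suc l ℕ.≤? suc n
  ... | yes h = ⊥-elim (gt h)
  ... | no _  = refl

partitions-weighted : ∀ w n → listSum (λ p → w (rank p)) (partitions (suc n)) ≡ weighted w (+ 2 * + suc n)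
partitions-weighted w n = begin
  listSum (λ p → w (rank p)) (partitions (suc n))
    ≡⟨ parts-rangeSum n (suc n) n W ℕₚ.≤-refl ⟩
  rangeSum (suc n) (partSum W x)
    ≡⟨ S-rangeSum (partSum W x) (suc n) zero (λ l → ∑-zero (fs-* (W -[1+ l ]) (pe-fsʳ -[1+ l ] x)) (λ k → *-zeroʳ (W -[1+ l ] k))) ⟨
  S (suc n) (partSum W x)
    ≡⟨ ∑-bound (partSum W x) r (suc n) (partSum-supp W n) ⟨
  ∑ (partSum W x) r
    ≡⟨ weighted-parts w x ⟨
  weighted w x ∎
  where
  open ≡-Reasoning
  x = + 2 * + suc n
  W : ℤ → ℤ → ℤ
  W l k = w (l - k)
  r = rows (pe-box W x) (λ l → fs-* (W l) (pe-fsʳ l x))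
  z : ∀ k → pe 0ℤ k x ≡ 0ℤ
  z (+ 0)     = refl
  z (+ suc k) = refl
  z -[1+ k ]  = refl
  zero : partSum W x 0ℤ ≡ 0ℤ
  zero = ∑-zero (fs-* (W 0ℤ) (pe-fsʳ 0ℤ x)) (λ k → trans (cong (W 0ℤ k *_) (z k)) (*-zeroʳ (W 0ℤ k)))

length-filter : ∀ {A : Set} (f : A → ℕ) ps → + length (filter (λ p → f p ℕₚ.≟ 0) ps) ≡ listSum (λ p → [ f p ≟ 0 ]) ps
length-filter f []       = refl
length-filter f (p ∷ ps) with f p
... | 0     = cong (λ z → 1ℤ + z) (length-filter f ps)
... | suc _ = trans (length-filter f ps) (sym (+-identityˡ _))

N-listSum : ∀ a n → + N a 3 n ≡ listSum (λ p → [ (rank p - a) %ℕ 3 ≟ 0 ]) (partitions n)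
N-listSum a n = length-filter (λ p → (rank p - a) %ℕ 3) (partitions n)

residue-diff : ∀ m → [ (m - 0ℤ) %ℕ 3 ≟ 0 ] - [ (m - 1ℤ) %ℕ 3 ≟ 0 ] ≡ cyc 1ℤ -1ℤ 0ℤ m
residue-diff m with mod3 m
... | mod0 q = trans (cong₂ (λ a b → [ a ≟ 0 ] - [ b ≟ 0 ]) (trans (cong (_%ℕ 3) (e₀ q)) (%ℕ-unique 3 0 q (s≤s z≤n))) (trans (cong (_%ℕ 3) (e₁ q)) (%ℕ-unique 3 2 (q - 1ℤ) ℕₚ.≤-refl))) (sym (cyc-0 1ℤ -1ℤ 0ℤ q))
  where
  e₀ : ∀ q → + 0 + q * + 3 - 0ℤ ≡ + 0 + q * + 3
  e₀ = solve-∀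
  e₁ : ∀ q → + 0 + q * + 3 - 1ℤ ≡ + 2 + (q - 1ℤ) * + 3
  e₁ = solve-∀
... | mod1 q = trans (cong₂ (λ a b → [ a ≟ 0 ] - [ b ≟ 0 ]) (trans (cong (_%ℕ 3) (e₀ q)) (%ℕ-unique 3 1 q (s≤s (s≤s z≤n)))) (trans (cong (_%ℕ 3) (e₁ q)) (%ℕ-unique 3 0 q (s≤s z≤n)))) (sym (cyc-1 1ℤ -1ℤ 0ℤ q))
  where
  e₀ : ∀ q → + 1 + q * + 3 - 0ℤ ≡ + 1 + q * + 3
  e₀ = solve-∀
  e₁ : ∀ q → + 1 + q * + 3 - 1ℤ ≡ + 0 + q * + 3
  e₁ = solve-∀
... | mod2 q = trans (cong₂ (λ a b → [ a ≟ 0 ] - [ b ≟ 0 ]) (trans (cong (_%ℕ 3) (e₀ q)) (%ℕ-unique 3 2 q ℕₚ.≤-refl)) (trans (cong (_%ℕ 3) (e₁ q)) (%ℕ-unique 3 1 q (s≤s (s≤s z≤n))))) (sym (cyc-2 1ℤ -1ℤ 0ℤ q))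
  where
  e₀ : ∀ q → + 2 + q * + 3 - 0ℤ ≡ + 2 + q * + 3
  e₀ = solve-∀
  e₁ : ∀ q → + 2 + q * + 3 - 1ℤ ≡ + 1 + q * + 3
  e₁ = solve-∀

N-C : ∀ n → + N (+ 0) 3 (suc n) - + N (+ 1) 3 (suc n) ≡ C (+ 2 * + suc n)
N-C n = begin
  + N (+ 0) 3 (suc n) - + N (+ 1) 3 (suc n)
    ≡⟨ cong₂ _-_ (N-listSum (+ 0) (suc n)) (N-listSum (+ 1) (suc n)) ⟩
  listSum (λ p → [ (rank p - + 0) %ℕ 3 ≟ 0 ]) (partitions (suc n)) - listSum (λ p → [ (rank p - + 1) %ℕ 3 ≟ 0 ]) (partitions (suc n))
    ≡⟨ listSum-- (λ p → [ (rank p - + 0) %ℕ 3 ≟ 0 ]) (λ p → [ (rank p - + 1) %ℕ 3 ≟ 0 ]) (partitions (suc n)) ⟩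
  listSum (λ p → [ (rank p - + 0) %ℕ 3 ≟ 0 ] - [ (rank p - + 1) %ℕ 3 ≟ 0 ]) (partitions (suc n))
    ≡⟨ listSum-cong (λ p → residue-diff (rank p)) (partitions (suc n)) ⟩
  listSum (λ p → cyc 1ℤ -1ℤ 0ℤ (rank p)) (partitions (suc n))
    ≡⟨ partitions-weighted (cyc 1ℤ -1ℤ 0ℤ) n ⟩
  C (+ 2 * + suc n) ∎
  where open ≡-Reasoning

-- Growth of the partition function

≤-+ʳ : ∀ {a b} → 0ℤ ≤ b → a ≤ a + b
≤-+ʳ {a} {b} h = subst (_≤ a + b) (+-identityʳ a) (+-monoʳ-≤ a h)

pos-nonneg : ∀ i → 0ℤ ≤ pos i
pos-nonneg (+ _)    = +-≥0 1
pos-nonneg -[1+ _ ] = +-≥0 0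

H-nonneg : ∀ m x → 0ℤ ≤ H m x
H-nonneg m x = ∑-nonneg (fs-* (λ j → pos (m - j)) (N₌-fs x)) (λ j → *-nonneg (pos-nonneg (m - j)) (N₌-nonneg j x))

H≤P : ∀ m x → H m x ≤ P x
H≤P m x = subst (H m x ≤_) (H-compl m x) (≤-+ʳ (H-nonneg (-1ℤ - m) x))

P-nonneg : ∀ x → 0ℤ ≤ P x
P-nonneg x = ∑-nonneg (N₌-fs x) (λ j → N₌-nonneg j x)

-- `P` splits into ranks at most 0 and, by conjugation, ranks at most -1. Dyson's recurrence with
-- `u = 0` and `u = 1` lowers the size by 1 and 2, that is, the doubled argument by 2 and 4.
-- Bounding `H` by `P` then gives `P-subadditive`.
P-rec : ∀ x → P x ≡ δ x + (H (+ 2) (x - + 2) + H (+ 3) (x - + 4))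
P-rec x = begin
  P x                                                     ≡⟨ H-compl 0ℤ x ⟨
  H 0ℤ x + H -1ℤ x                                        ≡⟨ cong₂ _+_ (dyson 0 x) (dyson 1 x) ⟩
  H (+ 2) (x - + 2) + δ x + (H (+ 3) (x - + 4) + 0ℤ)      ≡⟨ e (H (+ 2) (x - + 2)) (δ x) (H (+ 3) (x - + 4)) ⟩
  δ x + (H (+ 2) (x - + 2) + H (+ 3) (x - + 4))           ∎
  where
  open ≡-Reasoning
  e : ∀ a d b → a + d + (b + 0ℤ) ≡ d + (a + b)
  e = solve-∀

P-subadditive : ∀ x → x ≢ 0ℤ → P x ≤ P (x - + 2) + P (x - + 4)
P-subadditive x ne = subst (_≤ P (x - + 2) + P (x - + 4))
  (sym (trans (P-rec x) (trans (cong (_+ (H (+ 2) (x - + 2) + H (+ 3) (x - + 4))) (δ-≢ ne)) (+-identityˡ _))))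
  (+-mono-≤ (H≤P (+ 2) (x - + 2)) (H≤P (+ 3) (x - + 4)))

P-0 : P 0ℤ ≡ 1ℤ
P-0 = trans (P-rec 0ℤ) (cong (λ z → 1ℤ + z) (cong₂ _+_ (H-neg (+ 2) 1) (H-neg (+ 3) 3)))

P-2 : P (+ 2) ≡ 1ℤ
P-2 = begin
  P (+ 2)                                   ≡⟨ P-rec (+ 2) ⟩
  0ℤ + (H (+ 2) 0ℤ + H (+ 3) (- + 2))       ≡⟨ cong (λ z → 0ℤ + (H (+ 2) 0ℤ + z)) (H-neg (+ 3) 1) ⟩
  0ℤ + (H (+ 2) 0ℤ + 0ℤ)                    ≡⟨ trans (+-identityˡ _) (cong (λ z → H (+ 2) 0ℤ + z) (sym (trans (dyson 3 0ℤ) (cong (_+ 0ℤ) (H-neg (+ 5) 7))))) ⟩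
  H (+ 2) 0ℤ + H (- + 3) 0ℤ                 ≡⟨ trans (H-compl (+ 2) 0ℤ) P-0 ⟩
  1ℤ                                        ∎
  where open ≡-Reasoning

one : ℤ → ℤ → ℤ
one _ _ = 1ℤ

largest-fs : ∀ x → FinSupp (partSum one x)
largest-fs x = rows (pe-box one x) (λ l → fs-* (one l) (pe-fsʳ l x))

P-parts : ∀ x → P x ≡ ∑ (partSum one x) (largest-fs x)
P-parts x = trans (∑-cong (N₌-fs x) (fs-* (λ _ → 1ℤ) (N₌-fs x)) (λ j → sym (*-identityˡ (N₌ j x)))) (weighted-parts (λ _ → 1ℤ) x)

bin-monotoneˡ : ∀ l k x → bin l k x ≤ bin (suc l) k x
bin-monotoneˡ l 0       x = ≤-reflexive (bin-0ʳ l x)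
bin-monotoneˡ l (suc k) x = ≤-+ʳ (bin-nonneg (suc l) k (x - + 2 * + suc l))

-- Enlarging the largest part by one is injective, except that the empty partition has no largest part.
pe-enlarge : ∀ l k x → x ≢ + 2 → pe l k (x - + 2) ≤ pe (l + 1ℤ) k x
pe-enlarge (+ 0)     (+ 0)     x ne = ≤-reflexive (δ-≢ (λ z → ne (i-j≡0⇒i≡j x (+ 2) z)))
pe-enlarge (+ 0)     (+ suc k) x ne = pe-nonneg 1ℤ (+ suc k) x
pe-enlarge (+ suc l) (+ 0)     x ne = ≤-refl
pe-enlarge (+ suc l) (+ suc k) x ne = subst (pe (+ suc l) (+ suc k) (x - + 2) ≤_)
    (trans (cong (bin (suc l) k) (e x (+ l) (+ k))) (cong (λ z → pe (+ z) (+ suc k) x) (ℕₚ.+-comm 1 (suc l))))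
    (bin-monotoneˡ l k (x - + 2 - + 2 * (+ l + + k + 1ℤ)))
  where
  e : ∀ x l k → x - + 2 - + 2 * (l + k + 1ℤ) ≡ x - + 2 * (1ℤ + l + k + 1ℤ)
  e = solve-∀
pe-enlarge l         -[1+ k ]  x ne = ≤-reflexive (trans (pe-negʳ l k (x - + 2)) (sym (pe-negʳ (l + 1ℤ) k x)))
pe-enlarge -[1+ l ]  (+ k)     x ne = pe-nonneg (-[1+ l ] + 1ℤ) (+ k) x

partSum-enlarge : ∀ x → x ≢ + 2 → ∀ l → partSum one (x - + 2) l ≤ partSum one x (l + 1ℤ)
partSum-enlarge x ne l = ∑-mono (fs-* (one l) (pe-fsʳ l (x - + 2))) (fs-* (one (l + 1ℤ)) (pe-fsʳ (l + 1ℤ) x))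
  (λ k → subst (_≤ 1ℤ * pe (l + 1ℤ) k x) (sym (*-identityˡ _)) (subst (pe l k (x - + 2) ≤_) (sym (*-identityˡ _)) (pe-enlarge l k x ne)))

P-shift : ∀ x → P x ≡ ∑ (λ l → partSum one x (l + 1ℤ)) (fs-shift 1ℤ (largest-fs x))
P-shift x = trans (P-parts x) (∑-shift 1ℤ (partSum one x) (largest-fs x) (fs-shift 1ℤ (largest-fs x)))

-- Enlarging the largest part gives the injection except at `x = 2`, where the smaller partition is
-- empty; there both values are 1.
P-monotone : ∀ x → P (x - + 2) ≤ P x
P-monotone x = go (x ℤₚ.≟ + 2)
  where
  go : Dec (x ≡ + 2) → P (x - + 2) ≤ P x
  go (yes refl) = ≤-reflexive (trans P-0 (sym P-2))
  go (no ne)    = subst (_≤ P x) (sym (P-parts (x - + 2))) (subst (∑ (partSum one (x - + 2)) (largest-fs (x - + 2)) ≤_) (sym (P-shift x))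
    (∑-mono (largest-fs (x - + 2)) (fs-shift 1ℤ (largest-fs x)) (partSum-enlarge x ne)))

-- The partition into ones is not obtained by enlarging a largest part.
P-strict : ∀ n → P (+ 2 * + suc (suc n) - + 2) + 1ℤ ≤ P (+ 2 * + suc (suc n))
P-strict n = subst (P (x - + 2) + 1ℤ ≤_) (back (P (x - + 2)) (P x)) (+-monoʳ-≤ (P (x - + 2)) gap)
  where
  x = + 2 * + suc (suc n)
  x≢2 : x ≢ + 2
  x≢2 e = ℕₚ.m+1+n≢0 n (ℕₚ.suc-injective (ℕₚ.suc-injective (+-injective e)))
  back : ∀ a b → a + (b - a) ≡ b
  back = solve-∀
  d : ℤ → ℤ
  d l = partSum one x (l + 1ℤ) + -1ℤ * partSum one (x - + 2) l
  q : FinSupp (λ l → -1ℤ * partSum one (x - + 2) l)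
  q = fs-* (λ _ → -1ℤ) (largest-fs (x - + 2))
  d-fs : FinSupp d
  d-fs = fs-+ (fs-shift 1ℤ (largest-fs x)) q
  neg : ∀ a b → a - b ≡ a + -1ℤ * b
  neg = solve-∀
  d-nonneg : ∀ l → 0ℤ ≤ d l
  d-nonneg l = subst (0ℤ ≤_) (neg (partSum one x (l + 1ℤ)) (partSum one (x - + 2) l)) (i≤j⇒0≤j-i (partSum-enlarge x x≢2 l))
  ones : pe 1ℤ (+ suc (suc n)) x ≡ 1ℤ
  ones = cong δ (e (+ n))
    where
    e : ∀ n → + 2 * (+ 2 + n) - + 2 * (0ℤ + (1ℤ + n) + 1ℤ) ≡ 0ℤ
    e = solve-∀
  first : 1ℤ ≤ partSum one x 1ℤ
  first = subst (_≤ partSum one x 1ℤ) (trans (*-identityˡ _) ones)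
    (∑-term (fs-* (one 1ℤ) (pe-fsʳ 1ℤ x)) (λ k → subst (0ℤ ≤_) (sym (*-identityˡ _)) (pe-nonneg 1ℤ k x)) (+ suc (suc n)))
  none : partSum one (x - + 2) 0ℤ ≡ 0ℤ
  none = ∑-zero (fs-* (one 0ℤ) (pe-fsʳ 0ℤ (x - + 2))) z
    where
    e : ∀ n → + 2 * (+ 2 + n) - + 2 ≡ + 2 + (n + n)
    e = solve-∀
    z : ∀ k → 1ℤ * pe 0ℤ k (x - + 2) ≡ 0ℤ
    z (+ 0)     = trans (*-identityˡ _) (cong δ (e (+ n)))
    z (+ suc k) = refl
    z -[1+ k ]  = refl
  total : ∑ d d-fs ≡ P x - P (x - + 2)
  total = trans (∑-+ (fs-shift 1ℤ (largest-fs x)) q d-fs)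
    (trans (cong₂ _+_ (sym (P-shift x)) (trans (∑-* -1ℤ (largest-fs (x - + 2)) q) (cong (-1ℤ *_) (sym (P-parts (x - + 2)))))) (sym (neg (P x) (P (x - + 2)))))
  gap : 1ℤ ≤ P x - P (x - + 2)
  gap = subst (1ℤ ≤_) total (≤-trans first (subst (_≤ ∑ d d-fs) (trans (cong (λ z → partSum one x 1ℤ + -1ℤ * z) none) (+-identityʳ _)) (∑-term d-fs d-nonneg 0ℤ)))

-- The ordinary partition function, undoing the doubling of exponents.
p : ℤ → ℤ
p m = P (+ 2 * m)

p-supp : ∀ m → p m ≡ 0ℤ ⊎ 0ℤ ≤ m
p-supp (+ n)    = inj₂ (+-≥0 n)
p-supp -[1+ n ] = inj₁ (P-neg (n ℕ.+ suc (n ℕ.+ 0)))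

p-nonneg : ∀ m → 0ℤ ≤ p m
p-nonneg m = P-nonneg (+ 2 * m)

private
  double : ∀ m c → + 2 * (m - c) ≡ + 2 * m - + 2 * c
  double = solve-∀

p-monotone : ∀ m → p (m - 1ℤ) ≤ p m
p-monotone m = subst (λ z → P z ≤ p m) (sym (double m 1ℤ)) (P-monotone (+ 2 * m))

p-strict : ∀ n → p (+ suc (suc n) - 1ℤ) + 1ℤ ≤ p (+ suc (suc n))
p-strict n = subst (λ z → P z + 1ℤ ≤ p (+ suc (suc n))) (sym (double (+ suc (suc n)) 1ℤ)) (P-strict n)

p-subadditive : ∀ n → p (+ suc n) ≤ p (+ suc n - 1ℤ) + p (+ suc n - + 2)
p-subadditive n = subst (p (+ suc n) ≤_) (cong₂ (λ a b → P a + P b) (sym (double (+ suc n) 1ℤ)) (sym (double (+ suc n) (+ 2)))) (P-subadditive (+ 2 * + suc n) (λ ()))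

-- Sums along arithmetic progressions

module Progression (f : ℤ → ℤ) (f-nonneg : ∀ y → 0ℤ ≤ f y) (f-supp : ∀ y → f y ≡ 0ℤ ⊎ 0ℤ ≤ y) where

  ap-term : ℤ → ℕ → ℤ → ℤ → ℤ
  ap-term a d x j = pos j * f (x - (a + + d * j))

  ap-bounds : ∀ a d .{{_ : NonZero d}} x j → ap-term a d x j ≡ 0ℤ ⊎ + ∣ j ∣ ≤ x - a
  ap-bounds a d x -[1+ n ] = inj₁ refl
  ap-bounds a d x (+ n) with f-supp (x - (a + + d * + n))
  ... | inj₁ z = inj₁ (cong (1ℤ *_) z)
  ... | inj₂ h = inj₂ (≤-from (e x a (+ n) (+ d * + n)) (+-nonneg h (i≤j⇒0≤j-i (subst (+ n ≤_) (pos-* d n) (+≤+ (ℕₚ.m≤n*m n d))))))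
    where
    e : ∀ x a n m → x - a - n ≡ x - (a + m) + (m - n)
    e = solve-∀

  ap-fs : ∀ a d .{{_ : NonZero d}} x → FinSupp (ap-term a d x)
  ap-fs a d x = fs-bounded (x - a) (ap-bounds a d x)

  iterate-step : ∀ s → (∀ y → f (y - + s) ≤ f y) → ∀ k y → f (y - + s * + k) ≤ f y
  iterate-step s step 0       y = ≤-reflexive (cong f (trans (cong (λ z → y - z) (*-zeroʳ (+ s))) (+-identityʳ y)))
  iterate-step s step (suc k) y = ≤-trans (≤-reflexive (cong f (e y (+ s) (+ k)))) (≤-trans (iterate-step s step k (y - + s)) (step y))
    where
    e : ∀ y s k → y - s * (1ℤ + k) ≡ y - s - s * k
    e = solve-∀

  abstract
    ap : ℤ → ∀ d → .{{_ : NonZero d}} → ℤ → ℤ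
    ap a d x = ∑ (ap-term a d x) (ap-fs a d x)

    ap-def : ∀ a d .{{_ : NonZero d}} x → ap a d x ≡ ∑ (ap-term a d x) (ap-fs a d x)
    ap-def a d x = refl

    ap-term-nonneg : ∀ a d x j → 0ℤ ≤ ap-term a d x j
    ap-term-nonneg a d x j = *-nonneg (pos-nonneg j) (f-nonneg (x - (a + + d * j)))

    ap-nonneg : ∀ a d .{{_ : NonZero d}} x → 0ℤ ≤ ap a d x
    ap-nonneg a d x = ∑-nonneg (ap-fs a d x) (ap-term-nonneg a d x)

    ap-supp : ∀ a d .{{_ : NonZero d}} x → ap a d x ≡ 0ℤ ⊎ a ≤ x
    ap-supp a d x = go (a ℤₚ.≤? x)
      where
      go : Dec (a ≤ x) → ap a d x ≡ 0ℤ ⊎ a ≤ x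
      go (yes l) = inj₂ l
      go (no nl) = inj₁ (∑-zero (ap-fs a d x) z)
        where
        z : ∀ j → ap-term a d x j ≡ 0ℤ
        z j with ap-bounds a d x j
        ... | inj₁ e = e
        ... | inj₂ h = ⊥-elim (nl (0≤i-j⇒j≤i (≤-trans (+-≥0 ∣ j ∣) h)))

    -- Termwise: the `n`-th argument on the left is `s (u + w n)` below the one on the right, and
    -- `f` does not decrease in steps of `s`. Later start and wider spacing in multiples of `s`
    -- therefore make the sum smaller.
    ap-≤ : ∀ s → (∀ y → f (y - + s) ≤ f y) → ∀ {a a′} {d d′} .{{_ : NonZero d}} .{{_ : NonZero d′}} u w → a′ ≡ a + + s * + u → + d′ ≡ + d + + s * + w → ∀ x → ap a′ d′ x ≤ ap a d x
    ap-≤ s step {a} {a′} {d} {d′} u w ea ed x = ∑-mono (ap-fs a′ d′ x) (ap-fs a d x) le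
      where
      e : ∀ x a d s u w n → x - (a + s * u + (d + s * w) * n) ≡ x - (a + d * n) - s * (u + w * n)
      e = solve-∀
      le : ∀ j → ap-term a′ d′ x j ≤ ap-term a d x j
      le -[1+ n ] = ≤-refl
      le (+ n) = subst₂ _≤_ (sym (*-identityˡ _)) (sym (*-identityˡ _))
        (subst (λ z → f z ≤ f (x - (a + + d * + n)))
          (trans (cong (λ z → x - (a + + d * + n) - + s * (+ u + z)) (pos-* w n))
            (trans (sym (e x a (+ d) (+ s) (+ u) (+ w) (+ n))) (cong₂ (λ b c → x - (b + c * + n)) (sym ea) (sym ed))))
          (iterate-step s step (u ℕ.+ w ℕ.* n) (x - (a + + d * + n))))

    ap-peel : ∀ a d .{{_ : NonZero d}} x → ap a d x ≡ f (x - a) + ap (a + + d) d x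
    ap-peel a d x = begin
      ap a d x
        ≡⟨ ∑-shift 1ℤ (ap-term a d x) (ap-fs a d x) (fs-shift 1ℤ (ap-fs a d x)) ⟩
      ∑ (λ j → ap-term a d x (j + 1ℤ)) (fs-shift 1ℤ (ap-fs a d x))
        ≡⟨ ∑-cong (fs-shift 1ℤ (ap-fs a d x)) (fs-+ q (ap-fs (a + + d) d x)) pt ⟩
      ∑ (λ j → δ (j + 1ℤ) * f (x - a) + ap-term (a + + d) d x j) (fs-+ q (ap-fs (a + + d) d x))
        ≡⟨ ∑-+ q (ap-fs (a + + d) d x) (fs-+ q (ap-fs (a + + d) d x)) ⟩
      ∑ (λ j → δ (j + 1ℤ) * f (x - a)) q + ap (a + + d) d x
        ≡⟨ cong (_+ ap (a + + d) d x) (trans (∑-single q -1ℤ off) (*-identityˡ (f (x - a)))) ⟩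
      f (x - a) + ap (a + + d) d x ∎
      where
      open ≡-Reasoning
      back : ∀ j → j ≡ j + 1ℤ - 1ℤ
      back = solve-∀
      off : ∀ j → j ≢ -1ℤ → δ (j + 1ℤ) * f (x - a) ≡ 0ℤ
      off j ne = cong (_* f (x - a)) (δ-≢ {j + 1ℤ} λ z → ne (trans (back j) (cong (_- 1ℤ) z)))
      q : FinSupp (λ j → δ (j + 1ℤ) * f (x - a))
      q = fs-single -1ℤ off
      e : ∀ x a d j → x - (a + d * (j + 1ℤ)) ≡ x - (a + d + d * j)
      e = solve-∀
      e₀ : ∀ x a d → x - (a + d * (-1ℤ + 1ℤ)) ≡ x - a
      e₀ = solve-∀
      at : ∀ j → δ (j + 1ℤ) * f (x - (a + + d * (j + 1ℤ))) ≡ δ (j + 1ℤ) * f (x - a)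
      at j with δ-supp (j + 1ℤ)
      ... | inj₁ z = trans (cong (_* f (x - (a + + d * (j + 1ℤ)))) z) (sym (cong (_* f (x - a)) z))
      ... | inj₂ z = cong (λ w → δ (j + 1ℤ) * f w) (trans (cong (λ w → x - (a + + d * (w + 1ℤ))) (trans (back j) (cong (_- 1ℤ) z))) (e₀ x a (+ d)))
      pt : ∀ j → ap-term a d x (j + 1ℤ) ≡ δ (j + 1ℤ) * f (x - a) + ap-term (a + + d) d x j
      pt j = trans (cong (_* f (x - (a + + d * (j + 1ℤ)))) (trans (pos-step j) (+-comm (pos j) (δ (j + 1ℤ)))))
        (trans (*-distribʳ-+ (f (x - (a + + d * (j + 1ℤ)))) (δ (j + 1ℤ)) (pos j))
          (cong₂ _+_ (at j) (cong (λ z → pos j * f z) (e x a (+ d) j))))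

    ap-class : ∀ a d .{{_ : NonZero d}} c s → s ℕ.≤ c → ∀ x i → ap-term a d x (+ suc c * i + + s) ≡ ap-term (a + + d * + s) (suc c ℕ.* d) x i
    ap-class a d c s l x i = cong₂ (λ u v → u * f v) (pos-affine c s l i)
      (trans (e x a (+ d) (+ suc c) i (+ s)) (cong (λ z → x - (a + + d * + s + z * i)) (sym (pos-* (suc c) d))))
      where
      e : ∀ x a d c i s → x - (a + d * (c * i + s)) ≡ x - (a + d * s + c * d * i)
      e = solve-∀

    ap-split2 : ∀ a d .{{_ : NonZero d}} .{{_ : NonZero (2 ℕ.* d)}} x →
                ap a d x ≡ ap (a + + d * 0ℤ) (2 ℕ.* d) x + ap (a + + d * 1ℤ) (2 ℕ.* d) x
    ap-split2 a d x = trans (∑-split2 (ap-fs a d x) (q 0ℤ) (q 1ℤ))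
      (cong₂ _+_ (∑-cong (q 0ℤ) (ap-fs (a + + d * 0ℤ) (2 ℕ.* d) x) (ap-class a d 1 0 z≤n x))
                 (∑-cong (q 1ℤ) (ap-fs (a + + d * 1ℤ) (2 ℕ.* d) x) (ap-class a d 1 1 (s≤s z≤n) x)))
      where
      q : ∀ s → FinSupp (λ i → ap-term a d x (+ 2 * i + s))
      q s = fs-affine (+ 2) s (ap-fs a d x)

    ap-split3 : ∀ a d .{{_ : NonZero d}} .{{_ : NonZero (3 ℕ.* d)}} x →
                ap a d x ≡ ap (a + + d * 0ℤ) (3 ℕ.* d) x + (ap (a + + d * 1ℤ) (3 ℕ.* d) x + ap (a + + d * + 2) (3 ℕ.* d) x)
    ap-split3 a d x = trans (∑-split3 (ap-fs a d x) (q 0ℤ) (q 1ℤ) (q (+ 2)))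
      (cong₂ _+_ (∑-cong (q 0ℤ) (ap-fs (a + + d * 0ℤ) (3 ℕ.* d) x) (ap-class a d 2 0 z≤n x))
        (cong₂ _+_ (∑-cong (q 1ℤ) (ap-fs (a + + d * 1ℤ) (3 ℕ.* d) x) (ap-class a d 2 1 (s≤s z≤n) x))
                   (∑-cong (q (+ 2)) (ap-fs (a + + d * + 2) (3 ℕ.* d) x) (ap-class a d 2 2 ℕₚ.≤-refl x))))
      where
      q : ∀ s → FinSupp (λ i → ap-term a d x (+ 3 * i + s))
      q s = fs-affine (+ 3) s (ap-fs a d x)

-- Alternating sums

record Decreasing (v : ℤ → ℤ) : Set where
  no-eta-equality
  field
    finite   : FinSupp v
    negative : ∀ n → v -[1+ n ] ≡ 0ℤ
    nonneg   : ∀ n → 0ℤ ≤ v (+ n)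
    descent  : ∀ n → v (+ suc n) ≤ v (+ n)

open Decreasing

alternating : ∀ v → FinSupp v → ℤ
alternating v q = ∑ (λ i → sgn i * v i) (fs-* sgn q)

-- Pairing `2k` with `2k + 1` makes every summand nonnegative; only the pair `k = 0` is kept.
alternating-≥ : ∀ {v} (D : Decreasing v) → v 0ℤ - v 1ℤ ≤ alternating v (finite D)
alternating-≥ {v} D = subst (v 0ℤ - v 1ℤ ≤_) (sym pairs) (∑-term (fs-+ q₀ q₁) nn 0ℤ)
  where
  open ≡-Reasoning
  e₀ : ∀ k → + 2 * k + 0ℤ ≡ 0ℤ + (k + k)
  e₀ = solve-∀
  e₁ : ∀ k → + 2 * k + 1ℤ ≡ 0ℤ + 1ℤ + (k + k)
  e₁ = solve-∀
  s₀ : ∀ k → sgn (+ 2 * k + 0ℤ) * v (+ 2 * k + 0ℤ) ≡ v (+ 2 * k + 0ℤ)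
  s₀ k = trans (cong (_* v (+ 2 * k + 0ℤ)) (sgn-mod2 (+ 2 * k + 0ℤ) 0ℤ k (e₀ k))) (*-identityˡ _)
  s₁ : ∀ k → sgn (+ 2 * k + 1ℤ) * v (+ 2 * k + 1ℤ) ≡ - v (+ 2 * k + 1ℤ)
  s₁ k = trans (cong (_* v (+ 2 * k + 1ℤ)) (sgn-odd (+ 2 * k + 1ℤ) 0ℤ k (e₁ k))) (-1*i≡-i _)
  p₀ = fs-affine (+ 2) 0ℤ (fs-* sgn (finite D))
  p₁ = fs-affine (+ 2) 1ℤ (fs-* sgn (finite D))
  q₀ = fs-cong s₀ p₀
  q₁ = fs-cong s₁ p₁
  pairs : alternating v (finite D) ≡ ∑ (λ k → v (+ 2 * k + 0ℤ) + - v (+ 2 * k + 1ℤ)) (fs-+ q₀ q₁)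
  pairs = begin
    alternating v (finite D)
      ≡⟨ ∑-split2 (fs-* sgn (finite D)) p₀ p₁ ⟩
    ∑ (λ k → sgn (+ 2 * k + 0ℤ) * v (+ 2 * k + 0ℤ)) p₀ + ∑ (λ k → sgn (+ 2 * k + 1ℤ) * v (+ 2 * k + 1ℤ)) p₁
      ≡⟨ cong₂ _+_ (∑-cong p₀ q₀ s₀) (∑-cong p₁ q₁ s₁) ⟩
    ∑ (λ k → v (+ 2 * k + 0ℤ)) q₀ + ∑ (λ k → - v (+ 2 * k + 1ℤ)) q₁
      ≡⟨ ∑-+ q₀ q₁ (fs-+ q₀ q₁) ⟨
    ∑ (λ k → v (+ 2 * k + 0ℤ) + - v (+ 2 * k + 1ℤ)) (fs-+ q₀ q₁) ∎
  nn : ∀ k → 0ℤ ≤ v (+ 2 * k + 0ℤ) + - v (+ 2 * k + 1ℤ)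
  nn (+ k) = i≤j⇒0≤j-i (subst₂ (λ a b → v a ≤ v b) (trans (cong +_ (ℕₚ.+-comm 1 (2 ℕ.* k))) (cong (_+ 1ℤ) (pos-* 2 k))) (trans (sym (+-identityʳ (+ (2 ℕ.* k)))) (cong (_+ 0ℤ) (pos-* 2 k))) (descent D (2 ℕ.* k)))
  nn -[1+ k ] = ≤-reflexive (sym (cong₂ (λ a b → a + - b) (trans (cong v (f₀ (+ k))) (negative D (suc (k ℕ.+ k)))) (trans (cong v (f₁ (+ k))) (negative D (k ℕ.+ k)))))
    where
    f₀ : ∀ k → + 2 * - (1ℤ + k) + 0ℤ ≡ - (+ 2 + (k + k))
    f₀ = solve-∀
    f₁ : ∀ k → + 2 * - (1ℤ + k) + 1ℤ ≡ - (1ℤ + (k + k))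
    f₁ = solve-∀

tail : (ℤ → ℤ) → ℤ → ℤ
tail v i = pos i * v (i + 1ℤ)

tail-decreasing : ∀ {v} → Decreasing v → Decreasing (tail v)
tail-decreasing {v} D = record
  { finite   = fs-* pos (fs-shift 1ℤ (finite D))
  ; negative = λ n → refl
  ; nonneg   = λ n → subst (0ℤ ≤_) (sym (*-identityˡ _)) (nonneg D (n ℕ.+ 1))
  ; descent  = λ n → subst₂ _≤_ (sym (*-identityˡ _)) (sym (*-identityˡ _)) (descent D (n ℕ.+ 1))
  }

alternating-tail : ∀ {v} (D : Decreasing v) → alternating v (finite D) ≡ v 0ℤ - alternating (tail v) (finite (tail-decreasing D))
alternating-tail {v} D = begin
  alternating v (finite D)
    ≡⟨ ∑-shift 1ℤ (λ i → sgn i * v i) (fs-* sgn (finite D)) (fs-shift 1ℤ (fs-* sgn (finite D))) ⟩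
  ∑ (λ i → sgn (i + 1ℤ) * v (i + 1ℤ)) (fs-shift 1ℤ (fs-* sgn (finite D)))
    ≡⟨ ∑-cong (fs-shift 1ℤ (fs-* sgn (finite D))) (fs-+ q m) pt ⟩
  ∑ (λ i → δ (i + 1ℤ) * v 0ℤ + -1ℤ * (sgn i * tail v i)) (fs-+ q m)
    ≡⟨ ∑-+ q m (fs-+ q m) ⟩
  ∑ (λ i → δ (i + 1ℤ) * v 0ℤ) q + ∑ (λ i → -1ℤ * (sgn i * tail v i)) m
    ≡⟨ cong₂ _+_ (trans (∑-single q -1ℤ off) (*-identityˡ (v 0ℤ))) (trans (∑-* -1ℤ (fs-* sgn (finite (tail-decreasing D))) m) (-1*i≡-i _)) ⟩
  v 0ℤ - alternating (tail v) (finite (tail-decreasing D)) ∎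
  where
  open ≡-Reasoning
  back : ∀ j → j ≡ j + 1ℤ - 1ℤ
  back = solve-∀
  off : ∀ j → j ≢ -1ℤ → δ (j + 1ℤ) * v 0ℤ ≡ 0ℤ
  off j ne = cong (_* v 0ℤ) (δ-≢ {j + 1ℤ} λ z → ne (trans (back j) (cong (_- 1ℤ) z)))
  q : FinSupp (λ i → δ (i + 1ℤ) * v 0ℤ)
  q = fs-single -1ℤ off
  m : FinSupp (λ i → -1ℤ * (sgn i * tail v i))
  m = fs-* (λ _ → -1ℤ) (fs-* sgn (finite (tail-decreasing D)))
  e : ∀ s a → - s * a ≡ 0ℤ + -1ℤ * (s * (1ℤ * a))
  e = solve-∀
  pt : ∀ i → sgn (i + 1ℤ) * v (i + 1ℤ) ≡ δ (i + 1ℤ) * v 0ℤ + -1ℤ * (sgn i * tail v i)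
  pt (+ n) = trans (cong (_* v (+ n + 1ℤ)) (sgn-suc (+ n))) (trans (e (sgn (+ n)) (v (+ n + 1ℤ)))
    (cong (_+ -1ℤ * (sgn (+ n) * (1ℤ * v (+ n + 1ℤ)))) (sym (cong (_* v 0ℤ) (cong (λ z → δ (+ z)) (ℕₚ.+-comm n 1))))))
  pt -[1+ 0 ] = trans (*-identityˡ (v 0ℤ)) (sym (trans (+-identityʳ _) (*-identityˡ (v 0ℤ))))
  pt -[1+ suc n ] = trans (cong (sgn (-[1+ suc n ] + 1ℤ) *_) (negative D n)) (trans (*-zeroʳ (sgn (-[1+ suc n ] + 1ℤ)))
    (sym (trans (+-identityˡ _) (trans (cong (-1ℤ *_) (*-zeroʳ (sgn -[1+ suc n ]))) refl))))

alternating-nonneg : ∀ {v} (D : Decreasing v) → 0ℤ ≤ alternating v (finite D)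
alternating-nonneg D = ≤-trans (i≤j⇒0≤j-i (descent D 0)) (alternating-≥ D)

alternating-≤ : ∀ {v} (D : Decreasing v) → alternating v (finite D) ≤ v 0ℤ
alternating-≤ {v} D = subst (_≤ v 0ℤ) (sym (alternating-tail D)) (≤-from (e (v 0ℤ) _) (alternating-nonneg (tail-decreasing D)))
  where
  e : ∀ a b → a - (a - b) ≡ b
  e = solve-∀

-- The lower bound `alternating-≥` applied to the tail that starts at `v 1ℤ`, with the sign
-- reversed.
alternating-≤₃ : ∀ {v} (D : Decreasing v) → alternating v (finite D) ≤ v 0ℤ - v 1ℤ + v (+ 2)
alternating-≤₃ {v} D = subst (_≤ v 0ℤ - v 1ℤ + v (+ 2)) (sym (alternating-tail D))
  (≤-from (e (v 0ℤ) (v 1ℤ) (v (+ 2)) _) (i≤j⇒0≤j-i (subst (_≤ alternating (tail v) (finite (tail-decreasing D)))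
     (cong₂ _-_ (*-identityˡ (v 1ℤ)) (*-identityˡ (v (+ 2)))) (alternating-≥ (tail-decreasing D)))))
  where
  e : ∀ a b c t → a - b + c - (a - t) ≡ t - (b - c)
  e = solve-∀

-- Monotonicity and vanishing of `P₉`

P₉-nonneg : ∀ y → 0ℤ ≤ P₉ y
P₉-nonneg y = *-nonneg ([]-nonneg (y %ℕ 9) 0) (P-nonneg (y /ℕ 9))
  where
  []-nonneg : ∀ m n → 0ℤ ≤ [ m ≟ n ]
  []-nonneg m n with m ℕ.≟ n
  ... | yes _ = +-≥0 1
  ... | no _  = +-≥0 0

-- The lag 18 is 9 times the lag 2 in which `P` is monotone; it preserves the residue modulo 9.
P₉-step : ∀ y → P₉ (y - + 18) ≤ P₉ y
P₉-step y = subst₂ _≤_ (sym (trans (cong P₉ (trans (cong (_- + 18) (a≡a%ℕn+[a/ℕn]*n y 9)) (e (+ (y %ℕ 9)) (y /ℕ 9)))) (P₉-at (y %ℕ 9) (y /ℕ 9 - + 2) (n%ℕd<d y 9)))) refl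
  (scale (y %ℕ 9))
  where
  e : ∀ r q → r + q * + 9 - + 18 ≡ r + (q - + 2) * + 9
  e = solve-∀
  scale : ∀ r → [ r ≟ 0 ] * P (y /ℕ 9 - + 2) ≤ [ r ≟ 0 ] * P (y /ℕ 9)
  scale 0       = subst₂ _≤_ (sym (*-identityˡ _)) (sym (*-identityˡ _)) (P-monotone (y /ℕ 9))
  scale (suc r) = ≤-refl

P₉-18 : ∀ m → P₉ (+ 18 * m) ≡ p m
P₉-18 m = trans (cong P₉ (e m)) (trans (P₉-at 0 (+ 2 * m) (s≤s z≤n)) (*-identityˡ (p m)))
  where
  e : ∀ m → + 18 * m ≡ + 0 + + 2 * m * + 9
  e = solve-∀

3∤_ : ℤ → Set
3∤ y = Σ ℤ λ z → y ≡ + 3 * z + 1ℤ ⊎ y ≡ + 3 * z + + 2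

3∤-+ : ∀ y k → 3∤ y → 3∤ (y + + 3 * k)
3∤-+ _ k (z , inj₁ refl) = z + k , inj₁ (e z k)
  where
  e : ∀ z k → + 3 * z + 1ℤ + + 3 * k ≡ + 3 * (z + k) + 1ℤ
  e = solve-∀
3∤-+ _ k (z , inj₂ refl) = z + k , inj₂ (e z k)
  where
  e : ∀ z k → + 3 * z + + 2 + + 3 * k ≡ + 3 * (z + k) + + 2
  e = solve-∀

3∤-double : ∀ y → 3∤ y → 3∤ (+ 2 * y)
3∤-double _ (z , inj₁ refl) = + 2 * z , inj₂ (e z)
  where
  e : ∀ z → + 2 * (+ 3 * z + 1ℤ) ≡ + 3 * (+ 2 * z) + + 2
  e = solve-∀
3∤-double _ (z , inj₂ refl) = + 2 * z + 1ℤ , inj₁ (e z)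
  where
  e : ∀ z → + 2 * (+ 3 * z + + 2) ≡ + 3 * (+ 2 * z + 1ℤ) + 1ℤ
  e = solve-∀

3∤-gap : ∀ t s → t ℕ.≤ 2 → s ℕ.≤ 2 → s ≢ t → 3∤ (+ t - + s)
3∤-gap 0 0 _ _ n = ⊥-elim (n refl)
3∤-gap 0 1 _ _ _ = -1ℤ , inj₂ refl
3∤-gap 0 2 _ _ _ = -1ℤ , inj₁ refl
3∤-gap 1 0 _ _ _ = 0ℤ , inj₁ refl
3∤-gap 1 1 _ _ n = ⊥-elim (n refl)
3∤-gap 1 2 _ _ _ = -1ℤ , inj₂ refl
3∤-gap 2 0 _ _ _ = 0ℤ , inj₂ refl
3∤-gap 2 1 _ _ _ = 0ℤ , inj₁ refl
3∤-gap 2 2 _ _ n = ⊥-elim (n refl)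
3∤-gap (suc (suc (suc _))) _ (s≤s (s≤s ())) _ _
3∤-gap 0 (suc (suc (suc _))) _ (s≤s (s≤s ())) _
3∤-gap 1 (suc (suc (suc _))) _ (s≤s (s≤s ())) _
3∤-gap 2 (suc (suc (suc _))) _ (s≤s (s≤s ())) _

P₉-∤ : ∀ y → 3∤ y → P₉ y ≡ 0ℤ
P₉-∤ _ (z , inj₁ refl) = go z (mod3 z)
  where
  e₀ : ∀ q → + 3 * (+ 0 + q * + 3) + 1ℤ ≡ + 1 + q * + 9
  e₀ = solve-∀
  e₁ : ∀ q → + 3 * (+ 1 + q * + 3) + 1ℤ ≡ + 4 + q * + 9
  e₁ = solve-∀
  e₂ : ∀ q → + 3 * (+ 2 + q * + 3) + 1ℤ ≡ + 7 + q * + 9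
  e₂ = solve-∀
  go : ∀ z → Mod3 z → P₉ (+ 3 * z + 1ℤ) ≡ 0ℤ
  go _ (mod0 q) = trans (cong P₉ (e₀ q)) (P₉-at 1 q (ℕₚ.m≤m+n 2 7))
  go _ (mod1 q) = trans (cong P₉ (e₁ q)) (P₉-at 4 q (ℕₚ.m≤m+n 5 4))
  go _ (mod2 q) = trans (cong P₉ (e₂ q)) (P₉-at 7 q (ℕₚ.m≤m+n 8 1))
P₉-∤ _ (z , inj₂ refl) = go z (mod3 z)
  where
  e₀ : ∀ q → + 3 * (+ 0 + q * + 3) + + 2 ≡ + 2 + q * + 9
  e₀ = solve-∀
  e₁ : ∀ q → + 3 * (+ 1 + q * + 3) + + 2 ≡ + 5 + q * + 9
  e₁ = solve-∀
  e₂ : ∀ q → + 3 * (+ 2 + q * + 3) + + 2 ≡ + 8 + q * + 9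
  e₂ = solve-∀
  go : ∀ z → Mod3 z → P₉ (+ 3 * z + + 2) ≡ 0ℤ
  go _ (mod0 q) = trans (cong P₉ (e₀ q)) (P₉-at 2 q (ℕₚ.m≤m+n 3 6))
  go _ (mod1 q) = trans (cong P₉ (e₁ q)) (P₉-at 5 q (ℕₚ.m≤m+n 6 3))
  go _ (mod2 q) = trans (cong P₉ (e₂ q)) (P₉-at 8 q ℕₚ.≤-refl)

module Q = Progression P₉ P₉-nonneg P₉-supp
module R = Progression p p-nonneg p-supp

-- Families of progressions indexed by r

-- `g` = 0 and `g` = 1 give the differences `6(3r+1)` and `6(3r+2)` that the two exponents of `G`
-- have once `v` is confined to a class modulo 3. `c` and `e` record where that class starts.
module Family (c e g : ℕ) (X : ℤ) where

  start : ℕ → ℤ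
  start r = + 3 * (+ r * (+ r + 1ℤ)) + + 6 * (+ c * + r + + e)

  abstract
    fam : ℤ → ℤ
    fam (+ r)    = Q.ap (start r) (6 ℕ.* suc (3 ℕ.* r ℕ.+ g)) X
    fam -[1+ _ ] = 0ℤ

    fam-+ : ∀ r → fam (+ r) ≡ Q.ap (start r) (6 ℕ.* suc (3 ℕ.* r ℕ.+ g)) X
    fam-+ r = refl

    fam-- : ∀ r → fam -[1+ r ] ≡ 0ℤ
    fam-- r = refl

    fam-nonneg : ∀ i → 0ℤ ≤ fam i
    fam-nonneg (+ r)    = Q.ap-nonneg (start r) (6 ℕ.* suc (3 ℕ.* r ℕ.+ g)) X
    fam-nonneg -[1+ _ ] = +-≥0 0

  fam-negative : ∀ i → 0ℤ ≤ -1ℤ - i → fam i ≡ 0ℤ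
  fam-negative (+ 0)     ()
  fam-negative (+ suc n) ()
  fam-negative -[1+ n ]  _ = fam-- n

  fam-fs : FinSupp fam
  fam-fs = fs-bounded X w
    where
    e₁ : ∀ x r c e → x - r ≡ x - (+ 3 * (r * (r + 1ℤ)) + + 6 * (c * r + e)) + (+ 3 * (r * r) + + 2 * r + + 6 * (c * r + e))
    e₁ = solve-∀
    below : ∀ r → start r ≤ X → + r ≤ X
    below r l = ≤-from (e₁ X (+ r) (+ c) (+ e)) (+-nonneg (i≤j⇒0≤j-i l)
        (+-nonneg (+-nonneg (*-nonneg (+-≥0 3) (*-nonneg (+-≥0 r) (+-≥0 r))) (*-nonneg (+-≥0 2) (+-≥0 r)))
          (*-nonneg (+-≥0 6) (+-nonneg (*-nonneg (+-≥0 c) (+-≥0 r)) (+-≥0 e)))))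
    w : ∀ i → fam i ≡ 0ℤ ⊎ + ∣ i ∣ ≤ X
    w -[1+ n ] = inj₁ (fam-- n)
    w (+ r)    = Sum.map (trans (fam-+ r)) (below r) (Q.ap-supp (start r) (6 ℕ.* suc (3 ℕ.* r ℕ.+ g)) X)

  start-+3 : ∀ r → start (r ℕ.+ 3) ≡ start r + + 18 * + (r ℕ.+ 2 ℕ.+ c)
  start-+3 r = trans (cong (λ z → + 3 * (z * (z + 1ℤ)) + + 6 * (+ c * z + + e)) (pos-+ r 3))
    (trans (e₁ (+ r) (+ c) (+ e)) (cong (λ z → start r + + 18 * z) (sym (trans (pos-+ (r ℕ.+ 2) c) (cong (_+ + c) (pos-+ r 2))))))
    where
    e₁ : ∀ r c e → + 3 * ((r + + 3) * (r + + 3 + 1ℤ)) + + 6 * (c * (r + + 3) + e) ≡ + 3 * (r * (r + 1ℤ)) + + 6 * (c * r + e) + + 18 * (r + + 2 + c)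
    e₁ = solve-∀

  -- From `r` to `r + 3` the start moves by `18 (r + 2 + c)` and the difference by 54, both
  -- multiples of the lag 18 of `P₉-step`. A single step in `r` moves the start by `6 (r + 1 + c)`,
  -- in general not a multiple of 18.
  fam-descent : ∀ i → 0ℤ ≤ i → fam (i + + 3) ≤ fam i
  fam-descent (+ r) _ = subst₂ _≤_ (sym (fam-+ (r ℕ.+ 3))) (sym (fam-+ r))
      (Q.ap-≤ 18 P₉-step {start r} {start (r ℕ.+ 3)} {d} {d′} (r ℕ.+ 2 ℕ.+ c) 3 (start-+3 r) d′≡ X)
    where
    d  = 6 ℕ.* suc (3 ℕ.* r ℕ.+ g)
    d′ = 6 ℕ.* suc (3 ℕ.* (r ℕ.+ 3) ℕ.+ g)
    e₂ : ∀ r g → 6 ℕ.* suc (3 ℕ.* (r ℕ.+ 3) ℕ.+ g) ≡ 6 ℕ.* suc (3 ℕ.* r ℕ.+ g) ℕ.+ 54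
    e₂ = ℕ-solve-∀
    d′≡ : + d′ ≡ + d + + 54
    d′≡ = trans (cong +_ (e₂ r g)) (pos-+ d 54)

  branch : ℕ → ℤ → ℤ
  branch s i = fam (+ 3 * i + + s)

  branch-decreasing : ∀ s → s ℕ.≤ 2 → Decreasing (branch s)
  branch-decreasing s l = record
    { finite   = fs-affine (+ 3) (+ s) fam-fs
    ; negative = λ n → fam-negative (+ 3 * -[1+ n ] + + s)
        (subst (0ℤ ≤_) (sym (e₁ (+ n) (+ s))) (+-nonneg (i≤j⇒0≤j-i {+ s} {+ 2} (+≤+ l)) (*-nonneg {+ 3} {+ n} (+-≥0 3) (+-≥0 n))))
    ; nonneg   = λ n → fam-nonneg (+ 3 * + n + + s)
    ; descent  = λ n → subst (λ z → fam z ≤ fam (+ 3 * + n + + s)) (e₂ (+ n) (+ s))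
        (fam-descent (+ 3 * + n + + s) (+-nonneg (*-nonneg {+ 3} {+ n} (+-≥0 3) (+-≥0 n)) (+-≥0 s)))
    }
    where
    e₁ : ∀ n s → -1ℤ - (+ 3 * - (1ℤ + n) + s) ≡ + 2 - s + + 3 * n
    e₁ = solve-∀
    e₂ : ∀ n s → + 3 * n + s + + 3 ≡ + 3 * (1ℤ + n) + s
    e₂ = solve-∀

  D₀ = branch-decreasing 0 z≤n
  D₁ = branch-decreasing 1 (s≤s z≤n)
  D₂ = branch-decreasing 2 ℕₚ.≤-refl

  alt₀ alt₁ alt₂ : ℤ
  alt₀ = alternating (branch 0) (Decreasing.finite D₀)
  alt₁ = alternating (branch 1) (Decreasing.finite D₁)
  alt₂ = alternating (branch 2) (Decreasing.finite D₂)

  twist-fs : ∀ w₀ w₁ w₂ → FinSupp (λ r → cyc w₀ w₁ w₂ r * (sgn r * fam r))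
  twist-fs w₀ w₁ w₂ = fs-* (cyc w₀ w₁ w₂) (fs-* sgn fam-fs)

  -- Along `r = 3i + s` the period-3 weight is constant and `(-1)^r` is `(-1)^(i+s)`; hence the
  -- minus sign at `w₁` alone, and three alternating sums of decreasing sequences.
  twist : ∀ w₀ w₁ w₂ → ∑ (λ r → cyc w₀ w₁ w₂ r * (sgn r * fam r)) (twist-fs w₀ w₁ w₂) ≡ w₀ * alt₀ + (- w₁ * alt₁ + w₂ * alt₂)
  twist w₀ w₁ w₂ = trans (∑-split3 (twist-fs w₀ w₁ w₂) (q 0ℤ) (q 1ℤ) (q (+ 2)))
    (cong₂ _+_ (class 0 w₀ D₀ (q 0ℤ) c₀) (cong₂ _+_ (class 1 (- w₁) D₁ (q 1ℤ) c₁) (class 2 w₂ D₂ (q (+ 2)) c₂)))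
    where
    q : ∀ s → FinSupp (λ i → cyc w₀ w₁ w₂ (+ 3 * i + s) * (sgn (+ 3 * i + s) * fam (+ 3 * i + s)))
    q s = fs-affine (+ 3) s (twist-fs w₀ w₁ w₂)
    class : ∀ s w (D : Decreasing (branch s)) q → (∀ i → cyc w₀ w₁ w₂ (+ 3 * i + + s) * (sgn (+ 3 * i + + s) * fam (+ 3 * i + + s)) ≡ w * (sgn i * branch s i)) →
            ∑ (λ i → cyc w₀ w₁ w₂ (+ 3 * i + + s) * (sgn (+ 3 * i + + s) * fam (+ 3 * i + + s))) q ≡ w * alternating (branch s) (Decreasing.finite D)
    class s w D q eq = trans (∑-cong q (fs-* (λ _ → w) (fs-* sgn (Decreasing.finite D))) eq)
      (∑-* w (fs-* sgn (Decreasing.finite D)) (fs-* (λ _ → w) (fs-* sgn (Decreasing.finite D))))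
    form : ∀ i s → + 3 * i + s ≡ s + i * + 3
    form = solve-∀
    neg-out : ∀ w s a → w * (- s * a) ≡ - w * (s * a)
    neg-out = solve-∀
    f₀ : ∀ i → + 3 * i + 0ℤ ≡ i + (i + i)
    f₀ = solve-∀
    f₁ : ∀ i → + 3 * i + 1ℤ ≡ i + 1ℤ + (i + i)
    f₁ = solve-∀
    f₂ : ∀ i → + 3 * i + + 2 ≡ i + ((i + 1ℤ) + (i + 1ℤ))
    f₂ = solve-∀
    c₀ : ∀ i → cyc w₀ w₁ w₂ (+ 3 * i + 0ℤ) * (sgn (+ 3 * i + 0ℤ) * fam (+ 3 * i + 0ℤ)) ≡ w₀ * (sgn i * branch 0 i)
    c₀ i = cong₂ (λ a b → a * (b * branch 0 i)) (trans (cong (cyc w₀ w₁ w₂) (form i 0ℤ)) (cyc-0 w₀ w₁ w₂ i)) (sgn-mod2 (+ 3 * i + 0ℤ) i i (f₀ i))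
    c₁ : ∀ i → cyc w₀ w₁ w₂ (+ 3 * i + 1ℤ) * (sgn (+ 3 * i + 1ℤ) * fam (+ 3 * i + 1ℤ)) ≡ - w₁ * (sgn i * branch 1 i)
    c₁ i = trans (cong₂ (λ a b → a * (b * branch 1 i)) (trans (cong (cyc w₀ w₁ w₂) (form i 1ℤ)) (cyc-1 w₀ w₁ w₂ i)) (sgn-odd (+ 3 * i + 1ℤ) i i (f₁ i))) (neg-out w₁ (sgn i) (branch 1 i))
    c₂ : ∀ i → cyc w₀ w₁ w₂ (+ 3 * i + + 2) * (sgn (+ 3 * i + + 2) * fam (+ 3 * i + + 2)) ≡ w₂ * (sgn i * branch 2 i)
    c₂ i = cong₂ (λ a b → a * (b * branch 2 i)) (trans (cong (cyc w₀ w₁ w₂) (form i (+ 2))) (cyc-2 w₀ w₁ w₂ i)) (sgn-mod2 (+ 3 * i + + 2) i (i + 1ℤ) (f₂ i))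

-- The double sum for C, one residue class of v at a time

class-sum : ∀ r a d .{{_ : NonZero d}} .{{_ : NonZero (3 ℕ.* d)}} x q → ∑ (λ v → ω (r + v) * Q.ap-term a d x v) q ≡
            ω (r + 0ℤ) * Q.ap (a + + d * 0ℤ) (3 ℕ.* d) x + (ω (r + 1ℤ) * Q.ap (a + + d * 1ℤ) (3 ℕ.* d) x + ω (r + + 2) * Q.ap (a + + d * + 2) (3 ℕ.* d) x)
class-sum r a d x q = trans (∑-split3 {λ v → ω (r + v) * Q.ap-term a d x v} q (q′ 0ℤ) (q′ 1ℤ) (q′ (+ 2)))
  (cong₂ _+_ (one-class 0ℤ 0 refl z≤n) (cong₂ _+_ (one-class 1ℤ 1 refl (s≤s z≤n)) (one-class (+ 2) 2 refl ℕₚ.≤-refl)))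
  where
  q′ : ∀ s → FinSupp (λ i → ω (r + (+ 3 * i + s)) * Q.ap-term a d x (+ 3 * i + s))
  q′ s = fs-affine (+ 3) s {λ v → ω (r + v) * Q.ap-term a d x v} q
  e : ∀ r i s → r + (+ 3 * i + s) ≡ r + s + i * + 3
  e = solve-∀
  one-class : ∀ s n → s ≡ + n → n ℕ.≤ 2 → ∑ (λ i → ω (r + (+ 3 * i + s)) * Q.ap-term a d x (+ 3 * i + s)) (q′ s) ≡ ω (r + s) * Q.ap (a + + d * s) (3 ℕ.* d) x
  one-class _ s refl l = trans
    (∑-cong (q′ (+ s)) cq pt)
    (trans (∑-* (ω (r + + s)) (Q.ap-fs (a + + d * + s) (3 ℕ.* d) x) cq) (cong (ω (r + + s) *_) (sym (Q.ap-def (a + + d * + s) (3 ℕ.* d) x))))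
    where
    pt : ∀ i → ω (r + (+ 3 * i + + s)) * Q.ap-term a d x (+ 3 * i + + s) ≡ ω (r + + s) * Q.ap-term (a + + d * + s) (3 ℕ.* d) x i
    pt i = cong₂ _*_ (trans (cong ω (e r i (+ s))) (cyc-periodic 1ℤ 1ℤ (- + 2) (r + + s) i)) (Q.ap-class a d 2 s l x i)
    cq : FinSupp (λ i → ω (r + + s) * Q.ap-term (a + + d * + s) (3 ℕ.* d) x i)
    cq = fs-* (λ _ → ω (r + + s)) (Q.ap-fs (a + + d * + s) (3 ℕ.* d) x)

ap-translate : ∀ a a′ d d′ .{{_ : NonZero d}} .{{_ : NonZero d′}} x x′ → (∀ j → x - (a + + d * j) ≡ x′ - (a′ + + d′ * j)) → Q.ap a d x ≡ Q.ap a′ d′ x′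
ap-translate a a′ d d′ x x′ e = trans (Q.ap-def a d x)
  (trans (∑-cong (Q.ap-fs a d x) (Q.ap-fs a′ d′ x′) (λ j → cong (λ z → pos j * P₉ z) (e j))) (sym (Q.ap-def a′ d′ x′)))

ap-vanish : ∀ a d .{{_ : NonZero d}} x → (∀ j → P₉ (x - (a + + d * j)) ≡ 0ℤ) → Q.ap a d x ≡ 0ℤ
ap-vanish a d x e = trans (Q.ap-def a d x) (∑-zero (Q.ap-fs a d x) (λ j → trans (cong (pos j *_) (e j)) (*-zeroʳ (pos j))))

ap-class-shift : ∀ a b c d d′ .{{_ : NonZero (3 ℕ.* d)}} .{{_ : NonZero d′}} x y s → + d ≡ + 2 * c → + d′ ≡ + 6 * c →
                 x - (a + + 2 * c * s) ≡ y - b → Q.ap (a + + d * s) (3 ℕ.* d) x ≡ Q.ap b d′ y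
ap-class-shift a b c d d′ x y s dc dc′ eq = ap-translate (a + + d * s) b (3 ℕ.* d) d′ x y λ j →
    trans (cong₂ (λ u v → x - (a + u * s + v * j)) dc (trans (pos-* 3 d) (cong (+ 3 *_) dc)))
      (trans (e x a c s j) (trans (cong (_- + 6 * c * j) eq) (trans (f y b (+ 6 * c * j)) (cong (λ z → y - (b + z * j)) (sym dc′)))))
  where
  e : ∀ x a c s j → x - (a + + 2 * c * s + + 3 * (+ 2 * c) * j) ≡ x - (a + + 2 * c * s) - + 6 * c * j
  e = solve-∀
  f : ∀ y b z → y - b - z ≡ y - (b + z)
  f = solve-∀

ap-class-vanish : ∀ a c d .{{_ : NonZero (3 ℕ.* d)}} x s → + d ≡ + 2 * c → 3∤ (x - (a + + 2 * c * s)) → Q.ap (a + + d * s) (3 ℕ.* d) x ≡ 0ℤ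
ap-class-vanish a c d x s dc h = ap-vanish (a + + d * s) (3 ℕ.* d) x λ j →
    P₉-∤ (x - (a + + d * s + + (3 ℕ.* d) * j)) (subst 3∤_ (sym (trans (cong₂ (λ u v → x - (a + u * s + v * j)) dc (trans (pos-* 3 d) (cong (+ 3 *_) dc))) (e x a c s j)))
      (3∤-+ (x - (a + + 2 * c * s)) (- (+ 2 * c * j)) h))
  where
  e : ∀ x a c s j → x - (a + + 2 * c * s + + 3 * (+ 2 * c) * j) ≡ x - (a + + 2 * c * s) + + 3 * (- (+ 2 * c * j))
  e = solve-∀

ω-translate : ∀ {a b c} t → ω (+ 0 + + t) ≡ a → ω (+ 1 + + t) ≡ b → ω (+ 2 + + t) ≡ c → ∀ r → ω (r + + t) ≡ cyc a b c r
ω-translate {a} {b} {c} t ea eb ec r = go r (mod3 r)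
  where
  e : ∀ s q t → s + q * + 3 + t ≡ s + t + q * + 3
  e = solve-∀
  move : ∀ s q → ω (s + q * + 3 + + t) ≡ ω (s + + t)
  move s q = trans (cong ω (e s q (+ t))) (cyc-periodic 1ℤ 1ℤ (- + 2) (s + + t) q)
  go : ∀ r → Mod3 r → ω (r + + t) ≡ cyc a b c r
  go _ (mod0 q) = trans (move (+ 0) q) (trans ea (sym (cyc-0 a b c q)))
  go _ (mod1 q) = trans (move (+ 1) q) (trans eb (sym (cyc-1 a b c q)))
  go _ (mod2 q) = trans (move (+ 2) q) (trans ec (sym (cyc-2 a b c q)))

sum-at : ∀ t → t ℕ.≤ 2 → (w g : ℤ → ℤ) → (∀ s → s ℕ.≤ 2 → s ≢ t → g (+ s) ≡ 0ℤ) → w 0ℤ * g 0ℤ + (w 1ℤ * g 1ℤ + w (+ 2) * g (+ 2)) ≡ w (+ t) * g (+ t)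
sum-at t l w g z = go t l z
  where
  drop : ∀ s → g (+ s) ≡ 0ℤ → w (+ s) * g (+ s) ≡ 0ℤ
  drop s h = trans (cong (w (+ s) *_) h) (*-zeroʳ (w (+ s)))
  go : ∀ t → t ℕ.≤ 2 → (∀ s → s ℕ.≤ 2 → s ≢ t → g (+ s) ≡ 0ℤ) → w 0ℤ * g 0ℤ + (w 1ℤ * g 1ℤ + w (+ 2) * g (+ 2)) ≡ w (+ t) * g (+ t)
  go 0 _ z = trans (cong (λ y → w 0ℤ * g 0ℤ + y) (cong₂ _+_ (drop 1 (z 1 (s≤s z≤n) (λ ()))) (drop 2 (z 2 ℕₚ.≤-refl (λ ()))))) (+-identityʳ (w 0ℤ * g 0ℤ))
  go 1 _ z = trans (cong₂ _+_ (drop 0 (z 0 z≤n (λ ()))) (cong (λ y → w 1ℤ * g 1ℤ + y) (drop 2 (z 2 ℕₚ.≤-refl (λ ())))))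
    (trans (+-identityˡ (w 1ℤ * g 1ℤ + 0ℤ)) (+-identityʳ (w 1ℤ * g 1ℤ)))
  go 2 _ z = trans (cong₂ _+_ (drop 0 (z 0 z≤n (λ ()))) (cong (λ y → y + w (+ 2) * g (+ 2)) (drop 1 (z 1 (s≤s z≤n) (λ ())))))
    (trans (+-identityˡ (0ℤ + w (+ 2) * g (+ 2))) (+-identityˡ (w (+ 2) * g (+ 2))))
  go (suc (suc (suc _))) (s≤s (s≤s ())) _

-- For fixed `r` the two exponents of `G` are arithmetic progressions in `v`. In the second, the
-- shift `v + 1` is absorbed into the start `a₂`.
module Rows (x : ℤ) (r : ℕ) where
  R′ = + r
  a₁ = + 3 * (R′ * (R′ + 1ℤ))
  a₂ = + 3 * (R′ * (R′ + 1ℤ)) + + 2 * (+ 3 * R′ + + 2)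
  d₁ = 2 ℕ.* suc (3 ℕ.* r ℕ.+ 0)
  d₂ = 2 ℕ.* suc (3 ℕ.* r ℕ.+ 1)

  d₁≡ : + d₁ ≡ + 2 * (+ 3 * R′ + 1ℤ)
  d₁≡ = trans (pos-* 2 (suc (3 ℕ.* r ℕ.+ 0))) (cong (+ 2 *_) (trans (cong (λ z → 1ℤ + (z + 0ℤ)) (pos-* 3 r)) (e R′)))
    where
    e : ∀ r → 1ℤ + (+ 3 * r + 0ℤ) ≡ + 3 * r + 1ℤ
    e = solve-∀

  d₂≡ : + d₂ ≡ + 2 * (+ 3 * R′ + + 2)
  d₂≡ = trans (pos-* 2 (suc (3 ℕ.* r ℕ.+ 1))) (cong (+ 2 *_) (trans (cong (λ z → 1ℤ + (z + 1ℤ)) (pos-* 3 r)) (e R′)))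
    where
    e : ∀ r → 1ℤ + (+ 3 * r + 1ℤ) ≡ + 3 * r + + 2
    e = solve-∀

  row-sum : ∑ (K-term P₉ P₉-supp x R′) (row (K-box P₉ P₉-supp x) R′) ≡
    sgn R′ * (ω (R′ + 0ℤ) * Q.ap (a₁ + + d₁ * 0ℤ) (3 ℕ.* d₁) x + (ω (R′ + 1ℤ) * Q.ap (a₁ + + d₁ * 1ℤ) (3 ℕ.* d₁) x + ω (R′ + + 2) * Q.ap (a₁ + + d₁ * + 2) (3 ℕ.* d₁) x))
    + sgn R′ * (ω (R′ + 0ℤ) * Q.ap (a₂ + + d₂ * 0ℤ) (3 ℕ.* d₂) x + (ω (R′ + 1ℤ) * Q.ap (a₂ + + d₂ * 1ℤ) (3 ℕ.* d₂) x + ω (R′ + + 2) * Q.ap (a₂ + + d₂ * + 2) (3 ℕ.* d₂) x))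
  row-sum = begin
    ∑ (K-term P₉ P₉-supp x R′) (row (K-box P₉ P₉-supp x) R′)
      ≡⟨ ∑-cong (row (K-box P₉ P₉-supp x) R′) (fs-+ (s q₁) (s q₂)) pt ⟩
    ∑ (λ v → sgn R′ * (ω (R′ + v) * Q.ap-term a₁ d₁ x v) + sgn R′ * (ω (R′ + v) * Q.ap-term a₂ d₂ x v)) (fs-+ (s q₁) (s q₂))
      ≡⟨ ∑-+ (s q₁) (s q₂) (fs-+ (s q₁) (s q₂)) ⟩
    ∑ (λ v → sgn R′ * (ω (R′ + v) * Q.ap-term a₁ d₁ x v)) (s q₁) + ∑ (λ v → sgn R′ * (ω (R′ + v) * Q.ap-term a₂ d₂ x v)) (s q₂)
      ≡⟨ cong₂ _+_ (trans (∑-* (sgn R′) q₁ (s q₁)) (cong (sgn R′ *_) (class-sum R′ a₁ d₁ x q₁)))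
                   (trans (∑-* (sgn R′) q₂ (s q₂)) (cong (sgn R′ *_) (class-sum R′ a₂ d₂ x q₂))) ⟩
    _ ∎
    where
    open ≡-Reasoning
    q₁ : FinSupp (λ v → ω (R′ + v) * Q.ap-term a₁ d₁ x v)
    q₁ = fs-* (λ v → ω (R′ + v)) (Q.ap-fs a₁ d₁ x)
    q₂ : FinSupp (λ v → ω (R′ + v) * Q.ap-term a₂ d₂ x v)
    q₂ = fs-* (λ v → ω (R′ + v)) (Q.ap-fs a₂ d₂ x)
    s : ∀ {h} → FinSupp h → FinSupp (λ v → sgn R′ * h v)
    s = fs-* (λ _ → sgn R′)
    dist : ∀ w t s a b → w * (1ℤ * (t * (s * (a + b)))) ≡ s * (w * (t * a)) + s * (w * (t * b))
    dist = solve-∀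
    e₂ : ∀ x r v → + 3 * (r * (r + 1ℤ)) + + 2 * (+ 3 * r + + 2) * (v + 1ℤ) ≡ + 3 * (r * (r + 1ℤ)) + + 2 * (+ 3 * r + + 2) + + 2 * (+ 3 * r + + 2) * v
    e₂ = solve-∀
    pt : ∀ v → K-term P₉ P₉-supp x R′ v ≡ sgn R′ * (ω (R′ + v) * Q.ap-term a₁ d₁ x v) + sgn R′ * (ω (R′ + v) * Q.ap-term a₂ d₂ x v)
    pt v = trans (K-term-def P₉ P₉-supp x R′ v) (trans (cong₂ (λ a b → ω (R′ + v) * (1ℤ * (pos v * (sgn R′ * (P₉ (x - a) + P₉ (x - b))))))
                   (cong (λ z → a₁ + z * v) (sym d₁≡)) (trans (e₂ x R′ v) (cong (λ z → a₂ + z * v) (sym d₂≡))))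
                 (dist (ω (R′ + v)) (pos v) (sgn R′) (P₉ (x - (a₁ + + d₁ * v))) (P₉ (x - (a₂ + + d₂ * v)))))

-- For n ≡ t (mod 3) only the residue class v ≡ t contributes in the first progression, and only v ≡ 2 - t in the second.
module Class (t s : ℕ) (t+s : t ℕ.+ s ≡ 2) (n : ℤ) where

  -- Subtracting `2t` from the exponents at `v = t` and `v = s` leaves `3r(r+1) + 6tr`, and, using
  -- `t = 2 - s`, `3r(r+1) + 6((s+1)r + s)`.
  module U = Family t 0 0 (+ 6 * n)
  module V = Family (suc s) s 1 (+ 6 * n)

  private
    x = + 6 * n + + 2 * + t

    t≤2 : t ℕ.≤ 2
    t≤2 = subst (t ℕ.≤_) t+s (ℕₚ.m≤m+n t s)

    s≤2 : s ℕ.≤ 2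
    s≤2 = subst (s ℕ.≤_) t+s (ℕₚ.m≤n+m s t)

    t≡ : + t ≡ + 2 - + s
    t≡ = trans (e (+ t) (+ s)) (cong (_- + s) (trans (sym (pos-+ t s)) (cong +_ t+s)))
      where
      e : ∀ t s → t ≡ t + s - s
      e = solve-∀

    6c : ∀ r g c → + (2 ℕ.* suc (3 ℕ.* r ℕ.+ g)) ≡ + 2 * c → + (6 ℕ.* suc (3 ℕ.* r ℕ.+ g)) ≡ + 6 * c
    6c r g c h = trans (cong +_ (e (suc (3 ℕ.* r ℕ.+ g)))) (trans (pos-* 3 (2 ℕ.* suc (3 ℕ.* r ℕ.+ g))) (trans (cong (+ 3 *_) h) (e′ c)))
      where
      e : ∀ k → 6 ℕ.* k ≡ 3 ℕ.* (2 ℕ.* k)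
      e = ℕ-solve-∀
      e′ : ∀ c → + 3 * (+ 2 * c) ≡ + 6 * c
      e′ = solve-∀

    module _ (r : ℕ) where
      open Rows x r

      u-hit : Q.ap (a₁ + + d₁ * + t) (3 ℕ.* d₁) x ≡ U.fam R′
      u-hit = trans (ap-class-shift a₁ (U.start r) (+ 3 * R′ + 1ℤ) d₁ (6 ℕ.* suc (3 ℕ.* r ℕ.+ 0)) x (+ 6 * n) (+ t) d₁≡ (6c r 0 (+ 3 * R′ + 1ℤ) d₁≡) (e (+ 6 * n) R′ (+ t))) (sym (U.fam-+ r))
        where
        e : ∀ n r t → n + + 2 * t - (+ 3 * (r * (r + 1ℤ)) + + 2 * (+ 3 * r + 1ℤ) * t) ≡ n - (+ 3 * (r * (r + 1ℤ)) + + 6 * (t * r + 0ℤ))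
        e = solve-∀

      u-miss : ∀ v → v ℕ.≤ 2 → v ≢ t → Q.ap (a₁ + + d₁ * + v) (3 ℕ.* d₁) x ≡ 0ℤ
      u-miss v l ne = ap-class-vanish a₁ (+ 3 * R′ + 1ℤ) d₁ x (+ v) d₁≡
          (subst 3∤_ (e n R′ (+ t) (+ v)) (3∤-+ (+ 2 * (+ t - + v)) (+ 2 * n - R′ * (R′ + 1ℤ) - + 2 * R′ * + v) (3∤-double (+ t - + v) (3∤-gap t v t≤2 l ne))))
        where
        e : ∀ n r t v → + 2 * (t - v) + + 3 * (+ 2 * n - r * (r + 1ℤ) - + 2 * r * v) ≡ + 6 * n + + 2 * t - (+ 3 * (r * (r + 1ℤ)) + + 2 * (+ 3 * r + 1ℤ) * v)
        e = solve-∀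

      v-hit : Q.ap (a₂ + + d₂ * + s) (3 ℕ.* d₂) x ≡ V.fam R′
      v-hit = trans (ap-class-shift a₂ (V.start r) (+ 3 * R′ + + 2) d₂ (6 ℕ.* suc (3 ℕ.* r ℕ.+ 1)) x (+ 6 * n) (+ s) d₂≡ (6c r 1 (+ 3 * R′ + + 2) d₂≡)
          (trans (cong (λ z → + 6 * n + + 2 * z - (a₂ + + 2 * (+ 3 * R′ + + 2) * + s)) t≡) (e (+ 6 * n) R′ (+ s)))) (sym (V.fam-+ r))
        where
        e : ∀ n r s → n + + 2 * (+ 2 - s) - (+ 3 * (r * (r + 1ℤ)) + + 2 * (+ 3 * r + + 2) + + 2 * (+ 3 * r + + 2) * s) ≡ n - (+ 3 * (r * (r + 1ℤ)) + + 6 * ((1ℤ + s) * r + s))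
        e = solve-∀

      v-miss : ∀ v → v ℕ.≤ 2 → v ≢ s → Q.ap (a₂ + + d₂ * + v) (3 ℕ.* d₂) x ≡ 0ℤ
      v-miss v l ne = ap-class-vanish a₂ (+ 3 * R′ + + 2) d₂ x (+ v) d₂≡
          (subst 3∤_ (trans (e n R′ (+ s) (+ v)) (cong (λ z → + 6 * n + + 2 * z - (a₂ + + 2 * (+ 3 * R′ + + 2) * + v)) (sym t≡)))
            (3∤-+ (+ 2 * (+ 2 * (+ s - + v))) (+ 2 * n - R′ * (R′ + 1ℤ) - + 2 * R′ - + 2 * R′ * + v - + 2 * + s) (3∤-double (+ 2 * (+ s - + v)) (3∤-double (+ s - + v) (3∤-gap s v s≤2 l ne)))))
        where
        e : ∀ n r s v → + 2 * (+ 2 * (s - v)) + + 3 * (+ 2 * n - r * (r + 1ℤ) - + 2 * r - + 2 * r * v - + 2 * s) ≡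
            + 6 * n + + 2 * (+ 2 - s) - (+ 3 * (r * (r + 1ℤ)) + + 2 * (+ 3 * r + + 2) + + 2 * (+ 3 * r + + 2) * v)
        e = solve-∀

  module _ {a₀ a₁ a₂ b₀ b₁ b₂ : ℤ} (ea₀ : ω (+ 0 + + t) ≡ a₀) (ea₁ : ω (+ 1 + + t) ≡ a₁) (ea₂ : ω (+ 2 + + t) ≡ a₂)
           (eb₀ : ω (+ 0 + + s) ≡ b₀) (eb₁ : ω (+ 1 + + s) ≡ b₁) (eb₂ : ω (+ 2 + + s) ≡ b₂) where

    private
      row-value : ∀ r → ∑ (K-term P₉ P₉-supp x r) (row (K-box P₉ P₉-supp x) r) ≡ cyc a₀ a₁ a₂ r * (sgn r * U.fam r) + cyc b₀ b₁ b₂ r * (sgn r * V.fam r)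
      row-value -[1+ r ] = trans (∑-zero (row (K-box P₉ P₉-supp x) -[1+ r ]) (λ v → trans (K-term-def P₉ P₉-supp x -[1+ r ] v) (*-zeroʳ (ω (-[1+ r ] + v)))))
          (sym (trans (cong₂ (λ a b → cyc a₀ a₁ a₂ -[1+ r ] * (sgn -[1+ r ] * a) + cyc b₀ b₁ b₂ -[1+ r ] * (sgn -[1+ r ] * b)) (U.fam-- r) (V.fam-- r))
            (zero (cyc a₀ a₁ a₂ -[1+ r ]) (cyc b₀ b₁ b₂ -[1+ r ]) (sgn -[1+ r ]))))
        where
        zero : ∀ a b s → a * (s * 0ℤ) + b * (s * 0ℤ) ≡ 0ℤ
        zero = solve-∀
      row-value (+ r) = trans row-sum (cong₂ _+_
          (trans (cong (sgn R′ *_) (trans (sum-at t t≤2 (λ v → ω (R′ + v)) (λ v → Q.ap (Row.a₁ + + d₁ * v) (3 ℕ.* d₁) x) (u-miss r))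
              (cong₂ _*_ (ω-translate t ea₀ ea₁ ea₂ R′) (u-hit r)))) (swap (sgn R′) (cyc a₀ a₁ a₂ R′) (U.fam R′)))
          (trans (cong (sgn R′ *_) (trans (sum-at s s≤2 (λ v → ω (R′ + v)) (λ v → Q.ap (Row.a₂ + + d₂ * v) (3 ℕ.* d₂) x) (v-miss r))
              (cong₂ _*_ (ω-translate s eb₀ eb₁ eb₂ R′) (v-hit r)))) (swap (sgn R′) (cyc b₀ b₁ b₂ R′) (V.fam R′))))
        where
        module Row = Rows x r
        open Row using (R′; d₁; d₂; row-sum)
        swap : ∀ s w a → s * (w * a) ≡ w * (s * a)
        swap = solve-∀

    C-value : C (+ 6 * n + + 2 * + t) ≡ a₀ * U.alt₀ + (- a₁ * U.alt₁ + a₂ * U.alt₂) + (b₀ * V.alt₀ + (- b₁ * V.alt₁ + b₂ * V.alt₂))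
    C-value = begin
      C x
        ≡⟨ C-formula x ⟩
      K P₉ P₉-supp x
        ≡⟨ ∑-cong (K-fs P₉ P₉-supp x) q row-value ⟩
      ∑ (λ r → cyc a₀ a₁ a₂ r * (sgn r * U.fam r) + cyc b₀ b₁ b₂ r * (sgn r * V.fam r)) q
        ≡⟨ ∑-+ (U.twist-fs a₀ a₁ a₂) (V.twist-fs b₀ b₁ b₂) q ⟩
      ∑ (λ r → cyc a₀ a₁ a₂ r * (sgn r * U.fam r)) (U.twist-fs a₀ a₁ a₂) + ∑ (λ r → cyc b₀ b₁ b₂ r * (sgn r * V.fam r)) (V.twist-fs b₀ b₁ b₂)
        ≡⟨ cong₂ _+_ (U.twist a₀ a₁ a₂) (V.twist b₀ b₁ b₂) ⟩
      _ ∎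
      where
      open ≡-Reasoning
      q = fs-+ (U.twist-fs a₀ a₁ a₂) (V.twist-fs b₀ b₁ b₂)

module Class₀ (n : ℤ) where
  open Class 0 2 refl n using (module U; module V) public

  -- The weights are `ω` at 0, 1, 2 for `U` and at 2, 3, 4 for `V`, with the middle one negated as
  -- in `twist`.
  C-value₀ : C (+ 6 * n) ≡ 1ℤ * U.alt₀ + (- 1ℤ * U.alt₁ + (- + 2) * U.alt₂) + ((- + 2) * V.alt₀ + (- 1ℤ * V.alt₁ + 1ℤ * V.alt₂))
  C-value₀ = trans (cong C (sym (+-identityʳ (+ 6 * n)))) (Class.C-value 0 2 refl n refl refl refl refl refl refl)

module Class₁ (n : ℤ) where
  open Class 1 1 refl n using (module U; module V) public

  -- The value -2 of `ω` falls on `r ≡ 1` in both families, where `twist` negates it, so all six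
  -- weights are positive. This is the class with the opposite inequality.
  C-value₁ : C (+ 6 * n + + 2) ≡ 1ℤ * U.alt₀ + (- (- + 2) * U.alt₁ + 1ℤ * U.alt₂) + (1ℤ * V.alt₀ + (- (- + 2) * V.alt₁ + 1ℤ * V.alt₂))
  C-value₁ = Class.C-value 1 1 refl n refl refl refl refl refl refl

module Class₂ (n : ℤ) where
  open Class 2 0 refl n using (module U; module V) public

  C-value₂ : C (+ 6 * n + + 4) ≡ (- + 2) * U.alt₀ + (- 1ℤ * U.alt₁ + 1ℤ * U.alt₂) + (1ℤ * V.alt₀ + (- 1ℤ * V.alt₁ + (- + 2) * V.alt₂))
  C-value₂ = Class.C-value 2 0 refl n refl refl refl refl refl refl

-- Passing from P₉ to p in a residue class

P₉-6 : ∀ w → P₉ (+ 6 + + 18 * w) ≡ 0ℤ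
P₉-6 w = trans (cong P₉ (e w)) (P₉-at 6 (+ 2 * w) (ℕₚ.m≤m+n 7 2))
  where
  e : ∀ w → + 6 + + 18 * w ≡ + 6 + + 2 * w * + 9
  e = solve-∀

P₉-12 : ∀ w → P₉ (+ 12 + + 18 * w) ≡ 0ℤ
P₉-12 w = trans (cong P₉ (e w)) (P₉-at 3 (1ℤ + + 2 * w) (ℕₚ.m≤m+n 4 5))
  where
  e : ∀ w → + 12 + + 18 * w ≡ + 3 + (1ℤ + + 2 * w) * + 9
  e = solve-∀

remainder : ℤ → ∀ d → .{{_ : NonZero d}} → ℤ → ℤ
remainder z d m = [ z %ℕ 3 ≟ 0 ] * R.ap (- (z /ℕ 3)) d m

module _ (a : ℤ) (d : ℕ) .{{_ : NonZero d}} .{{_ : NonZero (6 ℕ.* d)}} .{{_ : NonZero (3 ℕ.* (6 ℕ.* d))}} (ρ m : ℤ) where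

  private
    X = + 6 * (+ 3 * m + ρ)

    18d≡ : + (3 ℕ.* (6 ℕ.* d)) ≡ + 18 * + d
    18d≡ = trans (pos-* 3 (6 ℕ.* d)) (trans (cong (+ 3 *_) (pos-* 6 d)) (e (+ d)))
      where
      e : ∀ d → + 3 * (+ 6 * d) ≡ + 18 * d
      e = solve-∀

    -- A progression whose residue modulo 3 is r, where ρ - a - d t = r + 3 q.
    piece : ∀ t r q → r ℕ.< 3 → ρ - a - + d * t ≡ + r + q * + 3 →
            Q.ap (+ 6 * a + + (6 ℕ.* d) * t) (3 ℕ.* (6 ℕ.* d)) X ≡ [ r ≟ 0 ] * R.ap (- q) d m
    piece t r q l eq = go r l arg
      where
      e₁ : ∀ m ρ a d t j → + 6 * (+ 3 * m + ρ) - (+ 6 * a + + 6 * d * t + + 18 * d * j) ≡ + 18 * m + + 6 * (ρ - a - d * t) - + 18 * d * j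
      e₁ = solve-∀
      e₂ : ∀ m r q d j → + 18 * m + + 6 * (r + q * + 3) - + 18 * d * j ≡ + 6 * r + + 18 * (m - (- q + d * j))
      e₂ = solve-∀
      arg : ∀ j → X - (+ 6 * a + + (6 ℕ.* d) * t + + (3 ℕ.* (6 ℕ.* d)) * j) ≡ + 6 * + r + + 18 * (m - (- q + + d * j))
      arg j = trans (cong₂ (λ y z → X - (+ 6 * a + y * t + z * j)) (pos-* 6 d) 18d≡)
        (trans (e₁ m ρ a (+ d) t j) (trans (cong (λ z → + 18 * m + + 6 * z - + 18 * + d * j) eq) (e₂ m (+ r) q (+ d) j)))
      go : ∀ r → r ℕ.< 3 → (∀ j → X - (+ 6 * a + + (6 ℕ.* d) * t + + (3 ℕ.* (6 ℕ.* d)) * j) ≡ + 6 * + r + + 18 * (m - (- q + + d * j))) →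
           Q.ap (+ 6 * a + + (6 ℕ.* d) * t) (3 ℕ.* (6 ℕ.* d)) X ≡ [ r ≟ 0 ] * R.ap (- q) d m
      go 0 _ h = trans (trans (Q.ap-def (+ 6 * a + + (6 ℕ.* d) * t) (3 ℕ.* (6 ℕ.* d)) X) (∑-cong (Q.ap-fs (+ 6 * a + + (6 ℕ.* d) * t) (3 ℕ.* (6 ℕ.* d)) X) (R.ap-fs (- q) d m)
          (λ j → cong (pos j *_) (trans (cong P₉ (trans (h j) (+-identityˡ (+ 18 * (m - (- q + + d * j)))))) (P₉-18 (m - (- q + + d * j)))))))
        (trans (sym (R.ap-def (- q) d m)) (sym (*-identityˡ (R.ap (- q) d m))))
      go 1 _ h = ap-vanish (+ 6 * a + + (6 ℕ.* d) * t) (3 ℕ.* (6 ℕ.* d)) X (λ j → trans (cong P₉ (h j)) (P₉-6 (m - (- q + + d * j))))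
      go 2 _ h = ap-vanish (+ 6 * a + + (6 ℕ.* d) * t) (3 ℕ.* (6 ℕ.* d)) X (λ j → trans (cong P₉ (h j)) (P₉-12 (m - (- q + + d * j))))
      go (suc (suc (suc _))) (s≤s (s≤s (s≤s ()))) _

    piece′ : ∀ t → Q.ap (+ 6 * a + + (6 ℕ.* d) * t) (3 ℕ.* (6 ℕ.* d)) X ≡ remainder (ρ - a - + d * t) d m
    piece′ t = piece t (z %ℕ 3) (z /ℕ 3) (n%ℕd<d z 3) (a≡a%ℕn+[a/ℕn]*n z 3)
      where z = ρ - a - + d * t

  -- All arguments are multiples of 6, and `P₉` vanishes there except at multiples of 18. In each
  -- class of the index modulo 3 the residue is constant, so a class is either zero or a progression
  -- of `p` with the same difference `d`. When 3 does not divide `d`, exactly one class survives.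
  Q-to-R : Q.ap (+ 6 * a) (6 ℕ.* d) X ≡ remainder (ρ - a - + d * 0ℤ) d m + (remainder (ρ - a - + d * 1ℤ) d m + remainder (ρ - a - + d * + 2) d m)
  Q-to-R = trans (Q.ap-split3 (+ 6 * a) (6 ℕ.* d) X) (cong₂ _+_ (piece′ 0ℤ) (cong₂ _+_ (piece′ 1ℤ) (piece′ (+ 2))))

-- The subscript is the class of the index that survives in `Q-to-R`. At each use `ρ`, `a` and `d`
-- are numerals, so the indicators and the start evaluate.
only₀ : ∀ a → 1ℤ * a + (0ℤ + 0ℤ) ≡ a
only₀ = solve-∀

only₁ : ∀ a → 0ℤ + (1ℤ * a + 0ℤ) ≡ a
only₁ = solve-∀

only₂ : ∀ a → 0ℤ + (0ℤ + 1ℤ * a) ≡ a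
only₂ = solve-∀

-- Values of p

p-monotone⁺ : ∀ k m → p (m - + k) ≤ p m
p-monotone⁺ k m = subst (λ z → p (m - z) ≤ p m) (*-identityˡ (+ k)) (R.iterate-step 1 p-monotone k m)

p-positive : ∀ n → 1ℤ ≤ p (+ n)
p-positive 0       = ≤-reflexive (sym P-0)
p-positive (suc n) = ≤-trans (p-positive n) (p-monotone (+ suc n))

-- The excluded place is the equality `p(0) = p(1)`; at `n = 0` the gain is `p(-1) = 0`.
p-increment₁ : ∀ n → n ≢ 1 → p (+ n - 1ℤ) + 1ℤ ≤ p (+ n)
p-increment₁ 0             _  = subst (λ z → z + 1ℤ ≤ p 0ℤ) (sym (P-neg 1)) (p-positive 0)
p-increment₁ 1             ne = ⊥-elim (ne refl)
p-increment₁ (suc (suc n)) _  = p-strict n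

-- A lag of three steps over the equality `p(0) = p(1)`, so the increase is strict for every natural
-- number.
p-increment₃ : ∀ n → p (+ n - + 3) + 1ℤ ≤ p (+ n)
p-increment₃ 0 = subst (λ z → z + 1ℤ ≤ p 0ℤ) (sym (P-neg 5)) (p-positive 0)
p-increment₃ 1 = subst (λ z → z + 1ℤ ≤ p 1ℤ) (sym (P-neg 3)) (p-positive 1)
p-increment₃ n@(suc (suc k)) = ≤-trans (+-monoˡ-≤ 1ℤ (subst (λ z → p z ≤ p (+ n - 1ℤ)) (e (+ n)) (p-monotone⁺ 2 (+ n - 1ℤ)))) (p-strict k)
  where
  e : ∀ n → n - 1ℤ - + 2 ≡ n - + 3
  e = solve-∀

slack : ∀ {a b} → a ≤ b → 0ℤ ≤ b - a
slack = i≤j⇒0≤j-i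

2*-nonneg : ∀ {a} → 0ℤ ≤ a → 0ℤ ≤ + 2 * a
2*-nonneg = *-nonneg (+-≥0 2)

-- The class n ≡ 0 (mod 3)

module _ (n : ℤ) where
  open Class₀ n

  -- Negative weights take the two-term lower bound of the alternating sum. Of the positive ones,
  -- `V.alt₂` takes its first term, but `U.alt₀` takes three, because the subtracted `U.fam (+ 3)`
  -- is spent in the comparisons below.
  C₀-bound : C (+ 6 * n) ≤ (U.fam 0ℤ - U.fam (+ 3) + U.fam (+ 6)) - (U.fam 1ℤ - U.fam (+ 4)) - + 2 * (U.fam (+ 2) - U.fam (+ 5))
                           - + 2 * (V.fam 0ℤ - V.fam (+ 3)) - (V.fam 1ℤ - V.fam (+ 4)) + V.fam (+ 2)
  C₀-bound = ≤-from (trans (cong (λ z → b₀ - b₁ - + 2 * b₂ - + 2 * c₀ - c₁ + c₂ - z) C-value₀)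
                           (e U.alt₀ U.alt₁ U.alt₂ V.alt₀ V.alt₁ V.alt₂ b₀ b₁ b₂ c₀ c₁ c₂))
    (+-nonneg (+-nonneg (+-nonneg (slack (alternating-≤₃ U.D₀)) (slack (alternating-≥ U.D₁))) (2*-nonneg (slack (alternating-≥ U.D₂))))
              (+-nonneg (+-nonneg (2*-nonneg (slack (alternating-≥ V.D₀))) (slack (alternating-≥ V.D₁))) (slack (alternating-≤ V.D₂))))
    where
    b₀ = U.fam 0ℤ - U.fam (+ 3) + U.fam (+ 6)
    b₁ = U.fam 1ℤ - U.fam (+ 4)
    b₂ = U.fam (+ 2) - U.fam (+ 5)
    c₀ = V.fam 0ℤ - V.fam (+ 3)
    c₁ = V.fam 1ℤ - V.fam (+ 4)
    c₂ = V.fam (+ 2)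
    e : ∀ A₀ A₁ A₂ B₀ B₁ B₂ b₀ b₁ b₂ c₀ c₁ c₂ →
        b₀ - b₁ - + 2 * b₂ - + 2 * c₀ - c₁ + c₂ - (1ℤ * A₀ + (- 1ℤ * A₁ + (- + 2) * A₂) + ((- + 2) * B₀ + (- 1ℤ * B₁ + 1ℤ * B₂))) ≡
        (b₀ - A₀) + (A₁ - b₁) + + 2 * (A₂ - b₂) + (+ 2 * (B₀ - c₀) + (B₁ - c₁) + (c₂ - B₂))
    e = solve-∀

module Progressions (m : ℤ) where

  ap : ℕ → ∀ d → .{{_ : NonZero d}} → ℤ
  ap a d = R.ap (+ a) d m

  le : ∀ a d .{{_ : NonZero d}} a′ d′ .{{_ : NonZero d′}} u w → + a′ ≡ + a + 1ℤ * + u → + d′ ≡ + d + 1ℤ * + w → ap a′ d′ ≤ ap a d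
  le a d a′ d′ u w ea ed = R.ap-≤ 1 p-monotone {+ a} {+ a′} {d} {d′} u w ea ed m

  two : ∀ a d .{{_ : NonZero d}} .{{_ : NonZero (2 ℕ.* d)}} → ap a d ≡ R.ap (+ a + + d * 0ℤ) (2 ℕ.* d) m + R.ap (+ a + + d * 1ℤ) (2 ℕ.* d) m
  two a d = R.ap-split2 (+ a) d m

  three : ∀ a d .{{_ : NonZero d}} .{{_ : NonZero (3 ℕ.* d)}} → ap a d ≡ R.ap (+ a + + d * 0ℤ) (3 ℕ.* d) m + (R.ap (+ a + + d * 1ℤ) (3 ℕ.* d) m + R.ap (+ a + + d * + 2) (3 ℕ.* d) m)
  three a d = R.ap-split3 (+ a) d m

  peel : ∀ a d .{{_ : NonZero d}} → ap a d ≡ p (m - + a) + R.ap (+ a + + d) d m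
  peel a d = R.ap-peel (+ a) d m

module Zero₀ (m : ℤ) where

  private
    n = + 3 * m + 0ℤ
    module K = Class₀ n
    open Progressions m

    u₀ : K.U.fam 0ℤ ≡ ap 0 1
    u₀ = trans (K.U.fam-+ 0) (trans (Q-to-R 0ℤ 1 0ℤ m) (only₀ (ap 0 1)))
    u₁ : K.U.fam 1ℤ ≡ ap 3 4
    u₁ = trans (K.U.fam-+ 1) (trans (Q-to-R 1ℤ 4 0ℤ m) (only₂ (ap 3 4)))
    u₂ : K.U.fam (+ 2) ≡ ap 1 7
    u₂ = trans (K.U.fam-+ 2) (trans (Q-to-R (+ 3) 7 0ℤ m) (only₀ (ap 1 7)))
    u₃ : K.U.fam (+ 3) ≡ ap 2 10
    u₃ = trans (K.U.fam-+ 3) (trans (Q-to-R (+ 6) 10 0ℤ m) (only₀ (ap 2 10)))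
    u₄ : K.U.fam (+ 4) ≡ ap 12 13
    u₄ = trans (K.U.fam-+ 4) (trans (Q-to-R (+ 10) 13 0ℤ m) (only₂ (ap 12 13)))
    u₅ : K.U.fam (+ 5) ≡ ap 5 16
    u₅ = trans (K.U.fam-+ 5) (trans (Q-to-R (+ 15) 16 0ℤ m) (only₀ (ap 5 16)))
    u₆ : K.U.fam (+ 6) ≡ ap 7 19
    u₆ = trans (K.U.fam-+ 6) (trans (Q-to-R (+ 21) 19 0ℤ m) (only₀ (ap 7 19)))
    v₀ : K.V.fam 0ℤ ≡ ap 2 2
    v₀ = trans (K.V.fam-+ 0) (trans (Q-to-R (+ 2) 2 0ℤ m) (only₂ (ap 2 2)))
    v₁ : K.V.fam 1ℤ ≡ ap 2 5
    v₁ = trans (K.V.fam-+ 1) (trans (Q-to-R (+ 6) 5 0ℤ m) (only₀ (ap 2 5)))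
    v₂ : K.V.fam (+ 2) ≡ ap 9 8
    v₂ = trans (K.V.fam-+ 2) (trans (Q-to-R (+ 11) 8 0ℤ m) (only₂ (ap 9 8)))
    v₃ : K.V.fam (+ 3) ≡ ap 13 11
    v₃ = trans (K.V.fam-+ 3) (trans (Q-to-R (+ 17) 11 0ℤ m) (only₂ (ap 13 11)))
    v₄ : K.V.fam (+ 4) ≡ ap 8 14
    v₄ = trans (K.V.fam-+ 4) (trans (Q-to-R (+ 24) 14 0ℤ m) (only₀ (ap 8 14)))

    -- Halving twice, `ap 3 4` consists of the progressions of difference 16 from 3, 11, 7 and 15,
    -- and each dominates one term on the left. `ap 13 22` and `ap 24 22` are the halves of
    -- `V.fam (+ 3)`, which the bound contains twice: one copy is paid here, the other in `i₂`.
    i₁ : (ap 5 16 + ap 13 22) + (ap 7 19 + ap 24 22) ≤ ap 3 4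
    i₁ = ≤-trans (+-mono-≤ (+-mono-≤ (le 3 16 5 16 2 0 refl refl) (le 11 16 13 22 2 6 refl refl)) (+-mono-≤ (le 7 16 7 19 0 3 refl refl) (le 15 16 24 22 9 6 refl refl)))
      (≤-reflexive (sym (trans (two 3 4) (cong₂ _+_ (two 3 8) (two 7 8)))))

    -- The strict gain of this class: in the half of `ap 2 5` that starts at 2 the leading `p(m-2)`
    -- exceeds `p(m-5)`, the leading term of `ap 5 16`. The other half covers `ap 13 11`.
    i₂ : p (m - + 5) + 1ℤ ≤ p (m - + 2) → ap 5 16 + 1ℤ + (ap 13 22 + ap 24 22) ≤ ap 2 5
    i₂ h = ≤-trans (+-mono-≤ (≤-trans (≤-reflexive (trans (cong (_+ 1ℤ) (peel 5 16)) (e (p (m - + 5)) (ap 21 16))))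
        (≤-trans (+-mono-≤ h (le 12 10 21 16 9 6 refl refl)) (≤-reflexive (sym (peel 2 10))))) (≤-trans (≤-reflexive (sym (two 13 11))) (le 7 10 13 11 6 1 refl refl)))
      (≤-reflexive (sym (two 2 5)))
      where
      e : ∀ a b → a + b + 1ℤ ≡ a + 1ℤ + b
      e = solve-∀

    i₃ : p (m - 1ℤ) + ap 9 8 ≤ ap 1 7
    i₃ = ≤-trans (+-monoʳ-≤ (p (m - 1ℤ)) (le 8 7 9 8 1 1 refl refl)) (≤-reflexive (sym (peel 1 7)))

    i₄ : p (m - 1ℤ) + ap 8 14 ≤ ap 1 7
    i₄ = ≤-trans (+-monoʳ-≤ (p (m - 1ℤ)) (≤-trans (≤-+ʳ (R.ap-nonneg (+ 15) 14 m)) (≤-reflexive (sym (two 8 7))))) (≤-reflexive (sym (peel 1 7)))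

    i₅ : p (m - + 2) + ap 12 13 ≤ ap 2 10
    i₅ = ≤-trans (+-monoʳ-≤ (p (m - + 2)) (le 12 10 12 13 0 3 refl refl)) (≤-reflexive (sym (peel 2 10)))

    i₆ : ap 0 1 ≤ p (m - 0ℤ) + (p (m - 1ℤ) + (ap 2 2 + ap 2 2))
    i₆ = ≤-trans (≤-reflexive (trans (peel 0 1) (cong (λ z → p (m - 0ℤ) + z) (trans (peel 1 1) (cong (λ z → p (m - 1ℤ) + z) (two 2 1))))))
      (+-monoʳ-≤ (p (m - 0ℤ)) (+-monoʳ-≤ (p (m - 1ℤ)) (+-monoʳ-≤ (ap 2 2) (le 2 2 3 2 1 0 refl refl))))

  -- The slacks add up exactly to the negated bound minus 1. `i₆` leaves `p(m) + p(m-1)` uncovered,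
  -- while `i₃`, `i₄` and `i₅` set free `p(m-1)`, `p(m-1)` and `p(m-2)`; `h₁` closes the gap.
  C-negative : p (m - 0ℤ) ≤ p (m - 1ℤ) + p (m - + 2) → p (m - + 5) + 1ℤ ≤ p (m - + 2) → C (+ 6 * n) + 1ℤ ≤ 0ℤ
  C-negative h₁ h₂ = ≤-trans (+-monoˡ-≤ 1ℤ (C₀-bound n)) (≤-from
      (trans (cong (λ z → 0ℤ - (z + 1ℤ)) (cong₂ _+_ (cong₂ _-_ (cong₂ _-_ (cong₂ _-_ (cong₂ _-_ (cong₂ _+_ (cong₂ _-_ u₀ u₃) u₆) (cong₂ _-_ u₁ u₄)) (cong (+ 2 *_) (cong₂ _-_ u₂ u₅))) (cong (+ 2 *_) (cong₂ _-_ v₀ (trans v₃ (two 13 11))))) (cong₂ _-_ v₁ v₄)) v₂))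
             (e (ap 0 1) (ap 3 4) (ap 1 7) (ap 2 10) (ap 12 13) (ap 5 16) (ap 7 19) (ap 2 2) (ap 2 5) (ap 9 8) (ap 8 14) (ap 13 22) (ap 24 22) (p (m - 0ℤ)) (p (m - 1ℤ)) (p (m - + 2))))
      (+-nonneg (+-nonneg (+-nonneg (+-nonneg (+-nonneg (+-nonneg (slack i₁) (slack (i₂ h₂))) (slack i₃)) (slack i₄)) (slack i₅)) (slack i₆)) (slack h₁)))
    where
    e : ∀ u0 u1 u2 u3 u4 u5 u6 v0 v1 v2 v4 s t p0 p1 p2 → 0ℤ - ((u0 - u3 + u6) - (u1 - u4) - + 2 * (u2 - u5) - + 2 * (v0 - (s + t)) - (v1 - v4) + v2 + 1ℤ) ≡ (u1 - ((u5 + s) + (u6 + t))) + (v1 - (u5 + 1ℤ + (s + t))) + (u2 - (p1 + v2)) + (u2 - (p1 + v4)) + (u3 - (p2 + u4)) + (p0 + (p1 + (v0 + v0)) - u0) + (p1 + p2 - p0)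
    e = solve-∀

module Zero₁ (m : ℤ) where

  private
    n = + 3 * m + 1ℤ
    module K = Class₀ n
    open Progressions m

    u₀ : K.U.fam 0ℤ ≡ ap 0 1
    u₀ = trans (K.U.fam-+ 0) (trans (Q-to-R 0ℤ 1 1ℤ m) (only₁ (ap 0 1)))
    u₁ : K.U.fam 1ℤ ≡ ap 0 4
    u₁ = trans (K.U.fam-+ 1) (trans (Q-to-R 1ℤ 4 1ℤ m) (only₀ (ap 0 4)))
    u₂ : K.U.fam (+ 2) ≡ ap 3 7
    u₂ = trans (K.U.fam-+ 2) (trans (Q-to-R (+ 3) 7 1ℤ m) (only₁ (ap 3 7)))
    u₃ : K.U.fam (+ 3) ≡ ap 5 10
    u₃ = trans (K.U.fam-+ 3) (trans (Q-to-R (+ 6) 10 1ℤ m) (only₁ (ap 5 10)))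
    u₄ : K.U.fam (+ 4) ≡ ap 3 13
    u₄ = trans (K.U.fam-+ 4) (trans (Q-to-R (+ 10) 13 1ℤ m) (only₀ (ap 3 13)))
    u₅ : K.U.fam (+ 5) ≡ ap 10 16
    u₅ = trans (K.U.fam-+ 5) (trans (Q-to-R (+ 15) 16 1ℤ m) (only₁ (ap 10 16)))
    u₆ : K.U.fam (+ 6) ≡ ap 13 19
    u₆ = trans (K.U.fam-+ 6) (trans (Q-to-R (+ 21) 19 1ℤ m) (only₁ (ap 13 19)))
    v₀ : K.V.fam 0ℤ ≡ ap 1 2
    v₀ = trans (K.V.fam-+ 0) (trans (Q-to-R (+ 2) 2 1ℤ m) (only₁ (ap 1 2)))
    v₁ : K.V.fam 1ℤ ≡ ap 5 5
    v₁ = trans (K.V.fam-+ 1) (trans (Q-to-R (+ 6) 5 1ℤ m) (only₂ (ap 5 5)))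
    v₂ : K.V.fam (+ 2) ≡ ap 6 8
    v₂ = trans (K.V.fam-+ 2) (trans (Q-to-R (+ 11) 8 1ℤ m) (only₁ (ap 6 8)))
    v₃ : K.V.fam (+ 3) ≡ ap 9 11
    v₃ = trans (K.V.fam-+ 3) (trans (Q-to-R (+ 17) 11 1ℤ m) (only₁ (ap 9 11)))
    v₄ : K.V.fam (+ 4) ≡ ap 17 14
    v₄ = trans (K.V.fam-+ 4) (trans (Q-to-R (+ 24) 14 1ℤ m) (only₂ (ap 17 14)))

    -- After its first term, the two halves of `ap 0 4` each pay for one of the two copies of
    -- `V.fam (+ 3)`. The freed `p(m)` is used up by `i₂`.
    i₁ : p (m - 0ℤ) + (ap 9 11 + ap 9 11) ≤ ap 0 4
    i₁ = ≤-trans (+-monoʳ-≤ (p (m - 0ℤ)) (≤-trans (+-mono-≤ (le 4 8 9 11 5 3 refl refl) (le 8 8 9 11 1 3 refl refl)) (≤-reflexive (sym (two 4 4)))))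
      (≤-reflexive (sym (peel 0 4)))

    -- Past `p(m)` the terms of `ap 0 1` pair off: each even one is at most the preceding odd one.
    -- The first pair, `p(m-2)` against `p(m-1)`, supplies the strict gain.
    i₂ : p (m - + 2) + 1ℤ ≤ p (m - 1ℤ) → ap 0 1 + 1ℤ ≤ p (m - 0ℤ) + (ap 1 2 + ap 1 2)
    i₂ h = ≤-trans (≤-reflexive (trans (cong (_+ 1ℤ) (trans (peel 0 1) (cong (λ z → p (m - 0ℤ) + z) (trans (two 1 1) (cong (λ z → ap 1 2 + z) (peel 2 2))))))
        (e (p (m - 0ℤ)) (ap 1 2) (p (m - + 2)) (ap 4 2))))
      (+-monoʳ-≤ (p (m - 0ℤ)) (+-monoʳ-≤ (ap 1 2) (≤-trans (+-mono-≤ h (le 3 2 4 2 1 0 refl refl)) (≤-reflexive (sym (peel 1 2))))))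
      where
      e : ∀ a b c d → a + (b + (c + d)) + 1ℤ ≡ a + (b + (c + 1ℤ + d))
      e = solve-∀

    i₃ : ap 3 13 ≤ ap 3 7
    i₃ = le 3 7 3 13 0 6 refl refl

    i₄ : ap 6 8 ≤ ap 3 7
    i₄ = le 3 7 6 8 3 1 refl refl

    i₅ : p (m - + 5) + ap 17 14 ≤ ap 5 10
    i₅ = ≤-trans (+-monoʳ-≤ (p (m - + 5)) (le 15 10 17 14 2 4 refl refl)) (≤-reflexive (sym (peel 5 10)))

    -- The thirds of `ap 5 5` start at 5, 10 and 15, too late for the leading `p(m-13)` of
    -- `ap 13 19`. That term is covered by a `p(m-5)` borrowed from `i₅`.
    i₆ : ap 10 16 + (ap 10 16 + ap 13 19) ≤ ap 5 5 + p (m - + 5)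
    i₆ = ≤-trans (+-mono-≤ (le 5 15 10 16 5 1 refl refl) (+-mono-≤ (le 10 15 10 16 0 1 refl refl)
        (≤-trans (≤-reflexive (peel 13 19)) (+-mono-≤ (subst (λ z → p z ≤ p (m - + 5)) (e m) (p-monotone⁺ 8 (m - + 5))) (le 15 15 32 19 17 4 refl refl)))))
      (≤-reflexive (trans (e′ (ap 5 15) (ap 10 15) (p (m - + 5)) (ap 15 15)) (cong (_+ p (m - + 5)) (sym (three 5 5)))))
      where
      e : ∀ m → m - + 5 - + 8 ≡ m - + 13
      e = solve-∀
      e′ : ∀ a b q c → a + (b + (q + c)) ≡ a + (b + c) + q
      e′ = solve-∀

  C-negative : p (m - + 2) + 1ℤ ≤ p (m - 1ℤ) → C (+ 6 * n) + 1ℤ ≤ 0ℤ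
  C-negative h = ≤-trans (+-monoˡ-≤ 1ℤ (C₀-bound n)) (≤-from
      (trans (cong (λ z → 0ℤ - (z + 1ℤ)) (cong₂ _+_ (cong₂ _-_ (cong₂ _-_ (cong₂ _-_ (cong₂ _-_ (cong₂ _+_ (cong₂ _-_ u₀ u₃) u₆) (cong₂ _-_ u₁ u₄)) (cong (+ 2 *_) (cong₂ _-_ u₂ u₅))) (cong (+ 2 *_) (cong₂ _-_ v₀ v₃))) (cong₂ _-_ v₁ v₄)) v₂))
             (e (ap 0 1) (ap 0 4) (ap 3 7) (ap 5 10) (ap 3 13) (ap 10 16) (ap 13 19) (ap 1 2) (ap 5 5) (ap 6 8) (ap 9 11) (ap 17 14) (p (m - 0ℤ)) (p (m - + 5))))
      (+-nonneg (+-nonneg (+-nonneg (+-nonneg (+-nonneg (slack i₁) (slack (i₂ h))) (slack i₃)) (slack i₄)) (slack i₅)) (slack i₆)))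
    where
    e : ∀ u0 u1 u2 u3 u4 u5 u6 v0 v1 v2 v3 v4 p0 p5 → 0ℤ - ((u0 - u3 + u6) - (u1 - u4) - + 2 * (u2 - u5) - + 2 * (v0 - v3) - (v1 - v4) + v2 + 1ℤ) ≡ (u1 - (p0 + (v3 + v3))) + (p0 + (v0 + v0) - (u0 + 1ℤ)) + (u2 - u4) + (u2 - v2) + (u3 - (p5 + v4)) + (v1 + p5 - (u5 + (u5 + u6)))
    e = solve-∀

module Zero₂ (m : ℤ) where

  private
    n = + 3 * m + + 2
    module K = Class₀ n
    open Progressions m

    u₀ : K.U.fam 0ℤ ≡ ap 0 1
    u₀ = trans (K.U.fam-+ 0) (trans (Q-to-R 0ℤ 1 (+ 2) m) (only₂ (ap 0 1)))
    u₁ : K.U.fam 1ℤ ≡ ap 1 4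
    u₁ = trans (K.U.fam-+ 1) (trans (Q-to-R 1ℤ 4 (+ 2) m) (only₁ (ap 1 4)))
    u₂ : K.U.fam (+ 2) ≡ ap 5 7
    u₂ = trans (K.U.fam-+ 2) (trans (Q-to-R (+ 3) 7 (+ 2) m) (only₂ (ap 5 7)))
    u₃ : K.U.fam (+ 3) ≡ ap 8 10
    u₃ = trans (K.U.fam-+ 3) (trans (Q-to-R (+ 6) 10 (+ 2) m) (only₂ (ap 8 10)))
    u₄ : K.U.fam (+ 4) ≡ ap 7 13
    u₄ = trans (K.U.fam-+ 4) (trans (Q-to-R (+ 10) 13 (+ 2) m) (only₁ (ap 7 13)))
    u₅ : K.U.fam (+ 5) ≡ ap 15 16
    u₅ = trans (K.U.fam-+ 5) (trans (Q-to-R (+ 15) 16 (+ 2) m) (only₂ (ap 15 16)))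
    u₆ : K.U.fam (+ 6) ≡ ap 19 19
    u₆ = trans (K.U.fam-+ 6) (trans (Q-to-R (+ 21) 19 (+ 2) m) (only₂ (ap 19 19)))
    v₀ : K.V.fam 0ℤ ≡ ap 0 2
    v₀ = trans (K.V.fam-+ 0) (trans (Q-to-R (+ 2) 2 (+ 2) m) (only₀ (ap 0 2)))
    v₁ : K.V.fam 1ℤ ≡ ap 3 5
    v₁ = trans (K.V.fam-+ 1) (trans (Q-to-R (+ 6) 5 (+ 2) m) (only₁ (ap 3 5)))
    v₂ : K.V.fam (+ 2) ≡ ap 3 8
    v₂ = trans (K.V.fam-+ 2) (trans (Q-to-R (+ 11) 8 (+ 2) m) (only₀ (ap 3 8)))
    v₃ : K.V.fam (+ 3) ≡ ap 5 11
    v₃ = trans (K.V.fam-+ 3) (trans (Q-to-R (+ 17) 11 (+ 2) m) (only₀ (ap 5 11)))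
    v₄ : K.V.fam (+ 4) ≡ ap 12 14
    v₄ = trans (K.V.fam-+ 4) (trans (Q-to-R (+ 24) 14 (+ 2) m) (only₁ (ap 12 14)))

    -- `ap 0 1` splits into `ap 0 2` and `ap 1 2`; comparing the latter with `ap 0 2` after removing
    -- both leading terms exchanges `p(m-1)` for `p(m)`.
    i₁ : ap 0 1 + p (m - 0ℤ) ≤ ap 0 2 + ap 0 2 + p (m - 1ℤ)
    i₁ = ≤-trans (≤-reflexive (trans (cong (_+ p (m - 0ℤ)) (trans (two 0 1) (cong (λ z → ap 0 2 + z) (peel 1 2)))) (e (ap 0 2) (p (m - 1ℤ)) (ap 3 2) (p (m - 0ℤ)))))
      (+-monoˡ-≤ (p (m - 1ℤ)) (+-monoʳ-≤ (ap 0 2) (≤-trans (+-monoʳ-≤ (p (m - 0ℤ)) (le 2 2 3 2 1 0 refl refl)) (≤-reflexive (sym (peel 0 2))))))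
      where
      e : ∀ a b c d → a + (b + c) + d ≡ a + (d + c) + b
      e = solve-∀

    i₂ : ap 5 11 ≤ ap 5 7
    i₂ = le 5 7 5 11 0 4 refl refl

    i₃ : ap 3 8 + ap 15 16 ≤ ap 3 5
    i₃ = ≤-trans (≤-reflexive (trans (cong (_+ ap 15 16) (two 3 8)) (+-assoc (ap 3 16) (ap 11 16) (ap 15 16))))
      (≤-trans (+-mono-≤ (le 3 15 3 16 0 1 refl refl) (+-mono-≤ (le 8 15 11 16 3 1 refl refl) (le 13 15 15 16 2 1 refl refl))) (≤-reflexive (sym (three 3 5))))

    i₄ : ap 15 16 ≤ ap 8 10
    i₄ = le 8 10 15 16 7 6 refl refl

    -- The thirds of `ap 1 4` dominate the three progressions. Trading the leading `p(m-1)` of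
    -- `ap 1 12` for the leading `p(m-7)` of `ap 7 13` supplies the `p(m-1)` owed by `i₁`.
    i₅ : ap 7 13 + (ap 12 14 + ap 19 19) + p (m - 1ℤ) ≤ ap 1 4 + p (m - + 7)
    i₅ = ≤-trans (≤-reflexive (trans (cong (λ z → z + (ap 12 14 + ap 19 19) + p (m - 1ℤ)) (peel 7 13)) (e (p (m - + 7)) (ap 20 13) (ap 12 14 + ap 19 19) (p (m - 1ℤ)))))
      (≤-trans (+-monoˡ-≤ (p (m - + 7)) (+-mono-≤ (≤-trans (+-monoʳ-≤ (p (m - 1ℤ)) (le 13 12 20 13 7 1 refl refl)) (≤-reflexive (sym (peel 1 12))))
          (+-mono-≤ (le 5 12 12 14 7 2 refl refl) (le 9 12 19 19 10 7 refl refl))))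
        (≤-reflexive (cong (_+ p (m - + 7)) (sym (three 1 4)))))
      where
      e : ∀ a b c d → a + b + c + d ≡ d + b + c + a
      e = solve-∀

  C-negative : p (m - + 7) + 1ℤ ≤ p (m - 0ℤ) → C (+ 6 * n) + 1ℤ ≤ 0ℤ
  C-negative h = ≤-trans (+-monoˡ-≤ 1ℤ (C₀-bound n)) (≤-from
      (trans (cong (λ z → 0ℤ - (z + 1ℤ)) (cong₂ _+_ (cong₂ _-_ (cong₂ _-_ (cong₂ _-_ (cong₂ _-_ (cong₂ _+_ (cong₂ _-_ u₀ u₃) u₆) (cong₂ _-_ u₁ u₄)) (cong (+ 2 *_) (cong₂ _-_ u₂ u₅))) (cong (+ 2 *_) (cong₂ _-_ v₀ v₃))) (cong₂ _-_ v₁ v₄)) v₂))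
             (e (ap 0 1) (ap 1 4) (ap 5 7) (ap 8 10) (ap 7 13) (ap 15 16) (ap 19 19) (ap 0 2) (ap 3 5) (ap 3 8) (ap 5 11) (ap 12 14) (p (m - 0ℤ)) (p (m - 1ℤ)) (p (m - + 7))))
      (+-nonneg (+-nonneg (+-nonneg (+-nonneg (+-nonneg (+-nonneg (slack i₁) (slack i₂)) (slack i₂)) (slack i₃)) (slack i₄)) (slack i₅)) (slack h)))
    where
    e : ∀ u0 u1 u2 u3 u4 u5 u6 v0 v1 v2 v3 v4 p0 p1 p7 → 0ℤ - ((u0 - u3 + u6) - (u1 - u4) - + 2 * (u2 - u5) - + 2 * (v0 - v3) - (v1 - v4) + v2 + 1ℤ) ≡ (v0 + v0 + p1 - (u0 + p0)) + (u2 - v3) + (u2 - v3) + (v1 - (v2 + u5)) + (u3 - u5) + (u1 + p7 - (u4 + (v4 + u6) + p1)) + (p0 - (p7 + 1ℤ))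
    e = solve-∀

-- The classes n ≡ 1 and n ≡ 2 (mod 3)

module _ (n : ℤ) where

  private
    g : ℕ → ℤ
    g i = P₉ (+ 6 * n - + 6 * + i)

    le : ∀ a d .{{_ : NonZero d}} a′ d′ .{{_ : NonZero d′}} u w → + a′ ≡ + a + + 18 * + u → + d′ ≡ + d + + 18 * + w → Q.ap (+ a′) d′ (+ 6 * n) ≤ Q.ap (+ a) d (+ 6 * n)
    le a d a′ d′ u w ea ed = Q.ap-≤ 18 P₉-step {+ a} {+ a′} {d} {d′} u w ea ed (+ 6 * n)

    X = + 6 * n

  -- With all weights positive, five of the alternating sums are dropped. In
  -- `U.fam 0ℤ - U.fam (+ 3)` the part of the first progression from 18 on dominates the second, and
  -- the three terms before it remain.
  C₁-positive : 1ℤ ≤ g 0 + (g 1 + g 2) → 1ℤ ≤ C (+ 6 * n + + 2)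
  C₁-positive h = ≤-trans h (≤-trans first (≤-from (trans (cong (_- (U.fam 0ℤ - U.fam (+ 3))) C-value₁) (e U.alt₀ U.alt₁ U.alt₂ V.alt₀ V.alt₁ V.alt₂ (U.fam 0ℤ - U.fam (+ 3))))
    (+-nonneg (slack (alternating-≥ U.D₀)) (+-nonneg (+-nonneg (2*-nonneg (alternating-nonneg U.D₁)) (alternating-nonneg U.D₂))
      (+-nonneg (alternating-nonneg V.D₀) (+-nonneg (2*-nonneg (alternating-nonneg V.D₁)) (alternating-nonneg V.D₂)))))))
    where
    open Class₁ n
    e : ∀ A₀ A₁ A₂ B₀ B₁ B₂ b → 1ℤ * A₀ + (- (- + 2) * A₁ + 1ℤ * A₂) + (1ℤ * B₀ + (- (- + 2) * B₁ + 1ℤ * B₂)) - b ≡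
        (A₀ - b) + (+ 2 * A₁ + A₂ + (B₀ + (+ 2 * B₁ + B₂)))
    e = solve-∀
    u₀ : U.fam 0ℤ ≡ g 0 + (g 1 + (g 2 + Q.ap (+ 18) 6 X))
    u₀ = trans (U.fam-+ 0) (trans (Q.ap-peel 0ℤ 6 X) (cong (λ z → g 0 + z) (trans (Q.ap-peel (+ 6) 6 X) (cong (λ z → g 1 + z) (Q.ap-peel (+ 12) 6 X)))))
    u₃ : U.fam (+ 3) ≤ Q.ap (+ 18) 6 X
    u₃ = ≤-trans (≤-reflexive (U.fam-+ 3)) (le 18 6 54 60 2 3 refl refl)
    f : ∀ a b c q u → a + (b + (c + q)) - u - (a + (b + c)) ≡ q - u
    f = solve-∀
    first : g 0 + (g 1 + g 2) ≤ U.fam 0ℤ - U.fam (+ 3)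
    first = ≤-from (trans (cong (λ z → z - U.fam (+ 3) - (g 0 + (g 1 + g 2))) u₀) (f (g 0) (g 1) (g 2) (Q.ap (+ 18) 6 X) (U.fam (+ 3)))) (slack u₃)

  -- `V.fam 0ℤ` is every second term of `U.fam 0ℤ`, so `2 u₀ - v₀` is `v₀` plus twice the other
  -- half. From `v₀` the part `Q.ap 24 24` pays for `u₂`, from the other half `Q.ap 18 24` pays for
  -- `u₃`, and `g 0`, `g 1`, `g 2` are left.
  C₂-negative : 1ℤ ≤ g 0 + (g 1 + g 2) → C (+ 6 * n + + 4) + 1ℤ ≤ 0ℤ
  C₂-negative h = ≤-from (trans (cong (λ z → 0ℤ - (z + 1ℤ)) C-value₂) (e U.alt₀ U.alt₁ U.alt₂ V.alt₀ V.alt₁ V.alt₂ (U.fam 0ℤ) (U.fam (+ 3)) (U.fam (+ 2)) (V.fam 0ℤ)))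
    (+-nonneg (+-nonneg (2*-nonneg (slack (alternating-≥ U.D₀))) (+-nonneg (alternating-nonneg U.D₁) (slack (alternating-≤ U.D₂))))
      (+-nonneg (+-nonneg (slack (alternating-≤ V.D₀)) (+-nonneg (alternating-nonneg V.D₁) (2*-nonneg (alternating-nonneg V.D₂)))) main))
    where
    open Class₂ n
    e : ∀ A₀ A₁ A₂ B₀ B₁ B₂ u₀ u₃ u₂ v₀ → 0ℤ - ((- + 2) * A₀ + (- 1ℤ * A₁ + 1ℤ * A₂) + (1ℤ * B₀ + (- 1ℤ * B₁ + (- + 2) * B₂)) + 1ℤ) ≡
        + 2 * (A₀ - (u₀ - u₃)) + (A₁ + (u₂ - A₂)) + ((v₀ - B₀) + (B₁ + + 2 * B₂) + (+ 2 * (u₀ - u₃) - u₂ - v₀ - 1ℤ))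
    e = solve-∀
    v₀ : V.fam 0ℤ ≡ g 0 + Q.ap (+ 24) 24 X + (g 2 + Q.ap (+ 36) 24 X)
    v₀ = trans (V.fam-+ 0) (trans (Q.ap-split2 0ℤ 12 X) (cong₂ _+_ (Q.ap-peel 0ℤ 24 X) (Q.ap-peel (+ 12) 24 X)))
    u₀ : U.fam 0ℤ ≡ V.fam 0ℤ + (g 1 + Q.ap (+ 30) 24 X + Q.ap (+ 18) 24 X)
    u₀ = trans (U.fam-+ 0) (trans (Q.ap-split2 0ℤ 6 X) (cong₂ _+_ (sym (V.fam-+ 0)) (trans (Q.ap-split2 (+ 6) 12 X) (cong (_+ Q.ap (+ 18) 24 X) (Q.ap-peel (+ 6) 24 X)))))
    u₂ : U.fam (+ 2) ≤ Q.ap (+ 24) 24 X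
    u₂ = ≤-trans (≤-reflexive (U.fam-+ 2)) (le 24 24 42 42 1 1 refl refl)
    u₃ : U.fam (+ 3) ≤ Q.ap (+ 18) 24 X
    u₃ = ≤-trans (≤-reflexive (U.fam-+ 3)) (le 18 24 72 60 3 2 refl refl)
    f : ∀ g₀ g₁ g₂ x₄₄ x₆₄ x₅₄ x₃₄ u₂ u₃ v → v ≡ g₀ + x₄₄ + (g₂ + x₆₄) → + 2 * (v + (g₁ + x₅₄ + x₃₄) - u₃) - u₂ - v - 1ℤ ≡
        (g₀ + (g₁ + g₂) - 1ℤ) + (g₁ + x₆₄ + + 2 * x₅₄) + ((x₄₄ - u₂) + + 2 * (x₃₄ - u₃))
    f g₀ g₁ g₂ x₄₄ x₆₄ x₅₄ x₃₄ u₂ u₃ v refl = f′ g₀ g₁ g₂ x₄₄ x₆₄ x₅₄ x₃₄ u₂ u₃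
      where
      f′ : ∀ g₀ g₁ g₂ x₄₄ x₆₄ x₅₄ x₃₄ u₂ u₃ → + 2 * (g₀ + x₄₄ + (g₂ + x₆₄) + (g₁ + x₅₄ + x₃₄) - u₃) - u₂ - (g₀ + x₄₄ + (g₂ + x₆₄)) - 1ℤ ≡
          (g₀ + (g₁ + g₂) - 1ℤ) + (g₁ + x₆₄ + + 2 * x₅₄) + ((x₄₄ - u₂) + + 2 * (x₃₄ - u₃))
      f′ = solve-∀
    main : 0ℤ ≤ + 2 * (U.fam 0ℤ - U.fam (+ 3)) - U.fam (+ 2) - V.fam 0ℤ - 1ℤ
    main = subst (0ℤ ≤_) (sym (trans (cong (λ z → + 2 * (z - U.fam (+ 3)) - U.fam (+ 2) - V.fam 0ℤ - 1ℤ) u₀)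
        (f (g 0) (g 1) (g 2) (Q.ap (+ 24) 24 X) (Q.ap (+ 36) 24 X) (Q.ap (+ 30) 24 X) (Q.ap (+ 18) 24 X) (U.fam (+ 2)) (U.fam (+ 3)) (V.fam 0ℤ) v₀)))
      (+-nonneg (+-nonneg (slack h) (+-nonneg (+-nonneg (P₉-nonneg (+ 6 * n - + 6 * + 1)) (Q.ap-nonneg (+ 36) 24 X)) (2*-nonneg (Q.ap-nonneg (+ 30) 24 X))))
        (+-nonneg (slack u₂) (2*-nonneg (slack u₃))))

-- Of three consecutive multiples of 6 one is divisible by 18; here it is `18m`, where `P₉` has the
-- value `p(m) ≥ 1`.
P₉-near : ∀ m ρ → ρ ℕ.< 3 → 1ℤ ≤ P₉ (+ 6 * (+ 3 * + m + + ρ) - + 6 * + 0) + (P₉ (+ 6 * (+ 3 * + m + + ρ) - + 6 * + 1) + P₉ (+ 6 * (+ 3 * + m + + ρ) - + 6 * + 2))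
P₉-near m ρ l = go ρ l
  where
  at : ∀ ρ → 1ℤ ≤ P₉ (+ 6 * (+ 3 * + m + + ρ) - + 6 * + ρ)
  at ρ = subst (1ℤ ≤_) (sym (trans (cong P₉ (e (+ m) (+ ρ))) (P₉-18 (+ m)))) (p-positive m)
    where
    e : ∀ m ρ → + 6 * (+ 3 * m + ρ) - + 6 * ρ ≡ + 18 * m
    e = solve-∀
  sum≥₀ : ∀ {a b c} → 1ℤ ≤ a → 0ℤ ≤ b → 0ℤ ≤ c → 1ℤ ≤ a + (b + c)
  sum≥₀ h p q = +-mono-≤ h (+-nonneg p q)
  sum≥₁ : ∀ {a b c} → 0ℤ ≤ a → 1ℤ ≤ b → 0ℤ ≤ c → 1ℤ ≤ a + (b + c)
  sum≥₁ p h q = +-mono-≤ p (+-mono-≤ h q)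
  sum≥₂ : ∀ {a b c} → 0ℤ ≤ a → 0ℤ ≤ b → 1ℤ ≤ c → 1ℤ ≤ a + (b + c)
  sum≥₂ p q h = +-mono-≤ p (+-mono-≤ q h)
  go : ∀ ρ → ρ ℕ.< 3 → 1ℤ ≤ P₉ (+ 6 * (+ 3 * + m + + ρ) - + 6 * + 0) + (P₉ (+ 6 * (+ 3 * + m + + ρ) - + 6 * + 1) + P₉ (+ 6 * (+ 3 * + m + + ρ) - + 6 * + 2))
  go 0 _ = sum≥₀ (at 0) (P₉-nonneg (+ 6 * (+ 3 * + m + + 0) - + 6 * + 1)) (P₉-nonneg (+ 6 * (+ 3 * + m + + 0) - + 6 * + 2))
  go 1 _ = sum≥₁ (P₉-nonneg (+ 6 * (+ 3 * + m + + 1) - + 6 * + 0)) (at 1) (P₉-nonneg (+ 6 * (+ 3 * + m + + 1) - + 6 * + 2))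
  go 2 _ = sum≥₂ (P₉-nonneg (+ 6 * (+ 3 * + m + + 2) - + 6 * + 0)) (P₉-nonneg (+ 6 * (+ 3 * + m + + 2) - + 6 * + 1)) (at 2)
  go (suc (suc (suc _))) (s≤s (s≤s (s≤s ())))

-- From the sign of `C` to the theorem, by residues modulo 9

N-diff-< : ∀ n → C (+ 2 * + suc n) + 1ℤ ≤ 0ℤ → N (+ 0) 3 (suc n) < N (+ 1) 3 (suc n)
N-diff-< n h = drop‿+≤+ (≤-from (e (+ N (+ 0) 3 (suc n)) (+ N (+ 1) 3 (suc n))) (slack (subst (λ z → z + 1ℤ ≤ 0ℤ) (sym (N-C n)) h)))
  where
  e : ∀ a b → b - (1ℤ + a) ≡ 0ℤ - (a - b + 1ℤ)
  e = solve-∀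

N-diff-> : ∀ n → 1ℤ ≤ C (+ 2 * + suc n) → N (+ 0) 3 (suc n) > N (+ 1) 3 (suc n)
N-diff-> n h = drop‿+≤+ (≤-from (e (+ N (+ 0) 3 (suc n)) (+ N (+ 1) 3 (suc n))) (slack (subst (1ℤ ≤_) (sym (N-C n)) h)))
  where
  e : ∀ a b → a - (1ℤ + b) ≡ a - b - 1ℤ
  e = solve-∀

module _ (q : ℕ) where

  private
    at₀ : ∀ ρ → + 2 * (+ 3 * + ρ + + (q ℕ.* 9)) ≡ + 6 * (+ 3 * + q + + ρ)
    at₀ ρ = trans (cong (λ z → + 2 * (+ 3 * + ρ + z)) (pos-* q 9)) (e (+ q) (+ ρ))
      where
      e : ∀ q ρ → + 2 * (+ 3 * ρ + q * + 9) ≡ + 6 * (+ 3 * q + ρ)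
      e = solve-∀

    at₁ : ∀ ρ → + 2 * (+ 3 * + ρ + 1ℤ + + (q ℕ.* 9)) ≡ + 6 * (+ 3 * + q + + ρ) + + 2
    at₁ ρ = trans (cong (λ z → + 2 * (+ 3 * + ρ + 1ℤ + z)) (pos-* q 9)) (e (+ q) (+ ρ))
      where
      e : ∀ q ρ → + 2 * (+ 3 * ρ + 1ℤ + q * + 9) ≡ + 6 * (+ 3 * q + ρ) + + 2
      e = solve-∀

    at₂ : ∀ ρ → + 2 * (+ 3 * + ρ + + 2 + + (q ℕ.* 9)) ≡ + 6 * (+ 3 * + q + + ρ) + + 4
    at₂ ρ = trans (cong (λ z → + 2 * (+ 3 * + ρ + + 2 + z)) (pos-* q 9)) (e (+ q) (+ ρ))
      where
      e : ∀ q ρ → + 2 * (+ 3 * ρ + + 2 + q * + 9) ≡ + 6 * (+ 3 * q + ρ) + + 4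
      e = solve-∀

  C-at₁ : ∀ ρ → ρ ℕ.< 3 → 1ℤ ≤ C (+ 2 * (+ 3 * + ρ + 1ℤ + + (q ℕ.* 9)))
  C-at₁ ρ l = subst (λ z → 1ℤ ≤ C z) (sym (at₁ ρ)) (C₁-positive (+ 3 * + q + + ρ) (P₉-near q ρ l))

  C-at₂ : ∀ ρ → ρ ℕ.< 3 → C (+ 2 * (+ 3 * + ρ + + 2 + + (q ℕ.* 9))) + 1ℤ ≤ 0ℤ
  C-at₂ ρ l = subst (λ z → C z + 1ℤ ≤ 0ℤ) (sym (at₂ ρ)) (C₂-negative (+ 3 * + q + + ρ) (P₉-near q ρ l))

  -- The number is `9q`. For `q = k + 2` the strict step `p(q-5) < p(q-2)` reads `p(k-3) < p(k)`. At
  -- `q = 1`, the number 9, both values are 0.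
  C-at-0 : q ≢ 0 → q ≢ 1 → C (+ 2 * (0ℤ + + (q ℕ.* 9))) + 1ℤ ≤ 0ℤ
  C-at-0 ne₀ ne₁ = subst (λ z → C z + 1ℤ ≤ 0ℤ) (sym (at₀ 0)) (go q ne₀ ne₁)
    where
    e : ∀ k → + 2 + k - + 5 ≡ k - + 3
    e = solve-∀
    e′ : ∀ k → + 2 + k - + 2 ≡ k
    e′ = solve-∀
    go : ∀ q → q ≢ 0 → q ≢ 1 → C (+ 6 * (+ 3 * + q + + 0)) + 1ℤ ≤ 0ℤ
    go 0 ne₀ _ = ⊥-elim (ne₀ refl)
    go 1 _ ne₁ = ⊥-elim (ne₁ refl)
    go q@(suc (suc k)) _ _ = Zero₀.C-negative (+ q)
      (subst (λ z → p z ≤ p (+ q - 1ℤ) + p (+ q - + 2)) (sym (+-identityʳ (+ q))) (p-subadditive (suc k)))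
      (subst₂ (λ a b → p a + 1ℤ ≤ p b) (sym (e (+ k))) (sym (e′ (+ k))) (p-increment₃ k))

  -- The number is `9q + 3`, and `p(q-2) < p(q-1)` is required. It fails at `q = 0`, where both are
  -- 0, and at `q = 2`, where both are 1: the numbers 3 and 21.
  C-at-3 : q ≢ 0 → q ≢ 2 → C (+ 2 * (+ 3 + + (q ℕ.* 9))) + 1ℤ ≤ 0ℤ
  C-at-3 ne₀ ne₂ = subst (λ z → C z + 1ℤ ≤ 0ℤ) (sym (at₀ 1)) (go q ne₀ ne₂)
    where
    e : ∀ k → 1ℤ + k - + 2 ≡ k - 1ℤ
    e = solve-∀
    e′ : ∀ k → 1ℤ + k - 1ℤ ≡ k
    e′ = solve-∀
    go : ∀ q → q ≢ 0 → q ≢ 2 → C (+ 6 * (+ 3 * + q + + 1)) + 1ℤ ≤ 0ℤ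
    go 0       ne₀ _ = ⊥-elim (ne₀ refl)
    go (suc k) _ ne₂ = Zero₁.C-negative (+ suc k)
      (subst₂ (λ a b → p a + 1ℤ ≤ p b) (sym (e (+ k))) (sym (e′ (+ k))) (p-increment₁ k (λ { refl → ne₂ refl })))

  -- The number is `9q + 6`. The step `p(q-7) < p(q)` holds for every `q`, so this class has no
  -- exception.
  C-at-6 : C (+ 2 * (+ 6 + + (q ℕ.* 9))) + 1ℤ ≤ 0ℤ
  C-at-6 = subst (λ z → C z + 1ℤ ≤ 0ℤ) (sym (at₀ 2)) (Zero₂.C-negative (+ q)
    (subst (λ z → p (+ q - + 7) + 1ℤ ≤ p z) (sym (+-identityʳ (+ q)))
      (≤-trans (+-monoˡ-≤ 1ℤ (subst (λ z → p z ≤ p (+ q - + 3)) (e (+ q)) (p-monotone⁺ 4 (+ q - + 3)))) (p-increment₃ q))))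
    where
    e : ∀ q → q - + 3 - + 4 ≡ q - + 7
    e = solve-∀

mod-9-3 : ∀ r q → (r ℕ.+ q ℕ.* 9) % 3 ≡ r % 3
mod-9-3 r q = trans (cong (λ z → (r ℕ.+ z) % 3) (sym (ℕₚ.*-assoc q 3 3))) ([m+kn]%n≡m%n r (q ℕ.* 3) 3)

by-residue : (S : ℕ → Set) → (∀ r q → r < 9 → S (r ℕ.+ q ℕ.* 9)) → ∀ n → S n
by-residue S h n = subst S (sym (m≡m%n+[m/n]*n n 9)) (h (n % 9) (n ℕ./ 9) (m%n<n n 9))

not-0-or-2 : ¬ (1 ≡ 0 ⊎ 1 ≡ 2)
not-0-or-2 (inj₁ ())
not-0-or-2 (inj₂ ())

0≢1 : 0 ≢ 1
0≢1 ()

2≢1 : 2 ≢ 1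
2≢1 ()

negative-case : ∀ r q → r < 9 → let n = r ℕ.+ q ℕ.* 9 in 0 < n → (n % 3 ≡ 0 ⊎ n % 3 ≡ 2) → n ≢ 3 → n ≢ 9 → n ≢ 21 → N (+ 0) 3 n < N (+ 1) 3 n
negative-case 0 0       _ () _ _ _ _
negative-case 0 (suc q) _ _ _ _ ne₉ _ = N-diff-< (8 ℕ.+ q ℕ.* 9) (C-at-0 (suc q) (λ ()) (λ { refl → ne₉ refl }))
negative-case 1 q _ _ c _ _ _ = ⊥-elim (not-0-or-2 (Sum.map (trans (sym (mod-9-3 1 q))) (trans (sym (mod-9-3 1 q))) c))
negative-case 2 q _ _ _ _ _ _ = N-diff-< (1 ℕ.+ q ℕ.* 9) (C-at₂ q 0 (s≤s z≤n))
negative-case 3 q _ _ _ ne₃ _ ne₂₁ = N-diff-< (2 ℕ.+ q ℕ.* 9) (C-at-3 q (λ { refl → ne₃ refl }) (λ { refl → ne₂₁ refl }))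
negative-case 4 q _ _ c _ _ _ = ⊥-elim (not-0-or-2 (Sum.map (trans (sym (mod-9-3 4 q))) (trans (sym (mod-9-3 4 q))) c))
negative-case 5 q _ _ _ _ _ _ = N-diff-< (4 ℕ.+ q ℕ.* 9) (C-at₂ q 1 (s≤s (s≤s z≤n)))
negative-case 6 q _ _ _ _ _ _ = N-diff-< (5 ℕ.+ q ℕ.* 9) (C-at-6 q)
negative-case 7 q _ _ c _ _ _ = ⊥-elim (not-0-or-2 (Sum.map (trans (sym (mod-9-3 7 q))) (trans (sym (mod-9-3 7 q))) c))
negative-case 8 q _ _ _ _ _ _ = N-diff-< (7 ℕ.+ q ℕ.* 9) (C-at₂ q 2 ℕₚ.≤-refl)
negative-case (suc (suc (suc (suc (suc (suc (suc (suc (suc r))))))))) q l = ⊥-elim (ℕₚ.m+n≮m 9 r l)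

positive-case : ∀ r q → r < 9 → let n = r ℕ.+ q ℕ.* 9 in 0 < n → n % 3 ≡ 1 → N (+ 0) 3 n > N (+ 1) 3 n
positive-case 0 q _ _ e = ⊥-elim (0≢1 (trans (sym (mod-9-3 0 q)) e))
positive-case 1 q _ _ _ = N-diff-> (q ℕ.* 9) (C-at₁ q 0 (s≤s z≤n))
positive-case 2 q _ _ e = ⊥-elim (2≢1 (trans (sym (mod-9-3 2 q)) e))
positive-case 3 q _ _ e = ⊥-elim (0≢1 (trans (sym (mod-9-3 3 q)) e))
positive-case 4 q _ _ _ = N-diff-> (3 ℕ.+ q ℕ.* 9) (C-at₁ q 1 (s≤s (s≤s z≤n)))
positive-case 5 q _ _ e = ⊥-elim (2≢1 (trans (sym (mod-9-3 5 q)) e))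
positive-case 6 q _ _ e = ⊥-elim (0≢1 (trans (sym (mod-9-3 6 q)) e))
positive-case 7 q _ _ _ = N-diff-> (6 ℕ.+ q ℕ.* 9) (C-at₁ q 2 ℕₚ.≤-refl)
positive-case 8 q _ _ e = ⊥-elim (2≢1 (trans (sym (mod-9-3 8 q)) e))
positive-case (suc (suc (suc (suc (suc (suc (suc (suc (suc r))))))))) q l = ⊥-elim (ℕₚ.m+n≮m 9 r l)

theorem2 : (∀ (n : ℕ) → 0 < n → (n % 3 ≡ 0 ⊎ n % 3 ≡ 2) → n ≢ 3 → n ≢ 9 → n ≢ 21 →
    N (+ 0) 3 n < N (+ 1) 3 n)
    × (∀ (n : ℕ) → 0 < n → n % 3 ≡ 1 → N (+ 0) 3 n > N (+ 1) 3 n)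
    × (N (+ 0) 3 3 ≡ N (+ 1) 3 3 × N (+ 0) 3 9 ≡ N (+ 1) 3 9 × N (+ 0) 3 21 ≡ N (+ 1) 3 21)
theorem2 = by-residue (λ n → 0 < n → (n % 3 ≡ 0 ⊎ n % 3 ≡ 2) → n ≢ 3 → n ≢ 9 → n ≢ 21 → N (+ 0) 3 n < N (+ 1) 3 n) negative-case
         , by-residue (λ n → 0 < n → n % 3 ≡ 1 → N (+ 0) 3 n > N (+ 1) 3 n) positive-case
         -- The three equalities hold by evaluation over the enumerated partitions of 3, 9 and 21.
         , refl , refl , refl
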